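{- Let $n\ge2$. A complete set of primitive orthogonal idempotents of the algebra $\mathcal{W}^\pm_n$ is given by $\frac12(I^+_{k,n}+I^-_{k,n})$ for $1\le k\le n$, $k\equiv n\pmod2$; $\frac12(J^+_{l,n}+J^-_{l,n}-I^+_{l,n}-I^-_{l,n})$ for $0\le l\le n-4$, $l\equiv n\pmod 2$; and $\frac12(J^+_{m,n}-J^-_{m,n})$ for $0\le m\le n-2$, $m\equiv n\pmod 2$.
   Context: Noncommutative symmetric functions: $\mathbf{Sym}=\bigoplus_n\mathbf{Sym}_n$ over $\mathbb{Q}$ with ribbon basis $R_I$ ($I$ compositions of $n$; a composition $(i_1,\dots,i_r)$ has descent set $\{i_1,\dots,i_1+\dots+i_{r-1}\}$), $R_\emptyset=1$. $\mathbf{Sym}_n$ is identified with the descent algebra $\mathcal{D}_n\subseteq\mathbb{Q}[\mathfrak{S}_n]$ via $R_I\mapsto\sum\{\sigma:\mathrm{Des}(\sigma)=\text{descent set of }I\}$, $\mathrm{Des}(\sigma)=\{i:\sigma(i)>\sigma(i+1)\}$; the internal product is that of $\mathbb{Q}[\mathfrak{S}_n]$ (with $(\alpha\beta)(i)=\alpha(\beta(i))$) in each degree and zero across degrees. External product: $R_{(i_1,\dots,i_r)}\star R_{(j_1,\dots,j_s)}=R_{(i_1,\dots,i_r,j_1,\dots,j_s)}+R_{(i_1,\dots,i_{r-1},i_r+j_1,j_2,\dots,j_s)}$; both products extend to the completion $\widehat{\mathbf{Sym}}$ of formal sums of homogeneous elements. For $F$ with zero degree-$0$ part, $\log_\star(1+F)=\sum_{m\ge1}\frac{(-1)^{m-1}}{m}F^{\star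 m}$, $\exp_\star F=\sum_{m\ge0}\frac1{m!}F^{\star m}$, and $(1+F)^{\star c}=\exp_\star(c\log_\star(1+F))$ for $c\in\mathbb{Q}$. Let $V_1^+=\sum_{i\ge0}R_{(i)}$, $V_1^-=\sum_{i\ge0}R_{(1^i)}$, $V_2^+=V_1^+\star V_1^-$, $V_2^-=V_1^-\star V_1^+$; $I_1^-=\frac12\log_\star V_2^-$, $I_1^+=\frac12\log_\star V_2^+$, $I_k^\pm=\frac1{k!}(I_1^\pm)^{\star k}$ ($I_0^\pm=1$), $J_0^+=V_1^+\star(V_2^-)^{\star(-1/2)}$, $J_0^-=V_1^-\star(V_2^+)^{\star(-1/2)}$, $J_k^+=J_0^+\star I_k^-$, $J_k^-=J_0^-\star I_k^+$; subscripts $k,n$ denote degree-$n$ components. An alternating run of $\sigma\in\mathfrak{S}_n$ is a maximal monotone sequence of consecutive entries of $\sigma(1),\dots,\sigma(n)$; $W_k^+$ (resp. $W_k^-$) is the sum of all $\sigma\in\mathfrak{S}_n$ with exactly $k$ alternating runs whose first run is ascending (resp. descending), and $\mathcal{W}_n^\pm=\mathrm{span}\{W_k^+,W_k^-:1\le k\le n-1\}$, a subalgebra of $\mathbb{Q}[\mathfrak{S}_n]$. -}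

module Defs where

open import Data.Nat using (ℕ; zero; suc; _+_; _∸_; _<ᵇ_; _≡ᵇ_)
open import Data.Bool using (Bool; true; false; if_then_else_; _∧_; not)
open import Data.List using (List; []; _∷_; _++_; map; concatMap; upTo; replicate; length; lookup)
open import Data.Product using (_×_; _,_; Σ)
open import Data.Sum using (_⊎_)
open import Data.Fin using (Fin)
open import Data.Integer using (+_)
open import Data.Rational using (ℚ; 0ℚ; 1ℚ; ½; -½; _/_) renaming (_+_ to _+q_; _*_ to _*q_; -_ to -q_)
open import Data.List.Relation.Unary.All using (All)
open import Relation.Binary.PropositionalEquality using (_≡_; _≢_)
open import Relation.Nullary using (¬_)

eqL : List ℕ → List ℕ → Bool
eqL [] [] = true
eqL (a ∷ as) (b ∷ bs) = (a ≡ᵇ b) ∧ eqL as bs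
eqL _ _ = false

nth : List ℕ → ℕ → ℕ
nth [] _ = 0
nth (a ∷ _) zero = a
nth (_ ∷ as) (suc i) = nth as i

even : ℕ → Bool
even zero = true
even (suc k) = not (even k)

filterB : {A : Set} → (A → Bool) → List A → List A
filterB p [] = []
filterB p (x ∷ xs) = if p x then x ∷ filterB p xs else filterB p xs

invFact : ℕ → ℚ
invFact zero = 1ℚ
invFact (suc k) = invFact k *q (+ 1 / suc k)

signQ : ℕ → ℚ
signQ zero = 1ℚ
signQ (suc k) = -q (signQ k)

-- Noncommutative symmetric functions (ribbon basis), truncated by degree.
-- A composition is a list of positive naturals; [] is the empty composition.
Comp : Set
Comp = List ℕ

-- finite Q-linear combination of ribbons R_I
LC : Set
LC = List (ℚ × Comp)

scaleLC : ℚ → LC → LC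
scaleLC c = map (λ { (q , I) → (c *q q , I) })

glue : ℕ → Comp → ℕ → Comp → Comp
glue i [] j J = (i + j) ∷ J
glue i (i' ∷ I) j J = i ∷ glue i' I j J

ribbonMul : Comp → Comp → List Comp
ribbonMul [] J = J ∷ []
ribbonMul (i ∷ I) [] = (i ∷ I) ∷ []
ribbonMul (i ∷ I) (j ∷ J) = ((i ∷ I) ++ (j ∷ J)) ∷ glue i I j J ∷ []

lcMul : LC → LC → LC
lcMul xs ys = concatMap (λ { (p , I) → concatMap (λ { (q , J) →
                map (λ K → (p *q q , K)) (ribbonMul I J) }) ys }) xs

-- element of the completion: degree-d homogeneous component for each d
Ser : Set
Ser = ℕ → LC

oneS : Ser
oneS zero = (1ℚ , []) ∷ []
oneS (suc _) = []

addS : Ser → Ser → Ser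
addS F G d = F d ++ G d

scaleS : ℚ → Ser → Ser
scaleS c F d = scaleLC c (F d)

subS : Ser → Ser → Ser
subS F G = addS F (scaleS (-q 1ℚ) G)

mulS : Ser → Ser → Ser
mulS F G d = concatMap (λ i → lcMul (F i) (G (d ∸ i))) (upTo (suc d))

powS : Ser → ℕ → Ser
powS F zero = oneS
powS F (suc m) = mulS F (powS F m)

-- log_⋆ V = log_⋆(1 + (V - 1)) for V with degree-0 part 1.
-- In degree d only the terms m ≤ d of the series contribute (V - 1 has zero
-- degree-0 part), so the degree-d component is the finite sum over 1 ≤ m ≤ d.
logS : Ser → Ser
logS V d = concatMap (λ k → scaleLC (signQ k *q (+ 1 / suc k)) (powS (subS V oneS) (suc k) d))
                     (upTo d)

-- exp_⋆ G for G with zero degree-0 part (degree d: terms m ≤ d)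
expS : Ser → Ser
expS G d = concatMap (λ m → scaleLC (invFact m) (powS G m d)) (upTo (suc d))

rpowS : ℚ → Ser → Ser
rpowS c V = expS (scaleS c (logS V))

V1p : Ser
V1p zero = (1ℚ , []) ∷ []
V1p (suc i) = (1ℚ , suc i ∷ []) ∷ []

V1m : Ser
V1m d = (1ℚ , replicate d 1) ∷ []

V2p V2m : Ser
V2p = mulS V1p V1m
V2m = mulS V1m V1p

I1p I1m : Ser
I1p = scaleS ½ (logS V2p)
I1m = scaleS ½ (logS V2m)

Ikp Ikm : ℕ → Ser
Ikp k = scaleS (invFact k) (powS I1p k)
Ikm k = scaleS (invFact k) (powS I1m k)

J0p J0m : Ser
J0p = mulS V1p (rpowS -½ V2m)
J0m = mulS V1m (rpowS -½ V2p)

Jkp Jkm : ℕ → Ser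
Jkp k = mulS J0p (Ikm k)
Jkm k = mulS J0m (Ikp k)

-- Group algebra Q[S_n].  A permutation σ of {1..n} is encoded in one-line
-- notation shifted to values 0..n-1 (list [σ(1)-1, ..., σ(n)-1]).
-- An element is a finite formal Q-linear combination of permutations.
GA : Set
GA = List (ℚ × List ℕ)

insertAll : ℕ → List ℕ → List (List ℕ)
insertAll x [] = (x ∷ []) ∷ []
insertAll x (y ∷ ys) = (x ∷ y ∷ ys) ∷ map (y ∷_) (insertAll x ys)

perms : ℕ → List (List ℕ)
perms zero = [] ∷ []
perms (suc n) = concatMap (insertAll n) (perms n)

idPerm : ℕ → List ℕ
idPerm n = upTo n

compose : List ℕ → List ℕ → List ℕ
compose α β = map (nth α) β

zeroGA : GA
zeroGA = []

oneGA : ℕ → GA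
oneGA n = (1ℚ , idPerm n) ∷ []

addGA : GA → GA → GA
addGA x y = x ++ y

scaleGA : ℚ → GA → GA
scaleGA c = map (λ { (q , σ) → (c *q q , σ) })

mulGA : GA → GA → GA
mulGA x y = concatMap (λ { (p , α) → map (λ { (q , β) → (p *q q , compose α β) }) y }) x

sumGA : List GA → GA
sumGA [] = []
sumGA (x ∷ xs) = x ++ sumGA xs

coeff : GA → List ℕ → ℚ
coeff [] σ = 0ℚ
coeff ((q , τ) ∷ x) σ = if eqL τ σ then q +q coeff x σ else coeff x σ

_≈_ : GA → GA → Set
x ≈ y = ∀ σ → coeff x σ ≡ coeff y σ

infix 4 _≈_

desAux : ℕ → List ℕ → List ℕ
desAux k (a ∷ b ∷ l) = if b <ᵇ a then k ∷ desAux (suc k) (b ∷ l) else desAux (suc k) (b ∷ l)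
desAux k _ = []

Des : List ℕ → List ℕ
Des = desAux 1

psums : ℕ → Comp → List ℕ
psums acc (i ∷ j ∷ I) = (acc + i) ∷ psums (acc + i) (j ∷ I)
psums acc _ = []

descComp : Comp → List ℕ
descComp = psums 0

ribbonGA : ℕ → Comp → GA
ribbonGA n I = map (λ σ → (1ℚ , σ)) (filterB (λ σ → eqL (Des σ) (descComp I)) (perms n))

lcGA : ℕ → LC → GA
lcGA n lc = concatMap (λ { (q , I) → scaleGA q (ribbonGA n I) }) lc

comp : ℕ → Ser → GA
comp n F = lcGA n (F n)

-- Alternating runs.  Direction of each consecutive pair (true = ascent);
-- the number of alternating runs is 1 + number of direction changes.
dirs : List ℕ → List Bool
dirs (a ∷ b ∷ l) = (a <ᵇ b) ∷ dirs (b ∷ l)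
dirs _ = []

changes : List Bool → ℕ
changes (a ∷ b ∷ l) = (if (a ∧ not b) ∨' (not a ∧ b) then 1 else 0) + changes (b ∷ l)
  where
  _∨'_ : Bool → Bool → Bool
  true ∨' _ = true
  false ∨' y = y
changes _ = 0

runs : List ℕ → ℕ
runs σ = suc (changes (dirs σ))

firstAsc : List ℕ → Bool
firstAsc (a ∷ b ∷ _) = a <ᵇ b
firstAsc _ = false

eqB : Bool → Bool → Bool
eqB true b = b
eqB false b = not b

Wk : Bool → ℕ → ℕ → GA
Wk asc k n = map (λ σ → (1ℚ , σ))
  (filterB (λ σ → (runs σ ≡ᵇ k) ∧ eqB (firstAsc σ) asc) (perms n))

InW : ℕ → GA → Set
InW n x = Σ (ℕ → ℚ) λ a → Σ (ℕ → ℚ) λ b →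
  x ≈ sumGA (map (λ k → addGA (scaleGA (a k) (Wk true k n)) (scaleGA (b k) (Wk false k n)))
                 (map suc (upTo (n ∸ 1))))

Idempotent : GA → Set
Idempotent e = mulGA e e ≈ e

Primitive : ℕ → GA → Set
Primitive n e = ¬ (e ≈ zeroGA) ×
  (∀ x y → InW n x → InW n y → Idempotent x → Idempotent y →
     mulGA x y ≈ zeroGA → mulGA y x ≈ zeroGA → addGA x y ≈ e →
     x ≈ zeroGA ⊎ y ≈ zeroGA)

-- complete set of primitive orthogonal idempotents of W_n^±
-- (the unit of W_n^± is the identity permutation, which is W_1^+)
CompletePOI : ℕ → List GA → Set
CompletePOI n E =
  All (InW n) E ×
  All Idempotent E ×
  (∀ (i j : Fin (length E)) → i ≢ j → mulGA (lookup E i) (lookup E j) ≈ zeroGA) ×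
  (sumGA E ≈ oneGA n) ×
  All (Primitive n) E

sameParity : ℕ → ℕ → Bool
sameParity k n = eqB (even k) (even n)

family1 family2 family3 : ℕ → List GA
family1 n = map (λ k → scaleGA ½ (addGA (comp n (Ikp k)) (comp n (Ikm k))))
  (filterB (λ k → sameParity k n) (map suc (upTo n)))
family2 n = map (λ l → scaleGA ½ (addGA (addGA (comp n (Jkp l)) (comp n (Jkm l)))
                                        (scaleGA (-q 1ℚ) (addGA (comp n (Ikp l)) (comp n (Ikm l))))))
  (filterB (λ l → sameParity l n) (upTo (n ∸ 3)))
family3 n = map (λ m → scaleGA ½ (addGA (comp n (Jkp m)) (scaleGA (-q 1ℚ) (comp n (Jkm m)))))
  (filterB (λ m → sameParity m n) (upTo (n ∸ 1)))

idempotents : ℕ → List GA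
idempotents n = family1 n ++ family2 n ++ family3 n

{-# OPTIONS --safe #-}
module Submission where

-- An element of the completion is regarded as a function on words, the coefficient of a ribbon being spread over all words
-- with that descent set; the external product becomes convolution for deconcatenation.  Let V_k^± = V_1^± ⋆ V_1^∓ ⋆ V_1^± ⋆ …
-- (k factors).  Since j ↦ V^j is polynomial, exp and log give V_k^± = Σ kⁱ I_i^± for even k and V_k^± = Σ kⁱ J_i^± for
-- odd k.  The function V_k^± is a character for shuffles of words with disjoint letters, which yields the internal products
-- V_k^ε V_l^δ = V_{kl}^ε (k even) and V_k^ε V_l^δ = V_{kl}^{εδ} (k odd).  Comparing coefficients of kⁱ lʲ gives the
-- multiplication table of the I_i^±, J_i^±: products with i ≠ j vanish, and for i = j one has I^ε X = I^ε,
-- J^ε I^δ = I^{εδ}, J^ε J^δ = J^{εδ}.  Idempotence, orthogonality and the one-dimensional corners e𝒲e = ℚe are read off this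
-- table.  The coefficient of V_k^± at σ depends only on the number of runs and the first direction of σ, triangularly in the
-- number of runs, so the V_k^± span 𝒲ₙ^±.  The sum of the idempotents is Σ J_i^+ = V_1^+, because V_1^+(t) V_1^-(−t) = 1 kills
-- the components of wrong parity and the remaining omitted ones vanish in top degree.  Finally no idempotent is zero: its
-- coefficient at the identity permutation satisfies a recurrence with positive terms.

open import Defs
open import Data.Bool using (Bool; true; false; if_then_else_; _∧_; _∨_; not)
open import Data.Bool.Properties using (not-involutive)
open import Data.Empty using (⊥; ⊥-elim)
import Data.Fin as Fin
open import Data.Integer using (+_)
import Data.Integer as ℤ
import Data.Integer.Properties as ℤₚ
open import Data.List using (List; []; _∷_; _++_; map; concatMap; upTo; applyUpTo; replicate; length; lookup; reverse; take; drop)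
import Data.List.Properties as Lₚ
open import Data.List.Membership.Propositional using (_∈_)
import Data.List.Membership.Propositional.Properties as ∈ₚ
open import Data.List.Relation.Binary.Permutation.Propositional using (_↭_; prep; swap; ↭-refl; ↭-sym; ↭-trans; ↭-reflexive; ↭⇒↭ₛ)
import Data.List.Relation.Binary.Permutation.Propositional.Properties as ↭ₚ
import Data.List.Relation.Binary.Permutation.Setoid.Properties as ↭ₛ
open import Data.List.Relation.Unary.All as All using (All; []; _∷_)
import Data.List.Relation.Unary.All.Properties as Allₚ
open import Data.List.Relation.Unary.AllPairs using (AllPairs; []; _∷_)
import Data.List.Relation.Unary.AllPairs.Properties as AllPairsₚ
open import Data.List.Relation.Unary.Any using (here; there)
import Data.List.Relation.Unary.Unique.Propositional.Properties as Uniqueₚ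
open import Data.Nat using (ℕ; zero; suc; _+_; _*_; _∸_; pred; _≤_; _<_; _<ᵇ_; _≡ᵇ_; z≤n; s≤s; z<s; s<s)
import Data.Nat.Properties as ℕₚ
import Data.Nat.Solver as ℕSolver
open import Data.Product using (_×_; _,_; Σ; proj₁; proj₂)
open import Data.Rational using (ℚ; 0ℚ; 1ℚ; ½; -½; _/_; 1/_; toℚᵘ) renaming (_+_ to _+q_; _*_ to _*q_; -_ to -q_)
import Data.Rational as ℚ
import Data.Rational.Properties as ℚₚ
import Data.Rational.Solver as ℚSolver
import Data.Rational.Unnormalised as ℚᵘ
import Data.Rational.Unnormalised.Properties as ℚᵘₚ
open import Data.Sum using (_⊎_; inj₁; inj₂)
open import Function using (_∘_)
open import Relation.Binary.Definitions using (tri<; tri≈; tri>)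
open import Relation.Binary.PropositionalEquality using (_≡_; _≢_; refl; sym; trans; cong; cong₂; subst; setoid; module ≡-Reasoning)
open import Relation.Nullary using (¬_; Dec; yes; no)

-- The value of V_k^± on a word is polynomial in k only along the even and along the odd numbers
-- separately; this is why there are two families. Identities between coefficients are obtained by
-- interpolation at infinitely many points of one parity rather than by composing power series.
--
-- Words with arbitrary letters replace permutations because a factor of a permutation would have to
-- be standardised to become a permutation again. In the product of the group algebra permutations
-- are unavoidable: there the right factor β is encoded by the positions at which its values are
-- inserted, since in this form σβ⁻¹ can be followed letter by letter, and cutting β into blocks
-- turns into shuffling the corresponding blocks of σ.
--
-- The multiplication table alone would be consistent with vanishing elements. At the identity
-- permutation V_k^± has the generating function ((1+t)/(1-t))^(k/2) for even k, and this times
-- (1-t²)^(∓1/2) for odd k. These functions satisfy first-order linear differential equations, and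
-- the recurrences used for positivity are their coefficient forms.

module QS = ℚSolver.+-*-Solver
module NS = ℕSolver.+-*-Solver

-- Arithmetic in ℚ.

cong+ : ∀ {a b c d : ℚ} → a ≡ b → c ≡ d → a +q c ≡ b +q d
cong+ = cong₂ _+q_

cong* : ∀ {a b c d : ℚ} → a ≡ b → c ≡ d → a *q c ≡ b *q d
cong* = cong₂ _*q_

0+0 : ∀ {a b : ℚ} → a ≡ 0ℚ → b ≡ 0ℚ → a +q b ≡ 0ℚ
0+0 p q = trans (cong+ p q) (ℚₚ.+-identityˡ 0ℚ)

0*x : ∀ {a : ℚ} b → a ≡ 0ℚ → a *q b ≡ 0ℚ
0*x b p = trans (cong (_*q b) p) (ℚₚ.*-zeroˡ b)

x*0 : ∀ a {b : ℚ} → b ≡ 0ℚ → a *q b ≡ 0ℚ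
x*0 a p = trans (cong (a *q_) p) (ℚₚ.*-zeroʳ a)

+q-medial : ∀ a b c d → (a +q b) +q (c +q d) ≡ (a +q c) +q (b +q d)
+q-medial = solve 4 (λ a b c d → (a :+ b) :+ (c :+ d) := (a :+ c) :+ (b :+ d)) refl
  where open QS

*q-left-comm : ∀ a b c → a *q (b *q c) ≡ b *q (a *q c)
*q-left-comm = solve 3 (λ a b c → a :* (b :* c) := b :* (a :* c)) refl
  where open QS

*q-medial : ∀ a b c d → (a *q b) *q (c *q d) ≡ (a *q c) *q (b *q d)
*q-medial = solve 4 (λ a b c d → (a :* b) :* (c :* d) := (a :* c) :* (b :* d)) refl
  where open QS

x-y≡0⇒x≡y : ∀ x y → x +q -q y ≡ 0ℚ → x ≡ y
x-y≡0⇒x≡y x y p = begin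
  x                  ≡⟨ solve 2 (λ x y → x := (x :+ :- y) :+ y) refl x y ⟩
  (x +q -q y) +q y   ≡⟨ cong (_+q y) p ⟩
  0ℚ +q y            ≡⟨ ℚₚ.+-identityˡ y ⟩
  y                  ∎
  where open QS
        open ≡-Reasoning

p*x≡0⇒x≡0 : ∀ p x → p ≢ 0ℚ → p *q x ≡ 0ℚ → x ≡ 0ℚ
p*x≡0⇒x≡0 p x p≢0 eq = begin
  x                    ≡⟨ sym (ℚₚ.*-identityˡ x) ⟩
  1ℚ *q x              ≡⟨ cong (_*q x) (sym (ℚₚ.*-inverseˡ p)) ⟩
  ((1/ p) *q p) *q x   ≡⟨ ℚₚ.*-assoc (1/ p) p x ⟩
  (1/ p) *q (p *q x)   ≡⟨ cong ((1/ p) *q_) eq ⟩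
  (1/ p) *q 0ℚ         ≡⟨ ℚₚ.*-zeroʳ (1/ p) ⟩
  0ℚ                   ∎
  where open ≡-Reasoning
        instance _ = ℚ.≢-nonZero p≢0

-- Natural numbers in ℚ

-- Defined by recursion so that `ι (suc n)` unfolds to `1ℚ +q ι n`, a form that the ring solver can
-- work with.
ι : ℕ → ℚ
ι zero    = 0ℚ
ι (suc n) = 1ℚ +q ι n

ι-+ : ∀ m n → ι (m + n) ≡ ι m +q ι n
ι-+ zero    n = sym (ℚₚ.+-identityˡ (ι n))
ι-+ (suc m) n = trans (cong (1ℚ +q_) (ι-+ m n)) (sym (ℚₚ.+-assoc 1ℚ (ι m) (ι n)))

ι-* : ∀ m n → ι (m * n) ≡ ι m *q ι n
ι-* zero    n = sym (ℚₚ.*-zeroˡ (ι n))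
ι-* (suc m) n = begin
  ι (n + m * n)            ≡⟨ ι-+ n (m * n) ⟩
  ι n +q ι (m * n)         ≡⟨ cong (ι n +q_) (ι-* m n) ⟩
  ι n +q ι m *q ι n        ≡⟨ solve 2 (λ m n → n :+ m :* n := (con 1ℚ :+ m) :* n) refl (ι m) (ι n) ⟩
  (1ℚ +q ι m) *q ι n       ∎
  where open QS
        open ≡-Reasoning

-- For unnormalised fractions equality is cross-multiplication, so the injectivity of `ι` and the
-- reciprocals in `recip-ι` reduce to integer identities.
toℚᵘ-ι : ∀ n → toℚᵘ (ι n) ℚᵘ.≃ ℚᵘ.mkℚᵘ (+ n) 0
toℚᵘ-ι zero    = ℚᵘₚ.≃-refl
toℚᵘ-ι (suc n) = ℚᵘₚ.≃-trans (ℚₚ.toℚᵘ-homo-+ 1ℚ (ι n))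
  (ℚᵘₚ.≃-trans (ℚᵘₚ.+-congʳ ℚᵘ.1ℚᵘ (toℚᵘ-ι n)) (ℚᵘ.*≡* (cong (λ k → (ℤ.+ 1 ℤ.+ k) ℤ.* ℤ.+ 1) (ℤₚ.*-identityʳ (+ n)))))

ι-injective : ∀ {m n} → ι m ≡ ι n → m ≡ n
ι-injective {m} {n} eq with ℚᵘₚ.≃-trans (ℚᵘₚ.≃-sym (toℚᵘ-ι m)) (ℚᵘₚ.≃-trans (ℚᵘₚ.≃-reflexive (cong toℚᵘ eq)) (toℚᵘ-ι n))
... | ℚᵘ.*≡* e = ℤₚ.+-injective (trans (sym (ℤₚ.*-identityʳ (+ m))) (trans e (ℤₚ.*-identityʳ (+ n))))

ι-suc≢0 : ∀ n → ι (suc n) ≢ 0ℚ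
ι-suc≢0 n eq with ι-injective {suc n} {0} eq
... | ()

recip-ι : ∀ k → (+ 1 / suc k) *q ι (suc k) ≡ 1ℚ
recip-ι k = ℚₚ.toℚᵘ-injective (ℚᵘₚ.≃-trans (ℚₚ.toℚᵘ-homo-* (+ 1 / suc k) (ι (suc k)))
  (ℚᵘₚ.≃-trans (ℚᵘₚ.*-cong (ℚₚ.toℚᵘ-fromℚᵘ (ℚᵘ.mkℚᵘ (+ 1) k)) (toℚᵘ-ι (suc k)))
    (ℚᵘ.*≡* (cong (λ x → + x) (solve 1 (λ k → ((con 1 :+ k) :+ con 0) :* con 1 := con 1 :* ((con 1 :+ k) :* con 1)) refl k)))))
  where open NS

ι-nonNeg : ∀ n → 0ℚ ℚ.≤ ι n
ι-nonNeg zero    = ℚₚ.≤-refl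
ι-nonNeg (suc n) = ℚₚ.≤-trans (ι-nonNeg n)
  (subst (ℚ._≤ ι (suc n)) (ℚₚ.+-identityˡ (ι n)) (ℚₚ.+-monoˡ-≤ (ι n) (ℚₚ.nonNegative⁻¹ 1ℚ)))

-- Finite sums

∑ : {A : Set} → List A → (A → ℚ) → ℚ
∑ []       f = 0ℚ
∑ (x ∷ xs) f = f x +q ∑ xs f

∑< : ℕ → (ℕ → ℚ) → ℚ
∑< zero    f = 0ℚ
∑< (suc n) f = f 0 +q ∑< n (f ∘ suc)

module _ {A : Set} where

  ∑-cong : ∀ (xs : List A) {f g : A → ℚ} → (∀ x → f x ≡ g x) → ∑ xs f ≡ ∑ xs g
  ∑-cong []       h = refl
  ∑-cong (x ∷ xs) h = cong+ (h x) (∑-cong xs h)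

  ∑-0 : ∀ (xs : List A) {f : A → ℚ} → (∀ x → f x ≡ 0ℚ) → ∑ xs f ≡ 0ℚ
  ∑-0 []       h = refl
  ∑-0 (x ∷ xs) h = trans (cong+ (h x) (∑-0 xs h)) (ℚₚ.+-identityˡ 0ℚ)

  ∑-+ : ∀ (xs : List A) (f g : A → ℚ) → ∑ xs (λ x → f x +q g x) ≡ ∑ xs f +q ∑ xs g
  ∑-+ []       f g = sym (ℚₚ.+-identityˡ 0ℚ)
  ∑-+ (x ∷ xs) f g = trans (cong ((f x +q g x) +q_) (∑-+ xs f g)) (+q-medial (f x) (g x) _ _)

  ∑-*ˡ : ∀ (xs : List A) c (f : A → ℚ) → ∑ xs (λ x → c *q f x) ≡ c *q ∑ xs f
  ∑-*ˡ []       c f = sym (ℚₚ.*-zeroʳ c)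
  ∑-*ˡ (x ∷ xs) c f = trans (cong (c *q f x +q_) (∑-*ˡ xs c f)) (sym (ℚₚ.*-distribˡ-+ c (f x) _))

  ∑-*ʳ : ∀ (xs : List A) c (f : A → ℚ) → ∑ xs (λ x → f x *q c) ≡ ∑ xs f *q c
  ∑-*ʳ xs c f = trans (∑-cong xs (λ x → ℚₚ.*-comm (f x) c)) (trans (∑-*ˡ xs c f) (ℚₚ.*-comm c _))

  ∑-++ : ∀ (xs ys : List A) (f : A → ℚ) → ∑ (xs ++ ys) f ≡ ∑ xs f +q ∑ ys f
  ∑-++ []       ys f = sym (ℚₚ.+-identityˡ _)
  ∑-++ (x ∷ xs) ys f = trans (cong (f x +q_) (∑-++ xs ys f)) (sym (ℚₚ.+-assoc (f x) _ _))

  ∑-filterB : ∀ (p : A → Bool) (xs : List A) (f : A → ℚ) → ∑ (filterB p xs) f ≡ ∑ xs (λ x → if p x then f x else 0ℚ)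
  ∑-filterB p []       f = refl
  ∑-filterB p (x ∷ xs) f with p x
  ... | true  = cong (f x +q_) (∑-filterB p xs f)
  ... | false = trans (∑-filterB p xs f) (sym (ℚₚ.+-identityˡ _))

module _ {A B : Set} where

  ∑-map : ∀ (g : A → B) xs (f : B → ℚ) → ∑ (map g xs) f ≡ ∑ xs (f ∘ g)
  ∑-map g []       f = refl
  ∑-map g (x ∷ xs) f = cong (f (g x) +q_) (∑-map g xs f)

  ∑-concatMap : ∀ (g : A → List B) xs (f : B → ℚ) → ∑ (concatMap g xs) f ≡ ∑ xs (λ x → ∑ (g x) f)
  ∑-concatMap g []       f = refl
  ∑-concatMap g (x ∷ xs) f = trans (∑-++ (g x) (concatMap g xs) f) (cong (∑ (g x) f +q_) (∑-concatMap g xs f))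

  ∑-swap : ∀ (xs : List A) (ys : List B) (f : A → B → ℚ) → ∑ xs (λ x → ∑ ys (f x)) ≡ ∑ ys (λ y → ∑ xs (λ x → f x y))
  ∑-swap []       ys f = sym (∑-0 ys (λ _ → refl))
  ∑-swap (x ∷ xs) ys f = trans (cong (∑ ys (f x) +q_) (∑-swap xs ys f)) (sym (∑-+ ys (f x) _))

∑<-cong : ∀ n {f g} → (∀ i → i < n → f i ≡ g i) → ∑< n f ≡ ∑< n g
∑<-cong zero    h = refl
∑<-cong (suc n) h = cong+ (h 0 z<s) (∑<-cong n (λ i i<n → h (suc i) (s<s i<n)))

∑<-0 : ∀ n {f} → (∀ i → i < n → f i ≡ 0ℚ) → ∑< n f ≡ 0ℚ
∑<-0 zero    h = refl
∑<-0 (suc n) h = trans (cong+ (h 0 z<s) (∑<-0 n (λ i i<n → h (suc i) (s<s i<n)))) (ℚₚ.+-identityˡ 0ℚ)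

∑<-+ : ∀ n f g → ∑< n (λ i → f i +q g i) ≡ ∑< n f +q ∑< n g
∑<-+ zero    f g = sym (ℚₚ.+-identityˡ 0ℚ)
∑<-+ (suc n) f g = trans (cong ((f 0 +q g 0) +q_) (∑<-+ n (f ∘ suc) (g ∘ suc))) (+q-medial (f 0) (g 0) _ _)

∑<-*ˡ : ∀ n c f → ∑< n (λ i → c *q f i) ≡ c *q ∑< n f
∑<-*ˡ zero    c f = sym (ℚₚ.*-zeroʳ c)
∑<-*ˡ (suc n) c f = trans (cong (c *q f 0 +q_) (∑<-*ˡ n c (f ∘ suc))) (sym (ℚₚ.*-distribˡ-+ c (f 0) _))

∑<-*ʳ : ∀ n c f → ∑< n (λ i → f i *q c) ≡ ∑< n f *q c
∑<-*ʳ n c f = trans (∑<-cong n (λ i _ → ℚₚ.*-comm (f i) c)) (trans (∑<-*ˡ n c f) (ℚₚ.*-comm c _))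

∑<-last : ∀ n f → ∑< (suc n) f ≡ ∑< n f +q f n
∑<-last zero    f = trans (ℚₚ.+-identityʳ (f 0)) (sym (ℚₚ.+-identityˡ (f 0)))
∑<-last (suc n) f = trans (cong (f 0 +q_) (∑<-last n (f ∘ suc))) (sym (ℚₚ.+-assoc (f 0) _ _))

∑<-split : ∀ m n f → ∑< (m + n) f ≡ ∑< m f +q ∑< n (λ i → f (m + i))
∑<-split zero    n f = sym (ℚₚ.+-identityˡ _)
∑<-split (suc m) n f = trans (cong (f 0 +q_) (∑<-split m n (f ∘ suc))) (sym (ℚₚ.+-assoc (f 0) _ _))

∑<-∑-swap : ∀ {A : Set} n (xs : List A) (f : ℕ → A → ℚ) → ∑< n (λ i → ∑ xs (f i)) ≡ ∑ xs (λ x → ∑< n (λ i → f i x))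
∑<-∑-swap zero    xs f = sym (∑-0 xs (λ _ → refl))
∑<-∑-swap (suc n) xs f = trans (cong (∑ xs (f 0) +q_) (∑<-∑-swap n xs (f ∘ suc))) (sym (∑-+ xs (f 0) _))

∑-applyUpTo : ∀ {A : Set} (g : ℕ → A) n (f : A → ℚ) → ∑ (applyUpTo g n) f ≡ ∑< n (f ∘ g)
∑-applyUpTo g zero    f = refl
∑-applyUpTo g (suc n) f = cong (f (g 0) +q_) (∑-applyUpTo (g ∘ suc) n f)

∑-upTo : ∀ n (f : ℕ → ℚ) → ∑ (upTo n) f ≡ ∑< n f
∑-upTo = ∑-applyUpTo (λ i → i)

-- Polynomials, as coefficient sequences cut off at a bound

-- Horner's scheme. The bound is the number of coefficients, one more than the degree.
evalP : ℕ → (ℕ → ℚ) → ℚ → ℚ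
evalP zero    a x = 0ℚ
evalP (suc d) a x = a 0 +q x *q evalP d (a ∘ suc) x

evalP-cong : ∀ d {a b} x → (∀ i → i < d → a i ≡ b i) → evalP d a x ≡ evalP d b x
evalP-cong zero    x h = refl
evalP-cong (suc d) x h = cong+ (h 0 z<s) (cong (x *q_) (evalP-cong d x (λ i i<d → h (suc i) (s<s i<d))))

evalP-0 : ∀ d {a} x → (∀ i → i < d → a i ≡ 0ℚ) → evalP d a x ≡ 0ℚ
evalP-0 zero    x h = refl
evalP-0 (suc d) x h = trans (cong+ (h 0 z<s) (trans (cong (x *q_) (evalP-0 d x (λ i i<d → h (suc i) (s<s i<d)))) (ℚₚ.*-zeroʳ x))) (ℚₚ.+-identityˡ 0ℚ)

evalP-+ : ∀ d a b x → evalP d (λ i → a i +q b i) x ≡ evalP d a x +q evalP d b x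
evalP-+ zero    a b x = sym (ℚₚ.+-identityˡ 0ℚ)
evalP-+ (suc d) a b x = trans (cong (λ y → (a 0 +q b 0) +q x *q y) (evalP-+ d (a ∘ suc) (b ∘ suc) x))
  (solve 5 (λ a b x p q → (a :+ b) :+ x :* (p :+ q) := (a :+ x :* p) :+ (b :+ x :* q)) refl (a 0) (b 0) x _ _)
  where open QS

evalP-* : ∀ d c a x → evalP d (λ i → c *q a i) x ≡ c *q evalP d a x
evalP-* zero    c a x = sym (ℚₚ.*-zeroʳ c)
evalP-* (suc d) c a x = trans (cong (λ y → c *q a 0 +q x *q y) (evalP-* d c (a ∘ suc) x))
  (solve 4 (λ c a x p → c :* a :+ x :* (c :* p) := c :* (a :+ x :* p)) refl c (a 0) x _)
  where open QS

evalP-ext : ∀ {d d'} a x → d ≤ d' → (∀ i → d ≤ i → a i ≡ 0ℚ) → evalP d' a x ≡ evalP d a x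
evalP-ext {zero}  {d'} a x z≤n h = evalP-0 d' x (λ i _ → h i z≤n)
evalP-ext {suc d} {suc d'} a x (s≤s d≤d') h =
  cong (λ y → a 0 +q x *q y) (evalP-ext (a ∘ suc) x d≤d' (λ i d≤i → h (suc i) (s≤s d≤i)))

evalP-at-1 : ∀ d a → evalP d a 1ℚ ≡ ∑< d a
evalP-at-1 zero    a = refl
evalP-at-1 (suc d) a = cong (a 0 +q_) (trans (ℚₚ.*-identityˡ _) (evalP-at-1 d (a ∘ suc)))

evalP-∑< : ∀ d m (a : ℕ → ℕ → ℚ) x → evalP d (λ i → ∑< m (λ k → a k i)) x ≡ ∑< m (λ k → evalP d (a k) x)
evalP-∑< d zero    a x = evalP-0 d x (λ _ _ → refl)
evalP-∑< d (suc m) a x = trans (evalP-+ d (a 0) _ x) (cong (evalP d (a 0) x +q_) (evalP-∑< d m (a ∘ suc) x))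

-- Synthetic division: the coefficients of the quotient by x - r.
synth : ℕ → (ℕ → ℚ) → ℚ → (ℕ → ℚ)
synth zero    a r i       = 0ℚ
synth (suc d) a r zero    = evalP d (a ∘ suc) r
synth (suc d) a r (suc i) = synth d (a ∘ suc) r i

synth-eval : ∀ d a r x → evalP (suc d) a x ≡ evalP (suc d) a r +q (x +q -q r) *q evalP d (synth (suc d) a r) x
synth-eval zero a r x = solve 3 (λ a r x → a :+ x :* con 0ℚ := a :+ r :* con 0ℚ :+ (x :+ :- r) :* con 0ℚ) refl (a 0) r x
  where open QS
synth-eval (suc d) a r x = trans (cong (λ y → a 0 +q x *q y) (synth-eval d (a ∘ suc) r x))
  (solve 5 (λ a r x p s → a :+ x :* (p :+ (x :+ :- r) :* s) := (a :+ r :* p) :+ (x :+ :- r) :* (p :+ x :* s)) refl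
    (a 0) r x (evalP (suc d) (a ∘ suc) r) (evalP d (synth (suc d) (a ∘ suc) r) x))
  where open QS

-- A polynomial is its value at r plus (x - r) times the quotient, so it vanishes when both do. The
-- quotient has one coefficient fewer, whence `suc i < d`.
synth-zero : ∀ d a r → evalP d a r ≡ 0ℚ → (∀ i → suc i < d → synth d a r i ≡ 0ℚ) → ∀ i → i < d → a i ≡ 0ℚ
synth-zero (suc zero) a r p h zero i<d = trans (solve 2 (λ a r → a := a :+ r :* con 0ℚ) refl (a 0) r) p
  where open QS
synth-zero (suc (suc d)) a r p h zero i<d =
  trans (solve 2 (λ a r → a := a :+ r :* con 0ℚ) refl (a 0) r)
    (trans (cong (λ y → a 0 +q r *q y) (sym (h 0 (s<s z<s)))) p)
  where open QS
synth-zero (suc zero) a r p h (suc i) (s≤s ())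
synth-zero (suc (suc d)) a r p h (suc i) (s≤s i<d) =
  synth-zero (suc d) (a ∘ suc) r (h 0 (s<s z<s)) (λ j j<d → h (suc j) (s<s j<d)) i i<d

-- Dividing by x - `r 0` uses up one root and lowers the bound; the quotient still vanishes at the
-- remaining points `r ∘ suc`.
poly-vanish : ∀ d a (r : ℕ → ℚ) → (∀ {i j} → r i ≡ r j → i ≡ j) → (∀ j → evalP d a (r j) ≡ 0ℚ) → ∀ i → i < d → a i ≡ 0ℚ
poly-vanish (suc d) a r r-inj h = synth-zero (suc d) a (r 0) (h 0) (λ i i<d → rec i (ℕₚ.≤-pred i<d))
  where
  open ≡-Reasoning
  rec : ∀ i → i < d → synth (suc d) a (r 0) i ≡ 0ℚ
  rec = poly-vanish d (synth (suc d) a (r 0)) (r ∘ suc) (λ e → ℕₚ.suc-injective (r-inj e)) λ j →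
    p*x≡0⇒x≡0 (r (suc j) +q -q r 0) _
      (λ e → case-absurd (r-inj (x-y≡0⇒x≡y (r (suc j)) (r 0) e)))
      (begin
        (r (suc j) +q -q r 0) *q s j                        ≡⟨ sym (ℚₚ.+-identityˡ _) ⟩
        0ℚ +q (r (suc j) +q -q r 0) *q s j                  ≡⟨ cong (_+q (r (suc j) +q -q r 0) *q s j) (sym (h 0)) ⟩
        evalP (suc d) a (r 0) +q (r (suc j) +q -q r 0) *q s j ≡⟨ sym (synth-eval d a (r 0) (r (suc j))) ⟩
        evalP (suc d) a (r (suc j))                         ≡⟨ h (suc j) ⟩
        0ℚ ∎)
    where
    s : ℕ → ℚ
    s j = evalP d (synth (suc d) a (r 0)) (r (suc j))
    case-absurd : ∀ {j} → suc j ≢ 0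
    case-absurd ()

-- The sample points form an arbitrary injective sequence, because later identities are available
-- only at the even or only at the odd numbers.
poly-unique : ∀ d a b (r : ℕ → ℚ) → (∀ {i j} → r i ≡ r j → i ≡ j) → (∀ j → evalP d a (r j) ≡ evalP d b (r j)) → ∀ i → i < d → a i ≡ b i
poly-unique d a b r r-inj h i i<d = x-y≡0⇒x≡y (a i) (b i) (trans (cong (a i +q_) (neg-is-scale (b i)))
  (poly-vanish d (λ i → a i +q -q 1ℚ *q b i) r r-inj
    (λ j → trans (evalP-+ d a (λ i → -q 1ℚ *q b i) (r j))
      (trans (cong+ (h j) (evalP-* d (-q 1ℚ) b (r j)))
        (solve 1 (λ x → x :+ :- con 1ℚ :* x := con 0ℚ) refl (evalP d b (r j))))) i i<d))
  where
  open QS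
  neg-is-scale : ∀ x → -q x ≡ -q 1ℚ *q x
  neg-is-scale = solve 1 (λ x → :- x := :- con 1ℚ :* x) refl

poly-unique-eval : ∀ d a b (r : ℕ → ℚ) → (∀ {i j} → r i ≡ r j → i ≡ j) → (∀ j → evalP d a (r j) ≡ evalP d b (r j)) → ∀ x → evalP d a x ≡ evalP d b x
poly-unique-eval d a b r r-inj h x = evalP-cong d x (poly-unique d a b r r-inj h)

-- The Taylor shift: the coefficients of a(x + k), obtained from Horner's scheme.
shiftP : ℚ → ℕ → (ℕ → ℚ) → (ℕ → ℚ)
shiftP k zero    a i       = 0ℚ
shiftP k (suc d) a zero    = a 0 +q k *q shiftP k d (a ∘ suc) 0
shiftP k (suc d) a (suc i) = shiftP k d (a ∘ suc) i +q k *q shiftP k d (a ∘ suc) (suc i)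

shiftP-support : ∀ k d a i → d ≤ i → shiftP k d a i ≡ 0ℚ
shiftP-support k zero    a i       d≤i = refl
shiftP-support k (suc d) a (suc i) (s≤s d≤i) = trans
  (cong₂ (λ x y → x +q k *q y) (shiftP-support k d (a ∘ suc) i d≤i) (shiftP-support k d (a ∘ suc) (suc i) (ℕₚ.m≤n⇒m≤1+n d≤i)))
  (solve 1 (λ k → con 0ℚ :+ k :* con 0ℚ := con 0ℚ) refl k)
  where open QS

shiftP-eval : ∀ k d a x → evalP d (shiftP k d a) x ≡ evalP d a (x +q k)
shiftP-eval k zero    a x = refl
shiftP-eval k (suc d) a x = begin
  (a 0 +q k *q q 0) +q x *q evalP d (λ i → q i +q k *q q (suc i)) x
    ≡⟨ cong (λ y → (a 0 +q k *q q 0) +q x *q y) (trans (evalP-+ d q _ x) (cong (evalP d q x +q_) (evalP-* d k (q ∘ suc) x))) ⟩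
  (a 0 +q k *q q 0) +q x *q (evalP d q x +q k *q evalP d (q ∘ suc) x)
    ≡⟨ solve 6 (λ a k q x e f → (a :+ k :* q) :+ x :* (e :+ k :* f) := a :+ x :* e :+ k :* (q :+ x :* f)) refl (a 0) k (q 0) x _ _ ⟩
  a 0 +q x *q evalP d q x +q k *q evalP (suc d) q x
    ≡⟨ cong (λ y → a 0 +q x *q evalP d q x +q k *q y) (evalP-ext q x (ℕₚ.n≤1+n d) (shiftP-support k d (a ∘ suc))) ⟩
  a 0 +q x *q evalP d q x +q k *q evalP d q x
    ≡⟨ solve 4 (λ a x e k → a :+ x :* e :+ k :* e := a :+ (x :+ k) :* e) refl (a 0) x _ k ⟩
  a 0 +q (x +q k) *q evalP d q x
    ≡⟨ cong (λ y → a 0 +q (x +q k) *q y) (shiftP-eval k d (a ∘ suc) x) ⟩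
  a 0 +q (x +q k) *q evalP d (a ∘ suc) (x +q k) ∎
  where
  open QS
  open ≡-Reasoning
  q = shiftP k d (a ∘ suc)

shiftP-constant : ∀ k d a → shiftP k d a 0 ≡ evalP d a k
shiftP-constant k zero    a = refl
shiftP-constant k (suc d) a = cong (λ y → a 0 +q k *q y) (shiftP-constant k d (a ∘ suc))

derivP : (ℕ → ℚ) → (ℕ → ℚ)
derivP a i = ι (suc i) *q a (suc i)

-- First-order Taylor coefficient. Through it the addition law for powers becomes the differential
-- recursion `P-suc`.
shiftP-linear : ∀ k d a → shiftP k (suc d) a 1 ≡ evalP d (derivP a) k
shiftP-linear k zero a = solve 1 (λ k → con 0ℚ :+ k :* con 0ℚ := con 0ℚ) refl k
  where open QS
shiftP-linear k (suc d) a = begin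
  shiftP k (suc d) (a ∘ suc) 0 +q k *q shiftP k (suc d) (a ∘ suc) 1
    ≡⟨ cong₂ (λ x y → x +q k *q y) (shiftP-constant k (suc d) (a ∘ suc)) (shiftP-linear k d (a ∘ suc)) ⟩
  (a 1 +q k *q evalP d (a ∘ suc ∘ suc) k) +q k *q evalP d (derivP (a ∘ suc)) k
    ≡⟨ solve 4 (λ a k e f → (a :+ k :* e) :+ k :* f := (con 1ℚ :+ con 0ℚ) :* a :+ k :* (e :+ f)) refl (a 1) k _ _ ⟩
  ι 1 *q a 1 +q k *q (evalP d (a ∘ suc ∘ suc) k +q evalP d (derivP (a ∘ suc)) k)
    ≡⟨ cong (λ y → ι 1 *q a 1 +q k *q y) (sym (evalP-+ d _ _ k)) ⟩
  ι 1 *q a 1 +q k *q evalP d (λ i → a (suc (suc i)) +q derivP (a ∘ suc) i) k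
    ≡⟨ cong (λ y → ι 1 *q a 1 +q k *q y) (evalP-cong d k (λ i _ →
         solve 2 (λ a n → a :+ n :* a := (con 1ℚ :+ n) :* a) refl (a (suc (suc i))) (ι (suc i)))) ⟩
  ι 1 *q a 1 +q k *q evalP d (derivP a ∘ suc) k ∎
  where
  open QS
  open ≡-Reasoning

-- The convolution algebra dual to deconcatenation of words

Fn : Set
Fn = List ℕ → ℚ

unit : Fn
unit []      = 1ℚ
unit (_ ∷ _) = 0ℚ

-- The sum over all cuts of the word (`conv-split`). Moving the letter into the left argument, as in
-- `f ∘ (a ∷_)`, keeps proofs structural inductions on the word.
conv : Fn → Fn → Fn
conv f g []      = f [] *q g []
conv f g (a ∷ w) = f [] *q g (a ∷ w) +q conv (f ∘ (a ∷_)) g w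

pow : Fn → ℕ → Fn
pow f zero    = unit
pow f (suc m) = conv f (pow f m)

-- Only factors no longer than the word occur. This refinement is what allows polynomial expansions
-- whose bound depends on the length.
conv-cong-≤ : ∀ {f f' g g' : Fn} w → (∀ u → length u ≤ length w → f u ≡ f' u) → (∀ u → length u ≤ length w → g u ≡ g' u) →
  conv f g w ≡ conv f' g' w
conv-cong-≤ []      p q = cong* (p [] z≤n) (q [] z≤n)
conv-cong-≤ (a ∷ w) p q = cong+ (cong* (p [] z≤n) (q (a ∷ w) ℕₚ.≤-refl))
  (conv-cong-≤ w (λ u h → p (a ∷ u) (s≤s h)) (λ u h → q u (ℕₚ.m≤n⇒m≤1+n h)))

conv-cong : ∀ {f f' g g' : Fn} → (∀ u → f u ≡ f' u) → (∀ u → g u ≡ g' u) → ∀ w → conv f g w ≡ conv f' g' w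
conv-cong p q w = conv-cong-≤ w (λ u _ → p u) (λ u _ → q u)

conv-split : ∀ f g w → conv f g w ≡ ∑< (suc (length w)) (λ i → f (take i w) *q g (drop i w))
conv-split f g []      = sym (ℚₚ.+-identityʳ _)
conv-split f g (a ∷ w) = cong (f [] *q g (a ∷ w) +q_) (conv-split (f ∘ (a ∷_)) g w)

conv-0ˡ : ∀ {f g : Fn} w → (∀ u → f u ≡ 0ℚ) → conv f g w ≡ 0ℚ
conv-0ˡ {g = g} []  h = 0*x (g []) (h [])
conv-0ˡ {g = g} (a ∷ w) h = 0+0 (0*x (g (a ∷ w)) (h [])) (conv-0ˡ w (h ∘ (a ∷_)))

conv-+ˡ : ∀ f f' g w → conv (λ u → f u +q f' u) g w ≡ conv f g w +q conv f' g w
conv-+ˡ f f' g []      = ℚₚ.*-distribʳ-+ (g []) (f []) (f' [])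
conv-+ˡ f f' g (a ∷ w) = trans (cong ((f [] +q f' []) *q g (a ∷ w) +q_) (conv-+ˡ (f ∘ (a ∷_)) (f' ∘ (a ∷_)) g w))
  (solve 5 (λ f f' g p q → (f :+ f') :* g :+ (p :+ q) := (f :* g :+ p) :+ (f' :* g :+ q)) refl (f []) (f' []) (g (a ∷ w)) _ _)
  where open QS

conv-*ˡ : ∀ c f g w → conv (λ u → c *q f u) g w ≡ c *q conv f g w
conv-*ˡ c f g []      = ℚₚ.*-assoc c (f []) (g [])
conv-*ˡ c f g (a ∷ w) = trans (cong (c *q f [] *q g (a ∷ w) +q_) (conv-*ˡ c (f ∘ (a ∷_)) g w))
  (solve 4 (λ c f g p → c :* f :* g :+ c :* p := c :* (f :* g :+ p)) refl c (f []) (g (a ∷ w)) _)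
  where open QS

conv-0ʳ : ∀ {f g : Fn} w → (∀ u → g u ≡ 0ℚ) → conv f g w ≡ 0ℚ
conv-0ʳ {f} []      h = x*0 (f []) (h [])
conv-0ʳ {f} (a ∷ w) h = 0+0 (x*0 (f []) (h (a ∷ w))) (conv-0ʳ {f ∘ (a ∷_)} w h)

conv-+ʳ : ∀ f g g' w → conv f (λ u → g u +q g' u) w ≡ conv f g w +q conv f g' w
conv-+ʳ f g g' []      = ℚₚ.*-distribˡ-+ (f []) (g []) (g' [])
conv-+ʳ f g g' (a ∷ w) = trans (cong (f [] *q (g (a ∷ w) +q g' (a ∷ w)) +q_) (conv-+ʳ (f ∘ (a ∷_)) g g' w))
  (solve 5 (λ f g g' p q → f :* (g :+ g') :+ (p :+ q) := (f :* g :+ p) :+ (f :* g' :+ q)) refl (f []) (g (a ∷ w)) (g' (a ∷ w)) _ _)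
  where open QS

conv-*ʳ : ∀ c f g w → conv f (λ u → c *q g u) w ≡ c *q conv f g w
conv-*ʳ c f g []      = *q-left-comm (f []) c (g [])
conv-*ʳ c f g (a ∷ w) = trans (cong (f [] *q (c *q g (a ∷ w)) +q_) (conv-*ʳ c (f ∘ (a ∷_)) g w))
  (solve 4 (λ c f g p → f :* (c :* g) :+ c :* p := c :* (f :* g :+ p)) refl c (f []) (g (a ∷ w)) _)
  where open QS

conv-assoc : ∀ f g h w → conv (conv f g) h w ≡ conv f (conv g h) w
conv-assoc f g h []      = ℚₚ.*-assoc (f []) (g []) (h [])
conv-assoc f g h (a ∷ w) = begin
  f [] *q g [] *q h (a ∷ w) +q conv (λ u → f [] *q g (a ∷ u) +q conv (f ∘ (a ∷_)) g u) h w
    ≡⟨ cong (f [] *q g [] *q h (a ∷ w) +q_) (conv-+ˡ (λ u → f [] *q g (a ∷ u)) (conv (f ∘ (a ∷_)) g) h w) ⟩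
  f [] *q g [] *q h (a ∷ w) +q (conv (λ u → f [] *q g (a ∷ u)) h w +q conv (conv (f ∘ (a ∷_)) g) h w)
    ≡⟨ cong₂ (λ x y → f [] *q g [] *q h (a ∷ w) +q (x +q y)) (conv-*ˡ (f []) (g ∘ (a ∷_)) h w) (conv-assoc (f ∘ (a ∷_)) g h w) ⟩
  f [] *q g [] *q h (a ∷ w) +q (f [] *q conv (g ∘ (a ∷_)) h w +q conv (f ∘ (a ∷_)) (conv g h) w)
    ≡⟨ solve 5 (λ f g h x y → f :* g :* h :+ (f :* x :+ y) := f :* (g :* h :+ x) :+ y) refl (f []) (g []) (h (a ∷ w)) _ _ ⟩
  f [] *q (g [] *q h (a ∷ w) +q conv (g ∘ (a ∷_)) h w) +q conv (f ∘ (a ∷_)) (conv g h) w ∎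
  where
  open QS
  open ≡-Reasoning

conv-unitˡ : ∀ f w → conv unit f w ≡ f w
conv-unitˡ f []      = ℚₚ.*-identityˡ (f [])
conv-unitˡ f (a ∷ w) = trans (cong+ (ℚₚ.*-identityˡ (f (a ∷ w))) (conv-0ˡ w (λ _ → refl))) (ℚₚ.+-identityʳ _)

conv-unitʳ : ∀ f w → conv f unit w ≡ f w
conv-unitʳ f []      = ℚₚ.*-identityʳ (f [])
conv-unitʳ f (a ∷ w) = trans (cong+ (ℚₚ.*-zeroʳ (f [])) (conv-unitʳ (f ∘ (a ∷_)) w)) (ℚₚ.+-identityˡ _)

conv-evalPˡ : ∀ d (P : ℕ → Fn) x g w → conv (λ u → evalP d (λ i → P i u) x) g w ≡ evalP d (λ i → conv (P i) g w) x
conv-evalPˡ zero    P x g w = conv-0ˡ w (λ _ → refl)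
conv-evalPˡ (suc d) P x g w = trans (conv-+ˡ (P 0) _ g w) (cong (conv (P 0) g w +q_)
  (trans (conv-*ˡ x _ g w) (cong (x *q_) (conv-evalPˡ d (P ∘ suc) x g w))))

conv-evalPʳ : ∀ d f (P : ℕ → Fn) x w → conv f (λ u → evalP d (λ i → P i u) x) w ≡ evalP d (λ i → conv f (P i) w) x
conv-evalPʳ zero    f P x w = conv-0ʳ {f} w (λ _ → refl)
conv-evalPʳ (suc d) f P x w = trans (conv-+ʳ f (P 0) _ w) (cong (conv f (P 0) w +q_)
  (trans (conv-*ʳ x f _ w) (cong (x *q_) (conv-evalPʳ d f (P ∘ suc) x w))))

conv-∑<ʳ : ∀ d f (P : ℕ → Fn) w → conv f (λ u → ∑< d (λ i → P i u)) w ≡ ∑< d (λ i → conv f (P i) w)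
conv-∑<ʳ zero    f P w = conv-0ʳ {f} w (λ _ → refl)
conv-∑<ʳ (suc d) f P w = trans (conv-+ʳ f (P 0) _ w) (cong (conv f (P 0) w +q_) (conv-∑<ʳ d f (P ∘ suc) w))

pow-cong : ∀ {f g : Fn} → (∀ u → f u ≡ g u) → ∀ m w → pow f m w ≡ pow g m w
pow-cong h zero    w = refl
pow-cong h (suc m) w = conv-cong h (pow-cong h m) w

pow-+ : ∀ f j k w → pow f (j + k) w ≡ conv (pow f j) (pow f k) w
pow-+ f zero    k w = sym (conv-unitˡ (pow f k) w)
pow-+ f (suc j) k w = trans (conv-cong (λ _ → refl) (pow-+ f j k) w) (sym (conv-assoc f (pow f j) (pow f k) w))

-- A factor without constant term consumes at least one letter, so the order of vanishing rises by
-- one.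
conv-low : ∀ {f g : Fn} m → f [] ≡ 0ℚ → (∀ u → length u < m → g u ≡ 0ℚ) → ∀ w → length w < suc m → conv f g w ≡ 0ℚ
conv-low {f} {g} m f0 h []      l = 0*x (g []) f0
conv-low {f} {g} m f0 h (a ∷ w) l = 0+0 (0*x (g (a ∷ w)) f0)
  (trans (conv-cong-≤ {f ∘ (a ∷_)} {f ∘ (a ∷_)} {g} {λ _ → 0ℚ} w (λ _ _ → refl) (λ u l' → h u (ℕₚ.≤-<-trans l' (ℕₚ.≤-pred l))))
    (conv-0ʳ {f ∘ (a ∷_)} w (λ _ → refl)))

pow-low : ∀ {f : Fn} → f [] ≡ 0ℚ → ∀ m w → length w < m → pow f m w ≡ 0ℚ
pow-low f0 (suc m) w l = conv-low m f0 (pow-low f0 m) w l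

qpow : ℚ → ℕ → ℚ
qpow c zero    = 1ℚ
qpow c (suc i) = c *q qpow c i

pow-scale : ∀ c f m w → pow (λ u → c *q f u) m w ≡ qpow c m *q pow f m w
pow-scale c f zero    w = sym (ℚₚ.*-identityˡ _)
pow-scale c f (suc m) w = trans (conv-*ˡ c f _ w) (trans
  (cong (c *q_) (trans (conv-cong {f} (λ _ → refl) (pow-scale c f m) w) (conv-*ʳ (qpow c m) f (pow f m) w)))
  (sym (ℚₚ.*-assoc c (qpow c m) _)))

evalP-qpow : ∀ d c a x → evalP d (λ i → qpow c i *q a i) x ≡ evalP d a (c *q x)
evalP-qpow zero    c a x = refl
evalP-qpow (suc d) c a x = cong+ (ℚₚ.*-identityˡ (a 0)) (begin
  x *q evalP d (λ i → c *q qpow c i *q a (suc i)) x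
    ≡⟨ cong (x *q_) (evalP-cong d x (λ i _ → ℚₚ.*-assoc c (qpow c i) (a (suc i)))) ⟩
  x *q evalP d (λ i → c *q (qpow c i *q a (suc i))) x
    ≡⟨ cong (x *q_) (trans (evalP-* d c _ x) (cong (c *q_) (evalP-qpow d c (a ∘ suc) x))) ⟩
  x *q (c *q evalP d (a ∘ suc) (c *q x))
    ≡⟨ solve 3 (λ x c e → x :* (c :* e) := c :* x :* e) refl x c _ ⟩
  c *q x *q evalP d (a ∘ suc) (c *q x) ∎)
  where
  open QS
  open ≡-Reasoning

-- Binomial coefficients as polynomials

-- The coefficients of x(x-1)...(x-m+1)/m!, each step multiplying by (x - m)/(m + 1).
binom : ℕ → ℕ → ℚ
binom zero    zero    = 1ℚ
binom zero    (suc i) = 0ℚ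
binom (suc m) zero    = (+ 1 / suc m) *q (-q ι m *q binom m 0)
binom (suc m) (suc i) = (+ 1 / suc m) *q (binom m i +q -q ι m *q binom m (suc i))

binom-support : ∀ m i → m < i → binom m i ≡ 0ℚ
binom-support zero    (suc i) l = refl
binom-support (suc m) (suc i) l = trans
  (cong₂ (λ x y → (+ 1 / suc m) *q (x +q -q ι m *q y)) (binom-support m i (ℕₚ.≤-pred l)) (binom-support m (suc i) (ℕₚ.m≤n⇒m≤1+n (ℕₚ.≤-pred l))))
  (solve 2 (λ c n → c :* (con 0ℚ :+ :- n :* con 0ℚ) := con 0ℚ) refl (+ 1 / suc m) (ι m))
  where open QS

binom-constant : ∀ m → binom (suc m) 0 ≡ 0ℚ
binom-constant zero    = refl
binom-constant (suc m) = trans (cong (λ x → (+ 1 / suc (suc m)) *q (-q ι (suc m) *q x)) (binom-constant m))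
  (solve 2 (λ c n → c :* (:- n :* con 0ℚ) := con 0ℚ) refl (+ 1 / suc (suc m)) (ι (suc m)))
  where open QS

-- The source of the logarithm: the linear coefficients of the binomial polynomials are the
-- coefficients of log(1 + F).
binom-linear : ∀ m → binom (suc m) 1 ≡ signQ m *q (+ 1 / suc m)
binom-linear zero    = refl
binom-linear (suc m) = begin
  c' *q (binom (suc m) 0 +q -q n *q binom (suc m) 1)
    ≡⟨ cong₂ (λ x y → c' *q (x +q -q n *q y)) (binom-constant m) (binom-linear m) ⟩
  c' *q (0ℚ +q -q n *q (s *q c))
    ≡⟨ solve 4 (λ c' n s c → c' :* (con 0ℚ :+ :- n :* (s :* c)) := :- s :* c' :* (c :* n)) refl c' n s c ⟩
  -q s *q c' *q (c *q n)
    ≡⟨ cong (-q s *q c' *q_) (recip-ι m) ⟩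
  -q s *q c' *q 1ℚ
    ≡⟨ ℚₚ.*-identityʳ _ ⟩
  -q s *q c' ∎
  where
  open QS
  open ≡-Reasoning
  c' = + 1 / suc (suc m)
  c = + 1 / suc m
  n = ι (suc m)
  s = signQ m

Binom : ℕ → ℚ → ℚ
Binom m x = evalP (suc m) (binom m) x

Binom-suc : ∀ m x → ι (suc m) *q Binom (suc m) x ≡ (x +q -q ι m) *q Binom m x
Binom-suc m x = begin
  n *q (c *q (-q k *q binom m 0) +q x *q evalP (suc m) (λ i → c *q (binom m i +q -q k *q binom m (suc i))) x)
    ≡⟨ cong (λ y → n *q (c *q (-q k *q binom m 0) +q x *q y)) (trans (evalP-* (suc m) c (λ i → binom m i +q -q k *q binom m (suc i)) x)
        (cong (c *q_) (trans (evalP-+ (suc m) (binom m) (λ i → -q k *q binom m (suc i)) x) (cong (e +q_) (evalP-* (suc m) (-q k) (binom m ∘ suc) x))))) ⟩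
  n *q (c *q (-q k *q binom m 0) +q x *q (c *q (e +q -q k *q evalP (suc m) (binom m ∘ suc) x)))
    ≡⟨ solve 7 (λ n c k b x e f → n :* (c :* (:- k :* b) :+ x :* (c :* (e :+ :- k :* f))) := (c :* n) :* (x :* e :+ :- k :* (b :+ x :* f))) refl
        n c k (binom m 0) x e _ ⟩
  (c *q n) *q (x *q e +q -q k *q evalP (suc (suc m)) (binom m) x)
    ≡⟨ cong₂ (λ y z → y *q (x *q e +q -q k *q z)) (recip-ι m) (evalP-ext (binom m) x (ℕₚ.n≤1+n (suc m)) (binom-support m)) ⟩
  1ℚ *q (x *q e +q -q k *q e)
    ≡⟨ solve 3 (λ x e k → con 1ℚ :* (x :* e :+ :- k :* e) := (x :+ :- k) :* e) refl x e k ⟩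
  (x +q -q k) *q e ∎
  where
  open QS
  open ≡-Reasoning
  n = ι (suc m)
  k = ι m
  c = + 1 / suc m
  e = Binom m x

ι-cancel : ∀ m {x y} → ι (suc m) *q x ≡ ι (suc m) *q y → x ≡ y
ι-cancel m {x} {y} eq = x-y≡0⇒x≡y x y (p*x≡0⇒x≡0 (ι (suc m)) _ (ι-suc≢0 m)
  (trans (solve 3 (λ n x y → n :* (x :+ :- y) := n :* x :+ :- (n :* y)) refl (ι (suc m)) x y)
    (trans (cong (_+q -q (ι (suc m) *q y)) eq) (ℚₚ.+-inverseʳ (ι (suc m) *q y)))))
  where open QS

-- Once the denominator `ι (suc m)` is cleared, this is the absorption identity `step`, which
-- unfolds by Pascal's rule one degree lower.
Pascal : ∀ m x → Binom (suc m) (1ℚ +q x) ≡ Binom m x +q Binom (suc m) x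
Pascal m x = ι-cancel m (begin
  ι (suc m) *q Binom (suc m) (1ℚ +q x)          ≡⟨ Binom-suc m (1ℚ +q x) ⟩
  (1ℚ +q x +q -q ι m) *q Binom m (1ℚ +q x)      ≡⟨ step m ⟩
  (1ℚ +q x) *q Binom m x                        ≡⟨ solve 3 (λ x n b → (con 1ℚ :+ x) :* b := (con 1ℚ :+ n) :* b :+ (x :+ :- n) :* b) refl x (ι m) (Binom m x) ⟩
  ι (suc m) *q Binom m x +q (x +q -q ι m) *q Binom m x ≡⟨ cong (ι (suc m) *q Binom m x +q_) (sym (Binom-suc m x)) ⟩
  ι (suc m) *q Binom m x +q ι (suc m) *q Binom (suc m) x ≡⟨ sym (ℚₚ.*-distribˡ-+ (ι (suc m)) _ _) ⟩
  ι (suc m) *q (Binom m x +q Binom (suc m) x)   ∎)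
  where
  open QS
  open ≡-Reasoning
  step : ∀ m → (1ℚ +q x +q -q ι m) *q Binom m (1ℚ +q x) ≡ (1ℚ +q x) *q Binom m x
  step zero    = solve 1 (λ x → (con 1ℚ :+ x :+ :- con 0ℚ) :* (con 1ℚ :+ (con 1ℚ :+ x) :* con 0ℚ) := (con 1ℚ :+ x) :* (con 1ℚ :+ x :* con 0ℚ)) refl x
  step (suc m) = begin
    (1ℚ +q x +q -q ι (suc m)) *q Binom (suc m) (1ℚ +q x)
      ≡⟨ cong ((1ℚ +q x +q -q ι (suc m)) *q_) (Pascal m x) ⟩
    (1ℚ +q x +q -q (1ℚ +q ι m)) *q (Binom m x +q Binom (suc m) x)
      ≡⟨ solve 4 (λ x n b b' → (con 1ℚ :+ x :+ :- (con 1ℚ :+ n)) :* (b :+ b') := (x :+ :- n) :* b :+ (x :+ :- n) :* b') refl x (ι m) (Binom m x) (Binom (suc m) x) ⟩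
    (x +q -q ι m) *q Binom m x +q (x +q -q ι m) *q Binom (suc m) x
      ≡⟨ cong (_+q (x +q -q ι m) *q Binom (suc m) x) (sym (Binom-suc m x)) ⟩
    (1ℚ +q ι m) *q Binom (suc m) x +q (x +q -q ι m) *q Binom (suc m) x
      ≡⟨ solve 3 (λ x n b → (con 1ℚ :+ n) :* b :+ (x :+ :- n) :* b := (con 1ℚ :+ x) :* b) refl x (ι m) (Binom (suc m) x) ⟩
    (1ℚ +q x) *q Binom (suc m) x ∎

-- Logarithm, exponential and powers of functions on words.

logC : Fn → Fn
logC V w = ∑< (length w) (λ k → (signQ k *q (+ 1 / suc k)) *q pow (λ u → V u +q -q 1ℚ *q unit u) (suc k) w)

divPow : Fn → ℕ → Fn
divPow G i w = invFact i *q pow G i w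

-- The exponential of xG with x kept as a separate variable: on a fixed word it is a polynomial in x
-- whose coefficients are the divided powers of G. The cut-off at the length is exact when G
-- vanishes on the empty word (`divPow-low`).
expC : Fn → ℚ → Fn
expC G x w = evalP (suc (length w)) (λ i → divPow G i w) x

divPow-low : ∀ {G : Fn} → G [] ≡ 0ℚ → ∀ i w → length w < i → divPow G i w ≡ 0ℚ
divPow-low G0 i w l = x*0 (invFact i) (pow-low G0 i w l)

expC-bound : ∀ {G : Fn} → G [] ≡ 0ℚ → ∀ d x w → length w < d → expC G x w ≡ evalP d (λ i → divPow G i w) x
expC-bound G0 d x w l = sym (evalP-ext _ x l (λ i → divPow-low G0 i w))

divPow-scale : ∀ c G i w → divPow (λ u → c *q G u) i w ≡ qpow c i *q divPow G i w
divPow-scale c G i w = trans (cong (invFact i *q_) (pow-scale c G i w)) (*q-left-comm (invFact i) (qpow c i) (pow G i w))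

expC-scale : ∀ c G x w → expC (λ u → c *q G u) x w ≡ expC G (c *q x) w
expC-scale c G x w = trans (evalP-cong (suc (length w)) x (λ i _ → divPow-scale c G i w)) (evalP-qpow (suc (length w)) c (λ i → divPow G i w) x)

-- Substituting one power series into another is avoided: V^j is expanded binomially, its linear
-- coefficient in j is the logarithm, and the addition law V^(j+k) = V^j ⋆ V^k forces the other
-- coefficients to be the divided powers of that logarithm.
module BinomialSeries (V : Fn) (V0 : V [] ≡ 1ℚ) where

  F : Fn
  F u = V u +q -q 1ℚ *q unit u

  F0 : F [] ≡ 0ℚ
  F0 = trans (cong (_+q -q 1ℚ *q 1ℚ) V0) refl

  V≡1+F : ∀ u → V u ≡ unit u +q F u
  V≡1+F u = solve 2 (λ v e → v := e :+ (v :+ :- con 1ℚ :* e)) refl (V u) (unit u)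
    where open QS

  pow-binomial : ∀ d j w → length w < suc d → pow V j w ≡ ∑< (suc d) (λ m → Binom m (ι j) *q pow F m w)
  pow-binomial d zero w l = sym (trans
    (cong+ (ℚₚ.*-identityˡ (unit w)) (∑<-0 d (λ m _ → 0*x (pow F (suc m) w)
      (trans (cong+ (binom-constant m) (ℚₚ.*-zeroˡ (evalP (suc m) (binom (suc m) ∘ suc) 0ℚ))) refl))))
    (ℚₚ.+-identityʳ (unit w)))
  pow-binomial d (suc j) w l = begin
    conv V (pow V j) w
      ≡⟨ conv-cong-≤ w (λ u _ → V≡1+F u) (λ u h → pow-binomial d j u (ℕₚ.≤-<-trans h l)) ⟩
    conv (λ u → unit u +q F u) S w
      ≡⟨ trans (conv-+ˡ unit F S w) (cong (_+q conv F S w) (conv-unitˡ S w)) ⟩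
    S w +q conv F S w
      ≡⟨ cong (S w +q_) (trans (conv-∑<ʳ (suc d) F (λ m u → b m *q pow F m u) w)
           (∑<-cong (suc d) (λ m _ → conv-*ʳ (b m) F (pow F m) w))) ⟩
    S w +q ∑< (suc d) (λ m → b m *q pow F (suc m) w)
      -- The term m = d now carries `pow F (suc d)`, which vanishes on a word of length at most d.
      ≡⟨ cong (S w +q_) (trans (∑<-last d (λ m → b m *q pow F (suc m) w))
           (trans (cong (T +q_) (x*0 (b d) (pow-low F0 (suc d) w l))) (ℚₚ.+-identityʳ T))) ⟩
    (b 0 *q pow F 0 w +q ∑< d (λ m → b (suc m) *q pow F (suc m) w)) +q T
      ≡⟨ ℚₚ.+-assoc (b 0 *q pow F 0 w) _ T ⟩
    b 0 *q pow F 0 w +q (∑< d (λ m → b (suc m) *q pow F (suc m) w) +q T)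
      ≡⟨ cong (b 0 *q pow F 0 w +q_) (trans (sym (∑<-+ d (λ m → b (suc m) *q pow F (suc m) w) (λ m → b m *q pow F (suc m) w)))
           (∑<-cong d (λ m _ → trans (solve 3 (λ x y p → x :* p :+ y :* p := (y :+ x) :* p) refl (b (suc m)) (b m) (pow F (suc m) w))
             (cong (_*q pow F (suc m) w) (sym (Pascal m (ι j))))))) ⟩
    b 0 *q pow F 0 w +q ∑< d (λ m → Binom (suc m) (ι (suc j)) *q pow F (suc m) w)
      ≡⟨ cong (λ x → x *q pow F 0 w +q ∑< d (λ m → Binom (suc m) (ι (suc j)) *q pow F (suc m) w))
           (solve 2 (λ x y → con 1ℚ :+ x :* con 0ℚ := con 1ℚ :+ y :* con 0ℚ) refl (ι j) (ι (suc j))) ⟩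
    ∑< (suc d) (λ m → Binom m (ι (suc j)) *q pow F m w) ∎
    where
    open QS
    open ≡-Reasoning
    b : ℕ → ℚ
    b m = Binom m (ι j)
    S : Fn
    S u = ∑< (suc d) (λ m → b m *q pow F m u)
    T : ℚ
    T = ∑< d (λ m → b m *q pow F (suc m) w)

  -- The coefficient of jⁱ in the polynomial function j ↦ V^j(w).
  P : ℕ → Fn
  P i w = ∑< (suc (length w)) (λ m → binom m i *q pow F m w)

  P-low : ∀ i w → length w < i → P i w ≡ 0ℚ
  P-low i w l = ∑<-0 (suc (length w)) (λ m m<d → 0*x (pow F m w) (binom-support m i (ℕₚ.<-≤-trans m<d l)))

  pow-evalP : ∀ d j w → length w < d → pow V j w ≡ evalP d (λ i → P i w) (ι j)
  pow-evalP d j w l = trans (pow-binomial n j w ℕₚ.≤-refl) (sym (trans (evalP-ext (λ i → P i w) (ι j) l (λ i → P-low i w))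
    (trans (evalP-∑< (suc n) (suc n) (λ m i → binom m i *q pow F m w) (ι j)) (∑<-cong (suc n) λ m m<d →
      trans (evalP-cong (suc n) (ι j) (λ i _ → ℚₚ.*-comm (binom m i) (pow F m w)))
       (trans (evalP-* (suc n) (pow F m w) (binom m) (ι j))
        (trans (cong (pow F m w *q_) (evalP-ext (binom m) (ι j) m<d (binom-support m))) (ℚₚ.*-comm (pow F m w) (Binom m (ι j)))))))))
    where n = length w

  P-constant : ∀ w → P 0 w ≡ unit w
  P-constant w = trans (cong+ (ℚₚ.*-identityˡ (unit w)) (∑<-0 (length w) (λ m _ → 0*x (pow F (suc m) w) (binom-constant m)))) (ℚₚ.+-identityʳ (unit w))

  P-linear : ∀ w → P 1 w ≡ logC V w
  P-linear w = trans (cong+ (ℚₚ.*-zeroˡ (unit w)) (∑<-cong (length w) (λ m _ → cong (_*q pow F (suc m) w) (binom-linear m)))) (ℚₚ.+-identityˡ _)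

  evalP-conv : ∀ d w → length w < d → ∀ x y →
    conv (λ u → evalP d (λ i → P i u) x) (λ u → evalP d (λ i → P i u) y) w ≡ evalP d (λ a → evalP d (λ b → conv (P a) (P b) w) y) x
  evalP-conv d w l x y = trans (conv-evalPˡ d P x _ w) (evalP-cong d x (λ a _ → conv-evalPʳ d (P a) P y w))

  P-add : ∀ d w → length w < d → ∀ j k →
    evalP d (λ i → P i w) (ι j +q ι k) ≡ evalP d (λ a → evalP d (λ b → conv (P a) (P b) w) (ι k)) (ι j)
  P-add d w l j k = begin
    evalP d (λ i → P i w) (ι j +q ι k)  ≡⟨ cong (evalP d (λ i → P i w)) (sym (ι-+ j k)) ⟩
    evalP d (λ i → P i w) (ι (j + k))   ≡⟨ sym (pow-evalP d (j + k) w l) ⟩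
    pow V (j + k) w                     ≡⟨ pow-+ V j k w ⟩
    conv (pow V j) (pow V k) w          ≡⟨ conv-cong-≤ w (λ u h → pow-evalP d j u (ℕₚ.≤-<-trans h l)) (λ u h → pow-evalP d k u (ℕₚ.≤-<-trans h l)) ⟩
    conv (λ u → evalP d (λ i → P i u) (ι j)) (λ u → evalP d (λ i → P i u) (ι k)) w ≡⟨ evalP-conv d w l (ι j) (ι k) ⟩
    evalP d (λ a → evalP d (λ b → conv (P a) (P b) w) (ι k)) (ι j) ∎
    where open ≡-Reasoning

  -- Compare the coefficients of j in V^(j+k) = V^j ⋆ V^k.
  P-suc : ∀ i w → ι (suc i) *q P (suc i) w ≡ conv (P 1) (P i) w
  P-suc i w = poly-unique d (derivP (λ i → P i w)) (λ b → conv (P 1) (P b) w) ι ι-injective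
    (λ k → trans (evalP-ext (derivP (λ i → P i w)) (ι k) (ℕₚ.n≤1+n _) (λ i' l → x*0 (ι (suc i')) (P-low (suc i') w (s≤s (ℕₚ.≤-trans (ℕₚ.≤-trans (ℕₚ.m≤m+n _ i) (ℕₚ.n≤1+n _)) l)))))
      (trans (sym (shiftP-linear (ι k) (suc (length w + i)) (λ i → P i w)))
        (poly-unique d (shiftP (ι k) d (λ i → P i w)) (λ a → evalP d (λ b → conv (P a) (P b) w) (ι k)) ι ι-injective
          (λ j → trans (shiftP-eval (ι k) d (λ i → P i w) (ι j)) (P-add d w l<d j k)) 1 (s<s z<s))))
    i (s≤s (ℕₚ.≤-trans (ℕₚ.m≤n+m i (length w)) (ℕₚ.n≤1+n _)))
    where
    -- Exceeds both the length of the word and the index, with one to spare because differentiation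
    -- lowers the bound by one.
    d = suc (suc (length w + i))
    l<d : length w < d
    l<d = s≤s (ℕₚ.≤-trans (ℕₚ.m≤m+n _ i) (ℕₚ.n≤1+n _))

  L : Fn
  L = logC V

  -- `P-suc` is the recursion that defines divided powers, and `P-linear` identifies the element
  -- being raised to powers.
  P≡divPow : ∀ i w → P i w ≡ divPow L i w
  P≡divPow zero    w = trans (P-constant w) (sym (ℚₚ.*-identityˡ (unit w)))
  P≡divPow (suc i) w = ι-cancel i (trans (P-suc i w) (trans (conv-cong P-linear (P≡divPow i) w)
    (trans (conv-*ʳ (invFact i) L (pow L i) w) (sym (begin
      ι (suc i) *q (invFact i *q (+ 1 / suc i) *q p)   ≡⟨ solve 4 (λ n f c p → n :* (f :* c :* p) := (c :* n) :* (f :* p)) refl (ι (suc i)) (invFact i) (+ 1 / suc i) p ⟩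
      ((+ 1 / suc i) *q ι (suc i)) *q (invFact i *q p) ≡⟨ cong (_*q (invFact i *q p)) (recip-ι i) ⟩
      1ℚ *q (invFact i *q p)                           ≡⟨ ℚₚ.*-identityˡ (invFact i *q p) ⟩
      invFact i *q p ∎)))))
    where
    open QS
    open ≡-Reasoning
    p = conv L (pow L i) w

  pow≡expC : ∀ j w → pow V j w ≡ expC L (ι j) w
  pow≡expC j w = trans (pow-evalP _ j w ℕₚ.≤-refl) (evalP-cong (suc (length w)) (ι j) (λ i _ → P≡divPow i w))

  expC≡evalP : ∀ d x w → length w < d → expC L x w ≡ evalP d (λ i → P i w) x
  expC≡evalP d x w l = trans (evalP-cong (suc (length w)) x (λ i _ → sym (P≡divPow i w))) (sym (evalP-ext (λ i → P i w) x l (λ i → P-low i w)))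

  -- Both sides are polynomial in x and y and agree on natural numbers.
  expC-+ : ∀ x y w → conv (expC L x) (expC L y) w ≡ expC L (x +q y) w
  expC-+ x y w = begin
    conv (expC L x) (expC L y) w
      ≡⟨ conv-cong-≤ w (λ u h → expC≡evalP d x u (s≤s h)) (λ u h → expC≡evalP d y u (s≤s h)) ⟩
    conv (λ u → evalP d (λ i → P i u) x) (λ u → evalP d (λ i → P i u) y) w
      ≡⟨ conv-evalPʳ d (λ u → evalP d (λ i → P i u) x) P y w ⟩
    evalP d (λ b → conv (λ u → evalP d (λ i → P i u) x) (P b) w) y
      ≡⟨ poly-unique-eval d (λ b → conv (λ u → evalP d (λ i → P i u) x) (P b) w) (shiftP x d p) ι ι-injective
           (λ k → trans (sym (conv-evalPʳ d (λ u → evalP d (λ i → P i u) x) P (ι k) w))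
             (trans (nat k) (trans (cong (evalP d p) (ℚₚ.+-comm x (ι k))) (sym (shiftP-eval x d p (ι k)))))) y ⟩
    evalP d (shiftP x d p) y      ≡⟨ shiftP-eval x d p y ⟩
    evalP d p (y +q x)            ≡⟨ cong (evalP d p) (ℚₚ.+-comm y x) ⟩
    evalP d p (x +q y)            ≡⟨ sym (expC≡evalP d (x +q y) w ℕₚ.≤-refl) ⟩
    expC L (x +q y) w ∎
    where
    open ≡-Reasoning
    d = suc (length w)
    p : ℕ → ℚ
    p i = P i w
    nat : ∀ k → conv (λ u → evalP d (λ i → P i u) x) (λ u → evalP d (λ i → P i u) (ι k)) w ≡ evalP d p (x +q ι k)
    nat k = trans (evalP-conv d w ℕₚ.≤-refl x (ι k))
      (trans (poly-unique-eval d (λ a → evalP d (λ b → conv (P a) (P b) w) (ι k)) (shiftP (ι k) d p) ι ι-injective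
        (λ j → trans (sym (P-add d w ℕₚ.≤-refl j k)) (sym (shiftP-eval (ι k) d p (ι j)))) x)
        (shiftP-eval (ι k) d p x))

-- Monotone words and products of their indicators.

ind : Bool → ℚ
ind true  = 1ℚ
ind false = 0ℚ

-- The sign true stands for + (ascending), false for − (descending).
step : Bool → ℕ → ℕ → Bool
step s a b = eqB s (not (b <ᵇ a))

-- Weakly increasing words for `true`, strictly decreasing ones for `false`: the two conditions are
-- complementary on every adjacent pair, also on equal letters.
χ : Bool → Fn
χ s []          = 1ℚ
χ s (a ∷ [])    = 1ℚ
χ s (a ∷ b ∷ w) = ind (step s a b) *q χ s (b ∷ w)

ind-step : ∀ s a b → ind (step s a b) +q ind (step (not s) a b) ≡ 1ℚ
ind-step true  a b with b <ᵇ a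
... | true  = refl
... | false = refl
ind-step false a b with b <ᵇ a
... | true  = refl
... | false = refl

N : List Bool → Fn
N []      = unit
N (s ∷ ε) = conv (χ s) (N ε)

alt : Bool → ℕ → List Bool
alt s zero    = []
alt s (suc k) = s ∷ alt (not s) k

-- Doubling by a recursion along which `alt s` unfolds two signs at a time.
dbl : ℕ → ℕ
dbl zero    = zero
dbl (suc j) = suc (suc (dbl j))

ι-dbl : ∀ j → ι (dbl j) ≡ ι j +q ι j
ι-dbl zero    = refl
ι-dbl (suc j) = trans (cong (λ x → 1ℚ +q (1ℚ +q x)) (ι-dbl j)) (solve 1 (λ x → con 1ℚ :+ (con 1ℚ :+ (x :+ x)) := (con 1ℚ :+ x) :+ (con 1ℚ :+ x)) refl (ι j))
  where open QS

half-dbl : ∀ j → ½ *q ι (dbl j) ≡ ι j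
half-dbl j = trans (cong (½ *q_) (ι-dbl j)) (solve 1 (λ x → con ½ :* (x :+ x) := x) refl (ι j))
  where open QS

-- The families I and J as functions on words.

V2 : Bool → Fn
V2 s = conv (χ s) (χ (not s))

L : Bool → Fn
L s = logC (V2 s)

module BS (s : Bool) = BinomialSeries (V2 s) refl

Ic : Bool → ℕ → Fn
Ic s = divPow (λ u → ½ *q L s u)

J0 : Bool → Fn
J0 s = conv (χ s) (expC (λ u → -½ *q L (not s) u) 1ℚ)

Jc : Bool → ℕ → Fn
Jc s i = conv (J0 s) (Ic (not s) i)

Ic-low : ∀ s i w → length w < i → Ic s i w ≡ 0ℚ
Ic-low s = divPow-low {λ u → ½ *q L s u} refl

Jc-low : ∀ s i w → length w < i → Jc s i w ≡ 0ℚ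
Jc-low s i w l = trans (conv-cong-≤ {J0 s} {J0 s} {Ic (not s) i} {λ _ → 0ℚ} w (λ _ _ → refl) (λ u h → Ic-low (not s) i u (ℕₚ.≤-<-trans h l)))
  (conv-0ʳ {J0 s} w (λ _ → refl))

N-alt-even : ∀ s j w → N (alt s (dbl j)) w ≡ pow (V2 s) j w
N-alt-even s zero    w = refl
N-alt-even s (suc j) w rewrite not-involutive s =
  trans (sym (conv-assoc (χ s) (χ (not s)) (N (alt s (dbl j))) w)) (conv-cong {V2 s} (λ _ → refl) (N-alt-even s j) w)

Ic-eval : ∀ s d x w → length w < d → evalP d (λ i → Ic s i w) x ≡ expC (L s) (½ *q x) w
Ic-eval s d x w l = trans (sym (expC-bound {λ u → ½ *q L s u} refl d x w l)) (expC-scale ½ (L s) x w)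

-- V_2j = (V_2)^j = exp(2j · ½ log V_2): the factor ½ in I_1 makes the number 2j of factors the
-- variable.
N-even : ∀ s j d w → length w < d → N (alt s (dbl j)) w ≡ evalP d (λ i → Ic s i w) (ι (dbl j))
N-even s j d w l = trans (N-alt-even s j w) (trans (BS.pow≡expC s j w)
  (trans (cong (λ x → expC (L s) x w) (sym (half-dbl j))) (sym (Ic-eval s d (ι (dbl j)) w l))))

J0-exp : ∀ s w → J0 s w ≡ conv (χ s) (expC (L (not s)) -½) w
J0-exp s w = conv-cong {χ s} (λ _ → refl) (λ u → expC-scale -½ (L (not s)) 1ℚ u) w

Jc-eval : ∀ s d x w → length w < d → evalP d (λ i → Jc s i w) x ≡ conv (χ s) (expC (L (not s)) (-½ +q ½ *q x)) w
Jc-eval s d x w l = begin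
  evalP d (λ i → conv (J0 s) (Ic s' i) w) x
    ≡⟨ sym (conv-evalPʳ d (J0 s) (Ic s') x w) ⟩
  conv (J0 s) (λ u → evalP d (λ i → Ic s' i u) x) w
    ≡⟨ conv-cong-≤ w (λ u _ → J0-exp s u) (λ u h → Ic-eval s' d x u (ℕₚ.≤-<-trans h l)) ⟩
  conv (conv (χ s) (expC (L s') -½)) (expC (L s') (½ *q x)) w
    ≡⟨ conv-assoc (χ s) (expC (L s') -½) (expC (L s') (½ *q x)) w ⟩
  conv (χ s) (conv (expC (L s') -½) (expC (L s') (½ *q x))) w
    ≡⟨ conv-cong {χ s} (λ _ → refl) (BS.expC-+ s' -½ (½ *q x)) w ⟩
  conv (χ s) (expC (L s') (-½ +q ½ *q x)) w ∎
  where
  open ≡-Reasoning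
  s' = not s

-- V_(2j+1) is V_1 followed by the j-th power of the opposite V_2, and j = -½ + ½(2j + 1). This is
-- the origin of the exponent -½ in J_0.
N-odd : ∀ s j d w → length w < d → N (alt s (suc (dbl j))) w ≡ evalP d (λ i → Jc s i w) (ι (suc (dbl j)))
N-odd s j d w l = trans
  (conv-cong {χ s} (λ _ → refl) (λ u → trans (N-alt-even (not s) j u) (trans (BS.pow≡expC (not s) j u) (cong (λ x → expC (L (not s)) x u) (sym eq)))) w)
  (sym (Jc-eval s d (ι (suc (dbl j))) w l))
  where
  open QS
  eq : -½ +q ½ *q ι (suc (dbl j)) ≡ ι j
  eq = trans (solve 1 (λ x → con -½ :+ con ½ :* (con 1ℚ :+ x) := con ½ :* x) refl (ι (dbl j))) (half-dbl j)

-- Parity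

-- The substitution t ↦ -t, where t records the degree.
ω : Fn → Fn
ω f w = signQ (length w) *q f w

signQ-square : ∀ n → signQ n *q signQ n ≡ 1ℚ
signQ-square zero    = refl
signQ-square (suc n) = trans (solve 1 (λ x → :- x :* :- x := x :* x) refl (signQ n)) (signQ-square n)
  where open QS

ω-involutive : ∀ f w → ω (ω f) w ≡ f w
ω-involutive f w = trans (sym (ℚₚ.*-assoc s s (f w))) (trans (cong (_*q f w) (signQ-square (length w))) (ℚₚ.*-identityˡ (f w)))
  where s = signQ (length w)

ω-unit : ∀ w → ω unit w ≡ unit w
ω-unit []      = refl
ω-unit (a ∷ w) = ℚₚ.*-zeroʳ (signQ (suc (length w)))

ω-conv : ∀ f g w → ω (conv f g) w ≡ conv (ω f) (ω g) w
ω-conv f g []      = solve 2 (λ f g → con 1ℚ :* (f :* g) := (con 1ℚ :* f) :* (con 1ℚ :* g)) refl (f []) (g [])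
  where open QS
ω-conv f g (a ∷ w) = begin
  -q s *q (f [] *q g (a ∷ w) +q conv (f ∘ (a ∷_)) g w)
    ≡⟨ solve 4 (λ s f g c → :- s :* (f :* g :+ c) := (con 1ℚ :* f) :* (:- s :* g) :+ :- con 1ℚ :* (s :* c)) refl s (f []) (g (a ∷ w)) _ ⟩
  (1ℚ *q f []) *q (-q s *q g (a ∷ w)) +q -q 1ℚ *q (s *q conv (f ∘ (a ∷_)) g w)
    ≡⟨ cong (λ x → (1ℚ *q f []) *q (-q s *q g (a ∷ w)) +q -q 1ℚ *q x) (ω-conv (f ∘ (a ∷_)) g w) ⟩
  (1ℚ *q f []) *q (-q s *q g (a ∷ w)) +q -q 1ℚ *q conv (ω (f ∘ (a ∷_))) (ω g) w
    ≡⟨ cong ((1ℚ *q f []) *q (-q s *q g (a ∷ w)) +q_) (trans (sym (conv-*ˡ (-q 1ℚ) (ω (f ∘ (a ∷_))) (ω g) w))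
         (conv-cong {g = ω g} (λ u → solve 2 (λ s x → :- con 1ℚ :* (s :* x) := :- s :* x) refl (signQ (length u)) (f (a ∷ u))) (λ _ → refl) w)) ⟩
  (1ℚ *q f []) *q (-q s *q g (a ∷ w)) +q conv (ω f ∘ (a ∷_)) (ω g) w ∎
  where
  open QS
  open ≡-Reasoning
  s = signQ (length w)

ω-pow : ∀ f m w → ω (pow f m) w ≡ pow (ω f) m w
ω-pow f zero    w = ω-unit w
ω-pow f (suc m) w = trans (ω-conv f (pow f m) w) (conv-cong {ω f} (λ _ → refl) (ω-pow f m) w)

-- The left factor already contains a. The next letter either starts the right factor or extends the
-- left one, and by `ind-step` the two contributions combine into a step of sign s.
χ-inverse-aux : ∀ s a w → conv (χ (not s) ∘ (a ∷_)) (ω (χ s)) w ≡ signQ (length w) *q χ s (a ∷ w)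
χ-inverse-aux s a []      = refl
χ-inverse-aux s a (b ∷ w) = begin
  1ℚ *q (-q σ *q x) +q conv (λ u → ind (step (not s) a b) *q χ (not s) (b ∷ u)) (ω (χ s)) w
    ≡⟨ cong (1ℚ *q (-q σ *q x) +q_) (trans (conv-*ˡ p' (χ (not s) ∘ (b ∷_)) (ω (χ s)) w) (cong (p' *q_) (χ-inverse-aux s b w))) ⟩
  1ℚ *q (-q σ *q x) +q p' *q (σ *q x)
    ≡⟨ solve 4 (λ σ x p p' → con 1ℚ :* (:- σ :* x) :+ p' :* (σ :* x) := :- σ :* (p :* x) :+ σ :* x :* ((p :+ p') :+ :- con 1ℚ)) refl σ x p p' ⟩
  -q σ *q (p *q x) +q σ *q x *q ((p +q p') +q -q 1ℚ)
    ≡⟨ cong (λ y → -q σ *q (p *q x) +q σ *q x *q (y +q -q 1ℚ)) (ind-step s a b) ⟩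
  -q σ *q (p *q x) +q σ *q x *q 0ℚ
    ≡⟨ solve 2 (λ y z → y :+ z :* con 0ℚ := y) refl (-q σ *q (p *q x)) (σ *q x) ⟩
  -q σ *q (p *q x) ∎
  where
  open QS
  open ≡-Reasoning
  σ = signQ (length w)
  x = χ s (b ∷ w)
  p = ind (step s a b)
  p' = ind (step (not s) a b)

χ-inverse : ∀ s w → conv (χ (not s)) (ω (χ s)) w ≡ unit w
χ-inverse s []      = refl
χ-inverse s (a ∷ w) = trans (cong (1ℚ *q (-q σ *q x) +q_) (χ-inverse-aux s a w))
  (solve 2 (λ σ x → con 1ℚ :* (:- σ :* x) :+ σ :* x := con 0ℚ) refl σ x)
  where
  open QS
  σ = signQ (length w)
  x = χ s (a ∷ w)

χ-inverse' : ∀ s w → conv (ω (χ (not s))) (χ s) w ≡ unit w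
χ-inverse' s w = begin
  conv (ω (χ (not s))) (χ s) w         ≡⟨ conv-cong {ω (χ (not s))} (λ _ → refl) (λ u → sym (ω-involutive (χ s) u)) w ⟩
  conv (ω (χ (not s))) (ω (ω (χ s))) w ≡⟨ sym (ω-conv (χ (not s)) (ω (χ s)) w) ⟩
  ω (conv (χ (not s)) (ω (χ s))) w     ≡⟨ cong (signQ (length w) *q_) (χ-inverse s w) ⟩
  ω unit w                             ≡⟨ ω-unit w ⟩
  unit w ∎
  where open ≡-Reasoning

χ-inverse'' : ∀ s w → conv (ω (χ s)) (χ (not s)) w ≡ unit w
χ-inverse'' true  = χ-inverse' false
χ-inverse'' false = χ-inverse' true

conv-cancel-middle : ∀ {f g h k : Fn} → (∀ u → conv g h u ≡ unit u) → ∀ w → conv (conv f g) (conv h k) w ≡ conv f k w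
conv-cancel-middle {f} {g} {h} {k} e w = begin
  conv (conv f g) (conv h k) w  ≡⟨ conv-assoc f g (conv h k) w ⟩
  conv f (conv g (conv h k)) w  ≡⟨ conv-cong {f} (λ _ → refl) (λ u → trans (sym (conv-assoc g h k u)) (trans (conv-cong e (λ _ → refl) u) (conv-unitˡ k u))) w ⟩
  conv f k w ∎
  where open ≡-Reasoning

-- The middle factors cancel, and after them the outer ones. Hence the logarithm of V_2 is odd in t,
-- which is exploited in `ω-divPow`.
ωV2-inverse : ∀ s w → conv (ω (V2 s)) (V2 s) w ≡ unit w
ωV2-inverse s w = trans (conv-cong {g = V2 s} (ω-conv (χ s) (χ (not s))) (λ _ → refl) w)
  (trans (conv-cancel-middle {ω (χ s)} {ω (χ (not s))} {χ s} {χ (not s)} (χ-inverse' s) w) (χ-inverse'' s w))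

pow-inverse : ∀ {f g : Fn} → (∀ u → conv f g u ≡ unit u) → ∀ m w → conv (pow f m) (pow g m) w ≡ unit w
pow-inverse e zero    w = conv-unitˡ unit w
pow-inverse {f} {g} e (suc m) w = trans
  (conv-cong {g = pow g (suc m)} (λ u → trans (cong (λ k → pow f k u) (ℕₚ.+-comm 1 m)) (trans (pow-+ f m 1 u) (conv-cong {pow f m} (λ _ → refl) (conv-unitʳ f) u))) (λ _ → refl) w)
  (trans (conv-cancel-middle {pow f m} {f} {g} {pow g m} e w) (pow-inverse e m w))

expC-0 : ∀ G w → expC G 0ℚ w ≡ unit w
expC-0 G w = trans (cong+ (ℚₚ.*-identityˡ (unit w)) (ℚₚ.*-zeroˡ (evalP (length w) (λ i → divPow G (suc i) w) 0ℚ))) (ℚₚ.+-identityʳ (unit w))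

ω-exp-ι : ∀ s j w → ω (expC (L s) (ι j)) w ≡ expC (L s) (-q 1ℚ *q ι j) w
ω-exp-ι s j w = begin
  ω (expC l (ι j)) w                       ≡⟨ cong (signQ (length w) *q_) (sym (BS.pow≡expC s j w)) ⟩
  ω (pow (V2 s) j) w                       ≡⟨ ω-pow (V2 s) j w ⟩
  U w                                      ≡⟨ sym (conv-unitʳ U w) ⟩
  conv U unit w                            ≡⟨ conv-cong {U} (λ _ → refl) (λ u → sym (trans (BS.expC-+ s (ι j) y u) (trans (cong (λ x → expC l x u) y-inv) (expC-0 l u)))) w ⟩
  conv U (conv (expC l (ι j)) (expC l y)) w ≡⟨ sym (conv-assoc U (expC l (ι j)) (expC l y) w) ⟩
  conv (conv U (expC l (ι j))) (expC l y) w ≡⟨ conv-cong {g = expC l y} (λ u → trans (conv-cong {U} (λ _ → refl) (λ v → sym (BS.pow≡expC s j v)) u) (pow-inverse (ωV2-inverse s) j u)) (λ _ → refl) w ⟩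
  conv unit (expC l y) w                   ≡⟨ conv-unitˡ (expC l y) w ⟩
  expC l y w ∎
  where
  open ≡-Reasoning
  l = L s
  U = pow (ω (V2 s)) j
  y = -q 1ℚ *q ι j
  y-inv : ι j +q y ≡ 0ℚ
  y-inv = solve 1 (λ x → x :+ :- con 1ℚ :* x := con 0ℚ) refl (ι j)
    where open QS

ω-divPow : ∀ s i w → ω (divPow (L s) i) w ≡ qpow (-q 1ℚ) i *q divPow (L s) i w
ω-divPow s i w with suc (length w) ℕₚ.≤? i
... | yes l = trans (x*0 (signQ (length w)) z) (sym (x*0 (qpow (-q 1ℚ) i) z))
  where z = divPow-low {L s} refl i w l
... | no ¬l = poly-unique d (λ i → signQ (length w) *q divPow (L s) i w) (λ i → qpow (-q 1ℚ) i *q divPow (L s) i w) ι ι-injective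
  (λ j → trans (evalP-* d (signQ (length w)) (λ i → divPow (L s) i w) (ι j))
    (trans (ω-exp-ι s j w) (sym (evalP-qpow d (-q 1ℚ) (λ i → divPow (L s) i w) (ι j))))) i (ℕₚ.≰⇒> ¬l)
  where d = suc (length w)

ω-exp : ∀ s x w → ω (expC (L s) x) w ≡ expC (L s) (-q 1ℚ *q x) w
ω-exp s x w = trans (sym (evalP-* d (signQ (length w)) (λ i → divPow (L s) i w) x))
  (trans (evalP-cong d x (λ i _ → ω-divPow s i w)) (evalP-qpow d (-q 1ℚ) (λ i → divPow (L s) i w) x))
  where d = suc (length w)

ω-Ic : ∀ s i w → ω (Ic s i) w ≡ qpow (-q 1ℚ) i *q Ic s i w
ω-Ic s i w = begin
  σ *q Ic s i w                       ≡⟨ cong (σ *q_) (divPow-scale ½ (L s) i w) ⟩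
  σ *q (h *q divPow (L s) i w)        ≡⟨ *q-left-comm σ h (divPow (L s) i w) ⟩
  h *q (σ *q divPow (L s) i w)        ≡⟨ cong (h *q_) (ω-divPow s i w) ⟩
  h *q (e *q divPow (L s) i w)        ≡⟨ *q-left-comm h e (divPow (L s) i w) ⟩
  e *q (h *q divPow (L s) i w)        ≡⟨ cong (e *q_) (sym (divPow-scale ½ (L s) i w)) ⟩
  e *q Ic s i w ∎
  where
  open ≡-Reasoning
  σ = signQ (length w)
  h = qpow ½ i
  e = qpow (-q 1ℚ) i

-- The sign change turns the exponent -½ into ½ = 1 - ½. The leading factor of the full copy of V_2
-- thus released cancels V_1(-t), and its second factor takes the place of V_1.
ω-J0 : ∀ s w → ω (J0 s) w ≡ J0 s w
ω-J0 s w = begin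
  ω (J0 s) w
    ≡⟨ trans (cong (signQ (length w) *q_) (J0-exp s w)) (ω-conv (χ s) (expC l -½) w) ⟩
  conv (ω (χ s)) (ω (expC l -½)) w
    ≡⟨ conv-cong {ω (χ s)} (λ _ → refl) (λ u → trans (ω-exp (not s) -½ u)
         (trans (sym (BS.expC-+ (not s) (ι 1) -½ u)) (conv-cong {g = expC l -½} (λ v → trans (sym (BS.pow≡expC (not s) 1 v)) (conv-unitʳ (V2 (not s)) v)) (λ _ → refl) u))) w ⟩
  conv (ω (χ s)) (conv (conv (χ (not s)) (χ (not (not s)))) (expC l -½)) w
    ≡⟨ conv-cong {ω (χ s)} (λ _ → refl) (conv-assoc (χ (not s)) (χ (not (not s))) (expC l -½)) w ⟩
  conv (ω (χ s)) (conv (χ (not s)) (conv (χ (not (not s))) (expC l -½))) w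
    ≡⟨ sym (conv-assoc (ω (χ s)) (χ (not s)) (conv (χ (not (not s))) (expC l -½)) w) ⟩
  conv (conv (ω (χ s)) (χ (not s))) (conv (χ (not (not s))) (expC l -½)) w
    ≡⟨ trans (conv-cong {g = conv (χ (not (not s))) (expC l -½)} (χ-inverse'' s) (λ _ → refl) w) (conv-unitˡ (conv (χ (not (not s))) (expC l -½)) w) ⟩
  conv (χ (not (not s))) (expC l -½) w
    ≡⟨ cong (λ t → conv (χ t) (expC l -½) w) (not-involutive s) ⟩
  conv (χ s) (expC l -½) w
    ≡⟨ sym (J0-exp s w) ⟩
  J0 s w ∎
  where
  open ≡-Reasoning
  l = L (not s)

ω-Jc : ∀ s i w → ω (Jc s i) w ≡ qpow (-q 1ℚ) i *q Jc s i w
ω-Jc s i w = trans (ω-conv (J0 s) (Ic (not s) i) w)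
  (trans (conv-cong (ω-J0 s) (ω-Ic (not s) i) w) (conv-*ʳ (qpow (-q 1ℚ) i) (J0 s) (Ic (not s) i) w))

signQ-even : ∀ n → signQ n ≡ (if even n then 1ℚ else -q 1ℚ)
signQ-even zero    = refl
signQ-even (suc n) rewrite signQ-even n with even n
... | true  = refl
... | false = refl

qpow-even : ∀ n → qpow (-q 1ℚ) n ≡ (if even n then 1ℚ else -q 1ℚ)
qpow-even zero    = refl
qpow-even (suc n) rewrite qpow-even n with even n
... | true  = refl
... | false = refl

opposite-signs : ∀ a b x → eqB a b ≡ false → (if b then 1ℚ else -q 1ℚ) *q x ≡ (if a then 1ℚ else -q 1ℚ) *q x → x ≡ 0ℚ
opposite-signs a b x ne e = trans (solve 1 (λ x → x := con ½ :* (con 1ℚ :* x :+ :- (:- con 1ℚ :* x))) refl x) (cong (½ *q_) (go a b ne e))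
  where
  open QS
  go : ∀ a b → eqB a b ≡ false → (if b then 1ℚ else -q 1ℚ) *q x ≡ (if a then 1ℚ else -q 1ℚ) *q x → 1ℚ *q x +q -q (-q 1ℚ *q x) ≡ 0ℚ
  go true  false _ e = trans (cong (_+q -q (-q 1ℚ *q x)) (sym e)) (ℚₚ.+-inverseʳ (-q 1ℚ *q x))
  go false true  _ e = trans (cong (_+q -q (-q 1ℚ *q x)) e) (ℚₚ.+-inverseʳ (-q 1ℚ *q x))

Ic-parity : ∀ s i w → sameParity i (length w) ≡ false → Ic s i w ≡ 0ℚ
Ic-parity s i w ne = opposite-signs (even i) (even (length w)) (Ic s i w) ne
  (trans (cong (_*q Ic s i w) (sym (signQ-even (length w)))) (trans (ω-Ic s i w) (cong (_*q Ic s i w) (qpow-even i))))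

Jc-parity : ∀ s i w → sameParity i (length w) ≡ false → Jc s i w ≡ 0ℚ
Jc-parity s i w ne = opposite-signs (even i) (even (length w)) (Jc s i w) ne
  (trans (cong (_*q Jc s i w) (sym (signQ-even (length w)))) (trans (ω-Jc s i w) (cong (_*q Jc s i w) (qpow-even i))))

-- Components of highest degree

-- Of all cuts only the one before the first letter leaves g a word that is long enough.
conv-top : ∀ {f g : Fn} w → (∀ u → length u < length w → g u ≡ 0ℚ) → conv f g w ≡ f [] *q g w
conv-top []      h = refl
conv-top {f} {g} (a ∷ w) h = trans (cong (f [] *q g (a ∷ w) +q_)
  (trans (conv-cong-≤ {f ∘ (a ∷_)} {f ∘ (a ∷_)} {g} {λ _ → 0ℚ} w (λ _ _ → refl) (λ u l → h u (s≤s l))) (conv-0ʳ {f ∘ (a ∷_)} w (λ _ → refl))))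
  (ℚₚ.+-identityʳ _)

pow-top : ∀ {f : Fn} → f [] ≡ 0ℚ → (∀ a → f (a ∷ []) ≡ 1ℚ) → ∀ w → pow f (length w) w ≡ 1ℚ
pow-top f0 f1 []      = refl
pow-top {f} f0 f1 (a ∷ w) = trans (cong+ (0*x (pow f (length w) (a ∷ w)) f0)
  (trans (conv-top {f ∘ (a ∷_)} w (pow-low f0 (length w))) (cong* (f1 a) (pow-top f0 f1 w)))) refl

-- On a single letter V_2 takes the value 2, so ½ log V_2 takes the value 1, and its top power is 1
-- on every word.
Ic-top : ∀ s w → Ic s (length w) w ≡ invFact (length w)
Ic-top s w = trans (cong (invFact (length w) *q_) (pow-top {λ u → ½ *q L s u} refl (λ _ → refl) w)) (ℚₚ.*-identityʳ _)

Jc-top : ∀ s w → Jc s (length w) w ≡ invFact (length w)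
Jc-top s w = trans (conv-top {J0 s} w (Ic-low (not s) (length w))) (trans (ℚₚ.*-identityˡ (Ic (not s) (length w) w)) (Ic-top (not s) w))

J0-two : ∀ a b → J0 true (a ∷ b ∷ []) +q J0 false (a ∷ b ∷ []) ≡ 0ℚ
J0-two a b with b <ᵇ a
... | true  = refl
... | false = refl

Jc-subtop : ∀ s a b w → Jc s (length w) (a ∷ b ∷ w) ≡ Ic (not s) (length w) (a ∷ b ∷ w) +q J0 s (a ∷ b ∷ []) *q invFact (length w)
Jc-subtop s a b w = trans
  (cong₂ (λ x y → 1ℚ *q x +q (0ℚ *q Ic (not s) m (b ∷ w) +q y)) {y = Ic (not s) m (a ∷ b ∷ w)} refl
    (trans (conv-top {J0 s ∘ (a ∷_) ∘ (b ∷_)} w (Ic-low (not s) m)) (cong (J0 s (a ∷ b ∷ []) *q_) (Ic-top (not s) w))))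
  (solve 3 (λ x y z → con 1ℚ :* x :+ (con 0ℚ :* z :+ y) := x :+ y) refl (Ic (not s) m (a ∷ b ∷ w)) (J0 s (a ∷ b ∷ []) *q invFact m) (Ic (not s) m (b ∷ w)))
  where
  open QS
  m = length w

-- J_0 has no component of degree 1, and its components of degree 2 for the two signs are opposite.
-- Consequently the second family contributes nothing at index n - 2 and ends at n - 4.
J+J≡I+I-subtop : ∀ a b w → Jc true (length w) (a ∷ b ∷ w) +q Jc false (length w) (a ∷ b ∷ w) ≡ Ic true (length w) (a ∷ b ∷ w) +q Ic false (length w) (a ∷ b ∷ w)
J+J≡I+I-subtop a b w = trans (cong+ (Jc-subtop true a b w) (Jc-subtop false a b w))
  (trans (solve 5 (λ x y j k f → (x :+ j :* f) :+ (y :+ k :* f) := (y :+ x) :+ (j :+ k) :* f) refl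
      (Ic false (length w) (a ∷ b ∷ w)) (Ic true (length w) (a ∷ b ∷ w)) (J0 true (a ∷ b ∷ [])) (J0 false (a ∷ b ∷ [])) (invFact (length w)))
    (trans (cong (Ic true (length w) (a ∷ b ∷ w) +q Ic false (length w) (a ∷ b ∷ w) +q_) (0*x (invFact (length w)) (J0-two a b))) (ℚₚ.+-identityʳ _)))
  where open QS

-- Ribbons as descent words

ind-∧ : ∀ a b → ind (a ∧ b) ≡ ind a *q ind b
ind-∧ true  b = sym (ℚₚ.*-identityˡ (ind b))
ind-∧ false b = sym (ℚₚ.*-zeroˡ (ind b))

eqBW : List Bool → List Bool → Bool
eqBW []       []       = true
eqBW (a ∷ as) (b ∷ bs) = eqB a b ∧ eqBW as bs
eqBW _        _        = false

pos : ℕ → List Bool → List ℕ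
pos k []          = []
pos k (true ∷ b)  = k ∷ pos (suc k) b
pos k (false ∷ b) = pos (suc k) b

dw : List ℕ → List Bool
dw (a ∷ b ∷ l) = (b <ᵇ a) ∷ dw (b ∷ l)
dw _           = []

-- The descent set as a word of length n - 1. In this form the two summands of a ribbon product
-- differ only in the letter at the seam.
toW : Comp → List Bool
toW []          = []
toW (i ∷ [])    = replicate (pred i) false
toW (i ∷ j ∷ I) = replicate (pred i) false ++ true ∷ toW (j ∷ I)

data IsComp : ℕ → Comp → Set where
  []  : IsComp 0 []
  add : ∀ i {d I} → IsComp d I → IsComp (suc i + d) (suc i ∷ I)

desAux-pos : ∀ k w → desAux k w ≡ pos k (dw w)
desAux-pos k []          = refl
desAux-pos k (a ∷ [])    = refl
desAux-pos k (a ∷ b ∷ l) with b <ᵇ a | desAux-pos (suc k) (b ∷ l)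
... | true  | e = cong (k ∷_) e
... | false | e = e

pos-falses : ∀ k m b → pos k (replicate m false ++ b) ≡ pos (k + m) b
pos-falses k zero    b = cong (λ x → pos x b) (sym (ℕₚ.+-identityʳ k))
pos-falses k (suc m) b = trans (pos-falses (suc k) m b) (cong (λ x → pos x b) (sym (ℕₚ.+-suc k m)))

psums-pos : ∀ acc {d I} → IsComp d I → psums acc I ≡ pos (suc acc) (toW I)
psums-pos acc []                            = refl
psums-pos acc (add i [])                    = sym (trans (cong (pos (suc acc)) (sym (Lₚ.++-identityʳ (replicate i false)))) (pos-falses (suc acc) i []))
psums-pos acc (add i {I = j ∷ J} c@(add _ _)) = trans
  (cong₂ _∷_ (ℕₚ.+-suc acc i) (trans (psums-pos (acc + suc i) c) (cong (λ x → pos (suc x) (toW (j ∷ J))) (ℕₚ.+-suc acc i))))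
  (sym (pos-falses (suc acc) i (true ∷ toW (j ∷ J))))

≡ᵇ-refl : ∀ k → (k ≡ᵇ k) ≡ true
≡ᵇ-refl zero    = refl
≡ᵇ-refl (suc k) = ≡ᵇ-refl k

≡ᵇ-< : ∀ k m → k < m → (k ≡ᵇ m) ≡ false
≡ᵇ-< zero    (suc m) l       = refl
≡ᵇ-< (suc k) (suc m) (s≤s l) = ≡ᵇ-< k m l

≡ᵇ-sym : ∀ k m → (k ≡ᵇ m) ≡ (m ≡ᵇ k)
≡ᵇ-sym zero    zero    = refl
≡ᵇ-sym zero    (suc m) = refl
≡ᵇ-sym (suc k) zero    = refl
≡ᵇ-sym (suc k) (suc m) = ≡ᵇ-sym k m

eqL-pos-< : ∀ k m xs b → k < m → eqL (k ∷ xs) (pos m b) ≡ false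
eqL-pos-< k m xs []          l = refl
eqL-pos-< k m xs (true ∷ b)  l rewrite ≡ᵇ-< k m l = refl
eqL-pos-< k m xs (false ∷ b) l = eqL-pos-< k (suc m) xs b (ℕₚ.m≤n⇒m≤1+n l)

eqL-pos-<' : ∀ k m xs b → k < m → eqL (pos m b) (k ∷ xs) ≡ false
eqL-pos-<' k m xs []          l = refl
eqL-pos-<' k m xs (true ∷ b)  l rewrite ≡ᵇ-sym m k | ≡ᵇ-< k m l = refl
eqL-pos-<' k m xs (false ∷ b) l = eqL-pos-<' k (suc m) xs b (ℕₚ.m≤n⇒m≤1+n l)

eqL-pos : ∀ k b b' → length b ≡ length b' → eqL (pos k b) (pos k b') ≡ eqBW b b'
eqL-pos k []          []           e = refl
eqL-pos k (true ∷ b)  (true ∷ b')  e rewrite ≡ᵇ-refl k = eqL-pos (suc k) b b' (ℕₚ.suc-injective e)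
eqL-pos k (true ∷ b)  (false ∷ b') e = eqL-pos-< k (suc k) (pos (suc k) b) b' ℕₚ.≤-refl
eqL-pos k (false ∷ b) (true ∷ b')  e = eqL-pos-<' k (suc k) (pos (suc k) b') b ℕₚ.≤-refl
eqL-pos k (false ∷ b) (false ∷ b') e = eqL-pos (suc k) b b' (ℕₚ.suc-injective e)

length-dw : ∀ w → length (dw w) ≡ pred (length w)
length-dw []          = refl
length-dw (a ∷ [])    = refl
length-dw (a ∷ b ∷ l) = cong suc (length-dw (b ∷ l))

length-toW : ∀ {d I} → IsComp d I → length (toW I) ≡ pred d
length-toW []         = refl
length-toW (add i []) = trans (Lₚ.length-replicate i) (sym (ℕₚ.+-identityʳ i))
length-toW (add i {I = j ∷ J} c@(add j' {d} _)) = trans (Lₚ.length-++ (replicate i false))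
  (cong₂ (λ x y → x + suc y) (Lₚ.length-replicate i) (length-toW c))

isRib : Comp → List ℕ → Bool
isRib I w = eqL (Des w) (descComp I)

isRib-word : ∀ {I} w → IsComp (length w) I → isRib I w ≡ eqBW (dw w) (toW I)
isRib-word {I} w c = trans (cong₂ eqL (desAux-pos 1 w) (psums-pos 0 c)) (eqL-pos 1 (dw w) (toW I) (trans (length-dw w) (sym (length-toW c))))

eqBW-++ : ∀ x x' c c' y y' → length x ≡ length x' → eqBW (x ++ c ∷ y) (x' ++ c' ∷ y') ≡ (eqBW x x' ∧ (eqB c c' ∧ eqBW y y'))
eqBW-++ []      []        c c' y y' e = refl
eqBW-++ (a ∷ x) (a' ∷ x') c c' y y' e rewrite eqBW-++ x x' c c' y y' (ℕₚ.suc-injective e) with eqB a a'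
... | true  = refl
... | false = refl

dw-++ : ∀ a u b v → Σ Bool λ c → dw ((a ∷ u) ++ b ∷ v) ≡ dw (a ∷ u) ++ c ∷ dw (b ∷ v)
dw-++ a []       b v = (b <ᵇ a) , refl
dw-++ a (a' ∷ u) b v with dw-++ a' u b v
... | c , e = c , cong ((a' <ᵇ a) ∷_) e

toW-++ : ∀ i I j J → toW ((i ∷ I) ++ j ∷ J) ≡ toW (i ∷ I) ++ true ∷ toW (j ∷ J)
toW-++ i []       j J = refl
toW-++ i (i' ∷ I) j J = trans (cong (λ x → replicate (pred i) false ++ true ∷ x) (toW-++ i' I j J))
  (sym (Lₚ.++-assoc (replicate (pred i) false) (true ∷ toW (i' ∷ I)) (true ∷ toW (j ∷ J))))

falses-++ : ∀ i j x → replicate (i + suc j) false ++ x ≡ replicate i false ++ false ∷ replicate j false ++ x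
falses-++ zero    j x = refl
falses-++ (suc i) j x = cong (false ∷_) (falses-++ i j x)

toW-cons-glue : ∀ i i' I j J → toW (i ∷ glue i' I j J) ≡ replicate (pred i) false ++ true ∷ toW (glue i' I j J)
toW-cons-glue i i' []      j J = refl
toW-cons-glue i i' (_ ∷ I) j J = refl

toW-glue : ∀ i {d I} → IsComp d I → ∀ j J → toW (glue (suc i) I (suc j) J) ≡ toW (suc i ∷ I) ++ false ∷ toW (suc j ∷ J)
toW-glue i [] j [] = trans (sym (Lₚ.++-identityʳ (replicate (i + suc j) false)))
  (trans (falses-++ i j []) (cong (λ x → replicate i false ++ false ∷ x) (Lₚ.++-identityʳ (replicate j false))))
toW-glue i [] j (j' ∷ J) = falses-++ i j (true ∷ toW (j' ∷ J))
toW-glue i (add i' {I = I} c) j J = trans (toW-cons-glue (suc i) (suc i') I (suc j) J)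
  (trans (cong (λ x → replicate i false ++ true ∷ x) (toW-glue i' c j J))
    (sym (Lₚ.++-assoc (replicate i false) (true ∷ toW (suc i' ∷ I)) (false ∷ toW (suc j ∷ J)))))

IsComp-++ : ∀ {d e I J} → IsComp d I → IsComp e J → IsComp (d + e) (I ++ J)
IsComp-++ [] c = c
IsComp-++ {e = e} {J = J} (add i {d} {I} b) c = subst (λ x → IsComp x (suc i ∷ I ++ J)) (sym (ℕₚ.+-assoc (suc i) d e)) (add i (IsComp-++ b c))

IsComp-glue : ∀ i {d I} → IsComp d I → ∀ j {e J} → IsComp e J → IsComp ((suc i + d) + (suc j + e)) (glue (suc i) I (suc j) J)
IsComp-glue i [] j {e} {J} c = subst (λ x → IsComp x (suc (i + suc j) ∷ J)) eq (add (i + suc j) c)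
  where
  open NS
  eq : suc (i + suc j) + e ≡ (suc i + 0) + (suc j + e)
  eq = solve 3 (λ i j e → con 1 :+ (i :+ (con 1 :+ j)) :+ e := (con 1 :+ i :+ con 0) :+ (con 1 :+ j :+ e)) refl i j e
IsComp-glue i (add i' {d} {I} b) j {e} {J} c = subst (λ x → IsComp x (glue (suc i) (suc i' ∷ I) (suc j) J))
  (sym (ℕₚ.+-assoc (suc i) (suc i' + d) (suc j + e))) (add i (IsComp-glue i' b j c))

ribbonMul-comp : ∀ {d e I J} → IsComp d I → IsComp e J → All (IsComp (d + e)) (ribbonMul I J)
ribbonMul-comp [] c = c ∷ []
ribbonMul-comp b@(add i {d} {I} _) [] = subst (λ x → IsComp x (suc i ∷ I)) (sym (ℕₚ.+-identityʳ (suc i + d))) b ∷ []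
ribbonMul-comp b@(add i b') c@(add j c') = IsComp-++ b c ∷ IsComp-glue i b' j c' ∷ []

ribbonMul-[] : ∀ I → ribbonMul I [] ≡ I ∷ []
ribbonMul-[] []      = refl
ribbonMul-[] (i ∷ I) = refl

ribInd : Comp → Fn
ribInd I w = ind (isRib I w)

-- The step at the seam of u and v is a descent or not, so exactly one of the two summands can fit
-- it. This makes convolution the image of the external product.
ribInd-mul : ∀ {I J} u v → IsComp (length u) I → IsComp (length v) J → ∑ (ribbonMul I J) (λ K → ribInd K (u ++ v)) ≡ ribInd I u *q ribInd J v
ribInd-mul {J = J} [] v [] c = trans (ℚₚ.+-identityʳ (ribInd J v)) (sym (ℚₚ.*-identityˡ (ribInd J v)))
ribInd-mul {I} (a ∷ u) [] b [] rewrite Lₚ.++-identityʳ u | ribbonMul-[] I = trans (ℚₚ.+-identityʳ (ribInd I (a ∷ u))) (sym (ℚₚ.*-identityʳ (ribInd I (a ∷ u))))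
ribInd-mul (a ∷ u) (a' ∷ v) b c = go b c refl refl
  where
  w = (a ∷ u) ++ a' ∷ v
  go : ∀ {d e I J} → IsComp d I → IsComp e J → length (a ∷ u) ≡ d → length (a' ∷ v) ≡ e →
    ∑ (ribbonMul I J) (λ K → ribInd K w) ≡ ribInd I (a ∷ u) *q ribInd J (a' ∷ v)
  go b@(add i {d'} {I} b') c@(add j {e'} {J} c') p q = begin
    ribInd ((suc i ∷ I) ++ suc j ∷ J) w +q (ribInd (glue (suc i) I (suc j) J) w +q 0ℚ)
      ≡⟨ cong₂ (λ x y → x +q (y +q 0ℚ)) (rib-eq true (toW-++ (suc i) I (suc j) J) (IsComp-++ b c)) (rib-eq false (toW-glue i b' j J) (IsComp-glue i b' j c')) ⟩
    X *q (ind (eqB k true) *q Y) +q (X *q (ind (eqB k false) *q Y) +q 0ℚ)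
      ≡⟨ solve 4 (λ x t f y → x :* (t :* y) :+ (x :* (f :* y) :+ con 0ℚ) := (t :+ f) :* (x :* y)) refl X (ind (eqB k true)) (ind (eqB k false)) Y ⟩
    (ind (eqB k true) +q ind (eqB k false)) *q (X *q Y)
      ≡⟨ trans (cong (_*q (X *q Y)) (dir k)) (ℚₚ.*-identityˡ (X *q Y)) ⟩
    X *q Y
      ≡⟨ cong₂ (λ x y → ind x *q ind y) (sym (isRib-word (a ∷ u) (subst (λ x → IsComp x (suc i ∷ I)) (sym p) b)))
            (sym (isRib-word (a' ∷ v) (subst (λ x → IsComp x (suc j ∷ J)) (sym q) c))) ⟩
    ribInd (suc i ∷ I) (a ∷ u) *q ribInd (suc j ∷ J) (a' ∷ v) ∎
    where
    open QS
    open ≡-Reasoning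
    k = proj₁ (dw-++ a u a' v)
    X = ind (eqBW (dw (a ∷ u)) (toW (suc i ∷ I)))
    Y = ind (eqBW (dw (a' ∷ v)) (toW (suc j ∷ J)))
    dir : ∀ k → ind (eqB k true) +q ind (eqB k false) ≡ 1ℚ
    dir true  = refl
    dir false = refl
    rib-eq : ∀ c {K} → toW K ≡ toW (suc i ∷ I) ++ c ∷ toW (suc j ∷ J) → IsComp ((suc i + d') + (suc j + e')) K → ribInd K w ≡ X *q (ind (eqB k c) *q Y)
    rib-eq c {K} eq h = begin
      ind (isRib K w)
        ≡⟨ cong ind (isRib-word w (subst (λ x → IsComp x K) (sym (trans (Lₚ.length-++ (a ∷ u)) (cong₂ _+_ p q))) h)) ⟩
      ind (eqBW (dw w) (toW K))
        ≡⟨ cong₂ (λ x y → ind (eqBW x y)) (proj₂ (dw-++ a u a' v)) eq ⟩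
      ind (eqBW (dw (a ∷ u) ++ k ∷ dw (a' ∷ v)) (toW (suc i ∷ I) ++ c ∷ toW (suc j ∷ J)))
        ≡⟨ cong ind (eqBW-++ (dw (a ∷ u)) (toW (suc i ∷ I)) k c _ _ (trans (length-dw (a ∷ u)) (trans (cong pred p) (sym (length-toW b))))) ⟩
      ind (eqBW (dw (a ∷ u)) (toW (suc i ∷ I)) ∧ (eqB k c ∧ eqBW (dw (a' ∷ v)) (toW (suc j ∷ J))))
        ≡⟨ trans (ind-∧ (eqBW (dw (a ∷ u)) (toW (suc i ∷ I))) _) (cong (X *q_) (ind-∧ (eqB k c) _)) ⟩
      X *q (ind (eqB k c) *q Y) ∎

-- Series as functions on words

evLC : LC → Fn
evLC lc w = ∑ lc (λ x → proj₁ x *q ribInd (proj₂ x) w)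

hat : Ser → Fn
hat F w = evLC (F (length w)) w

-- Ties the sizes of the stored compositions to the degree, since `ribInd-mul` speaks only of words
-- whose length is the size of the composition.
Homogeneous : Ser → Set
Homogeneous F = ∀ d → All (λ x → IsComp d (proj₂ x)) (F d)

∑-congAll : ∀ {A : Set} {P : A → Set} {xs} {f g : A → ℚ} → All P xs → (∀ x → P x → f x ≡ g x) → ∑ xs f ≡ ∑ xs g
∑-congAll []       h = refl
∑-congAll (p ∷ ps) h = cong+ (h _ p) (∑-congAll ps h)

All-concatMap : ∀ {A B : Set} {P : B → Set} {g : A → List B} {xs} → All (λ x → All P (g x)) xs → All P (concatMap g xs)
All-concatMap ps = Allₚ.concat⁺ (Allₚ.map⁺ ps)

∑-concatMap-upTo : ∀ {B : Set} (g : ℕ → List B) n (f : B → ℚ) → ∑ (concatMap g (upTo n)) f ≡ ∑< n (λ i → ∑ (g i) f)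
∑-concatMap-upTo g n f = trans (∑-concatMap g (upTo n) f) (∑-upTo n (λ i → ∑ (g i) f))

evLC-scale : ∀ c lc w → evLC (scaleLC c lc) w ≡ c *q evLC lc w
evLC-scale c lc w = trans (∑-map _ lc _) (trans (∑-cong lc (λ x → ℚₚ.*-assoc c (proj₁ x) (ribInd (proj₂ x) w))) (∑-*ˡ lc c _))

hat-one : ∀ w → hat oneS w ≡ unit w
hat-one []      = refl
hat-one (a ∷ w) = refl

hat-add : ∀ F G w → hat (addS F G) w ≡ hat F w +q hat G w
hat-add F G w = ∑-++ (F (length w)) (G (length w)) _

hat-scale : ∀ c F w → hat (scaleS c F) w ≡ c *q hat F w
hat-scale c F w = evLC-scale c (F (length w)) w

evLC-mul : ∀ {xs ys} u v → All (λ x → IsComp (length u) (proj₂ x)) xs → All (λ x → IsComp (length v) (proj₂ x)) ys →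
  evLC (lcMul xs ys) (u ++ v) ≡ evLC xs u *q evLC ys v
evLC-mul {xs} {ys} u v ps qs = begin
  evLC (lcMul xs ys) (u ++ v)
    ≡⟨ ∑-concatMap _ xs _ ⟩
  ∑ xs (λ x → ∑ (concatMap (λ y → map (λ K → (proj₁ x *q proj₁ y , K)) (ribbonMul (proj₂ x) (proj₂ y))) ys) ev)
    ≡⟨ ∑-congAll ps (λ x p → trans (∑-concatMap _ ys ev) (∑-congAll qs (λ y q → trans (∑-map _ (ribbonMul (proj₂ x) (proj₂ y)) ev)
         (trans (∑-*ˡ (ribbonMul (proj₂ x) (proj₂ y)) (proj₁ x *q proj₁ y) _) (trans (cong ((proj₁ x *q proj₁ y) *q_) (ribInd-mul u v p q))
           (*q-medial (proj₁ x) (proj₁ y) _ _)))))) ⟩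
  ∑ xs (λ x → ∑ ys (λ y → (proj₁ x *q ribInd (proj₂ x) u) *q (proj₁ y *q ribInd (proj₂ y) v)))
    ≡⟨ ∑-cong xs (λ x → ∑-*ˡ ys (proj₁ x *q ribInd (proj₂ x) u) _) ⟩
  ∑ xs (λ x → (proj₁ x *q ribInd (proj₂ x) u) *q evLC ys v)
    ≡⟨ ∑-*ʳ xs (evLC ys v) _ ⟩
  evLC xs u *q evLC ys v ∎
  where
  open ≡-Reasoning
  ev : ℚ × Comp → ℚ
  ev x = proj₁ x *q ribInd (proj₂ x) (u ++ v)

hat-mul : ∀ {F G} → Homogeneous F → Homogeneous G → ∀ w → hat (mulS F G) w ≡ conv (hat F) (hat G) w
hat-mul {F} {G} hF hG w = trans (∑-concatMap-upTo (λ i → lcMul (F i) (G (d ∸ i))) (suc d) ev)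
  (trans (∑<-cong (suc d) term) (sym (conv-split (hat F) (hat G) w)))
  where
  d = length w
  ev : ℚ × Comp → ℚ
  ev x = proj₁ x *q ribInd (proj₂ x) w
  term : ∀ i → i < suc d → ∑ (lcMul (F i) (G (d ∸ i))) ev ≡ hat F (take i w) *q hat G (drop i w)
  term i l = trans (cong₂ (λ x y → evLC (lcMul x y) w) (cong F (sym lu)) (cong G (sym lv)))
    (trans (cong (evLC (lcMul (F (length u)) (G (length v)))) (sym (Lₚ.take++drop≡id i w))) (evLC-mul u v (hF (length u)) (hG (length v))))
    where
    u = take i w
    v = drop i w
    lu : length u ≡ i
    lu = trans (Lₚ.length-take i w) (ℕₚ.m≤n⇒m⊓n≡m (ℕₚ.≤-pred l))
    lv : length v ≡ d ∸ i
    lv = Lₚ.length-drop i w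

one-homogeneous : Homogeneous oneS
one-homogeneous zero    = [] ∷ []
one-homogeneous (suc d) = []

add-homogeneous : ∀ {F G} → Homogeneous F → Homogeneous G → Homogeneous (addS F G)
add-homogeneous hF hG d = Allₚ.++⁺ (hF d) (hG d)

scaleLC-comp : ∀ {d} c {lc} → All (λ x → IsComp d (proj₂ x)) lc → All (λ x → IsComp d (proj₂ x)) (scaleLC c lc)
scaleLC-comp c ps = Allₚ.map⁺ ps

scale-homogeneous : ∀ c {F} → Homogeneous F → Homogeneous (scaleS c F)
scale-homogeneous c hF d = scaleLC-comp c (hF d)

mul-homogeneous : ∀ {F G} → Homogeneous F → Homogeneous G → Homogeneous (mulS F G)
mul-homogeneous {F} {G} hF hG d = All-concatMap (Allₚ.applyUpTo⁺₁ (λ i → i) (suc d) λ {i} i<d →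
  All-concatMap (All.map (λ {x} p → All-concatMap (All.map (λ {y} q → Allₚ.map⁺
    (subst (λ k → All (IsComp k) (ribbonMul (proj₂ x) (proj₂ y))) (ℕₚ.m+[n∸m]≡n (ℕₚ.≤-pred i<d)) (ribbonMul-comp p q))) (hG (d ∸ i)))) (hF i)))

pow-homogeneous : ∀ {F} → Homogeneous F → ∀ m → Homogeneous (powS F m)
pow-homogeneous hF zero    = one-homogeneous
pow-homogeneous hF (suc m) = mul-homogeneous hF (pow-homogeneous hF m)

log-homogeneous : ∀ {V} → Homogeneous V → Homogeneous (logS V)
log-homogeneous hV d = All-concatMap (Allₚ.applyUpTo⁺₂ (λ i → i) d (λ k →
  scaleLC-comp (signQ k *q (+ 1 / suc k)) (pow-homogeneous (add-homogeneous hV (scale-homogeneous (-q 1ℚ) one-homogeneous)) (suc k) d)))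

exp-homogeneous : ∀ {V} → Homogeneous V → Homogeneous (expS V)
exp-homogeneous hV d = All-concatMap (Allₚ.applyUpTo⁺₂ (λ i → i) (suc d) (λ k → scaleLC-comp (invFact k) (pow-homogeneous hV k d)))

hat-pow : ∀ {F} → Homogeneous F → ∀ m w → hat (powS F m) w ≡ pow (hat F) m w
hat-pow hF zero    w = hat-one w
hat-pow {F} hF (suc m) w = trans (hat-mul hF (pow-homogeneous hF m) w) (conv-cong {hat F} (λ _ → refl) (hat-pow hF m) w)

hat-log : ∀ {V} → Homogeneous V → ∀ w → hat (logS V) w ≡ logC (hat V) w
hat-log {V} hV w = trans (∑-concatMap-upTo (λ k → scaleLC (signQ k *q (+ 1 / suc k)) (powS (subS V oneS) (suc k) d)) d (λ x → proj₁ x *q ribInd (proj₂ x) w)) (∑<-cong d (λ k _ →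
  trans (evLC-scale (signQ k *q (+ 1 / suc k)) (powS (subS V oneS) (suc k) d) w) (cong ((signQ k *q (+ 1 / suc k)) *q_)
    (trans (hat-pow (add-homogeneous hV (scale-homogeneous (-q 1ℚ) one-homogeneous)) (suc k) w)
      (pow-cong (λ u → trans (hat-add V (scaleS (-q 1ℚ) oneS) u) (cong (hat V u +q_) (trans (hat-scale (-q 1ℚ) oneS u) (cong (-q 1ℚ *q_) (hat-one u))))) (suc k) w)))))
  where d = length w

hat-exp : ∀ {G} → Homogeneous G → ∀ w → hat (expS G) w ≡ expC (hat G) 1ℚ w
hat-exp {G} hG w = trans (∑-concatMap-upTo (λ k → scaleLC (invFact k) (powS G k d)) (suc d) (λ x → proj₁ x *q ribInd (proj₂ x) w)) (trans (∑<-cong (suc d) (λ k _ →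
  trans (evLC-scale (invFact k) (powS G k d) w) (cong (invFact k *q_) (hat-pow hG k w)))) (sym (evalP-at-1 (suc d) (λ i → divPow (hat G) i w))))
  where d = length w

logC-cong : ∀ {f g : Fn} → (∀ u → f u ≡ g u) → ∀ w → logC f w ≡ logC g w
logC-cong h w = ∑<-cong (length w) (λ k _ → cong ((signQ k *q (+ 1 / suc k)) *q_) (pow-cong (λ u → cong (_+q -q 1ℚ *q unit u) (h u)) (suc k) w))

expC-cong : ∀ {f g : Fn} x → (∀ u → f u ≡ g u) → ∀ w → expC f x w ≡ expC g x w
expC-cong x h w = evalP-cong (suc (length w)) x (λ i _ → cong (invFact i *q_) (pow-cong h i w))

comp-ones : ∀ d → IsComp d (replicate d 1)
comp-ones zero    = []
comp-ones (suc d) = add 0 (comp-ones d)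

toW-ones : ∀ d → toW (replicate (suc d) 1) ≡ replicate d true
toW-ones zero    = refl
toW-ones (suc d) = cong (true ∷_) (toW-ones d)

V1s : Bool → Ser
V1s true  = V1p
V1s false = V1m

V1-homogeneous : ∀ s → Homogeneous (V1s s)
V1-homogeneous true  zero    = [] ∷ []
V1-homogeneous true  (suc d) = subst (λ x → IsComp x (suc d ∷ [])) (ℕₚ.+-identityʳ (suc d)) (add d []) ∷ []
V1-homogeneous false d       = comp-ones d ∷ []

χ-asc : ∀ k w → ind (eqL (desAux k w) []) ≡ χ true w
χ-asc k []          = refl
χ-asc k (a ∷ [])    = refl
χ-asc k (a ∷ b ∷ w) with b <ᵇ a | χ-asc (suc k) (b ∷ w)
... | true  | _ = sym (ℚₚ.*-zeroˡ (χ true (b ∷ w)))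
... | false | e = trans e (sym (ℚₚ.*-identityˡ (χ true (b ∷ w))))

χ-desc : ∀ a w → ind (eqBW (dw (a ∷ w)) (replicate (length w) true)) ≡ χ false (a ∷ w)
χ-desc a []      = refl
χ-desc a (b ∷ w) with b <ᵇ a | χ-desc b w
... | true  | e = trans e (sym (ℚₚ.*-identityˡ (χ false (b ∷ w))))
... | false | _ = sym (ℚₚ.*-zeroˡ (χ false (b ∷ w)))

hat-V1 : ∀ s w → hat (V1s s) w ≡ χ s w
hat-V1 true []       = refl
hat-V1 true (a ∷ w)  = trans (ℚₚ.+-identityʳ _) (trans (ℚₚ.*-identityˡ _) (χ-asc 1 (a ∷ w)))
hat-V1 false []      = refl
hat-V1 false (a ∷ w) = trans (ℚₚ.+-identityʳ _) (trans (ℚₚ.*-identityˡ _)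
  (trans (cong ind (trans (isRib-word (a ∷ w) (comp-ones (suc (length w)))) (cong (eqBW (dw (a ∷ w))) (toW-ones (length w))))) (χ-desc a w)))

-- Indexed by the sign so that both signs are treated at once; at `true` and `false` these reduce to
-- the given series such as `V2p` and `J0m`.
V2s I1s J0s : Bool → Ser
V2s s = mulS (V1s s) (V1s (not s))
I1s s = scaleS ½ (logS (V2s s))
J0s s = mulS (V1s s) (rpowS -½ (V2s (not s)))

Iks Jks : Bool → ℕ → Ser
Iks s k = scaleS (invFact k) (powS (I1s s) k)
Jks s k = mulS (J0s s) (Iks (not s) k)

V2-homogeneous : ∀ s → Homogeneous (V2s s)
V2-homogeneous s = mul-homogeneous (V1-homogeneous s) (V1-homogeneous (not s))

hat-V2 : ∀ s w → hat (V2s s) w ≡ V2 s w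
hat-V2 s w = trans (hat-mul (V1-homogeneous s) (V1-homogeneous (not s)) w) (conv-cong (hat-V1 s) (hat-V1 (not s)) w)

hat-logV2 : ∀ s w → hat (logS (V2s s)) w ≡ L s w
hat-logV2 s w = trans (hat-log (V2-homogeneous s) w) (logC-cong (hat-V2 s) w)

hat-Ik : ∀ s k w → hat (Iks s k) w ≡ Ic s k w
hat-Ik s k w = trans (hat-scale (invFact k) (powS (I1s s) k) w) (cong (invFact k *q_)
  (trans (hat-pow (scale-homogeneous ½ (log-homogeneous (V2-homogeneous s))) k w)
    (pow-cong (λ u → trans (hat-scale ½ (logS (V2s s)) u) (cong (½ *q_) (hat-logV2 s u))) k w)))

rpow-homogeneous : ∀ c s → Homogeneous (rpowS c (V2s s))
rpow-homogeneous c s = exp-homogeneous (scale-homogeneous c (log-homogeneous (V2-homogeneous s)))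

hat-Jk : ∀ s k w → hat (Jks s k) w ≡ Jc s k w
hat-Jk s k w = trans (hat-mul (mul-homogeneous (V1-homogeneous s) (rpow-homogeneous -½ (not s)))
    (scale-homogeneous (invFact k) (pow-homogeneous (scale-homogeneous ½ (log-homogeneous (V2-homogeneous (not s)))) k)) w)
  (conv-cong (λ u → trans (hat-mul (V1-homogeneous s) (rpow-homogeneous -½ (not s)) u)
     (conv-cong (hat-V1 s) (λ v → trans (hat-exp (scale-homogeneous -½ (log-homogeneous (V2-homogeneous (not s)))) v)
       (expC-cong 1ℚ (λ x → trans (hat-scale -½ (logS (V2s (not s))) x) (cong (-½ *q_) (hat-logV2 (not s) x))) v)) u))
    (hat-Ik (not s) k) w)

-- Shuffles: N ε is multiplicative on words with disjoint sets of letters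

-- φ evaluated on the shuffle product of the two words; the prefix already chosen is absorbed into
-- φ.
sh : Fn → List ℕ → List ℕ → ℚ
sh φ []      v       = φ v
sh φ (a ∷ u) []      = φ (a ∷ u)
sh φ (a ∷ u) (b ∷ v) = sh (φ ∘ (a ∷_)) u (b ∷ v) +q sh (φ ∘ (b ∷_)) (a ∷ u) v

sh-[] : ∀ φ u → sh φ u [] ≡ φ u
sh-[] φ []      = refl
sh-[] φ (a ∷ u) = refl

sh-+ : ∀ (φ ψ : Fn) u v → sh (λ w → φ w +q ψ w) u v ≡ sh φ u v +q sh ψ u v
sh-+ φ ψ []      v       = refl
sh-+ φ ψ (a ∷ u) []      = refl
sh-+ φ ψ (a ∷ u) (b ∷ v) = trans (cong+ (sh-+ (φ ∘ (a ∷_)) (ψ ∘ (a ∷_)) u (b ∷ v)) (sh-+ (φ ∘ (b ∷_)) (ψ ∘ (b ∷_)) (a ∷ u) v))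
  (+q-medial (sh (φ ∘ (a ∷_)) u (b ∷ v)) (sh (ψ ∘ (a ∷_)) u (b ∷ v)) (sh (φ ∘ (b ∷_)) (a ∷ u) v) (sh (ψ ∘ (b ∷_)) (a ∷ u) v))

sh-* : ∀ c (φ : Fn) u v → sh (λ w → c *q φ w) u v ≡ c *q sh φ u v
sh-* c φ []      v       = refl
sh-* c φ (a ∷ u) []      = refl
sh-* c φ (a ∷ u) (b ∷ v) = trans (cong+ (sh-* c (φ ∘ (a ∷_)) u (b ∷ v)) (sh-* c (φ ∘ (b ∷_)) (a ∷ u) v)) (sym (ℚₚ.*-distribˡ-+ c _ _))

Fn₂ : Set
Fn₂ = List ℕ → Fn

-- Convolution on pairs of words, both being cut independently.
conv₂ : Fn₂ → Fn₂ → Fn₂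
conv₂ F G []      v = conv (F []) (G []) v
conv₂ F G (a ∷ u) v = conv (F []) (G (a ∷ u)) v +q conv₂ (F ∘ (a ∷_)) G u v

conv₂-[] : ∀ F G u → conv₂ F G u [] ≡ conv (λ x → F x []) (λ x → G x []) u
conv₂-[] F G []      = refl
conv₂-[] F G (a ∷ u) = cong (F [] [] *q G (a ∷ u) [] +q_) (conv₂-[] (F ∘ (a ∷_)) G u)

-- Carries the recursion of `sh` through `conv₂`: `H₁` collects the shuffles whose next letter comes
-- from the left word and `H₂` those whose next letter is b.
conv₂-∷ : ∀ (H H₁ H₂ G : Fn₂) b → (∀ x → H x [] ≡ H₁ x []) → (∀ x y → H x (b ∷ y) ≡ H₁ x (b ∷ y) +q H₂ x y) →
  ∀ u v → conv₂ H G u (b ∷ v) ≡ conv₂ H₁ G u (b ∷ v) +q conv₂ H₂ G u v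
conv₂-∷ H H₁ H₂ G b p q u v = go H H₁ H₂ p q u
  where
  head : ∀ (H H₁ H₂ : Fn₂) → (∀ x → H x [] ≡ H₁ x []) → (∀ x y → H x (b ∷ y) ≡ H₁ x (b ∷ y) +q H₂ x y) →
    ∀ (K : Fn) → conv (H []) K (b ∷ v) ≡ conv (H₁ []) K (b ∷ v) +q conv (H₂ []) K v
  head H H₁ H₂ p q K = trans (cong+ (cong (_*q K (b ∷ v)) (p []))
      (trans (conv-cong {g = K} (q []) (λ _ → refl) v) (conv-+ˡ (H₁ [] ∘ (b ∷_)) (H₂ []) K v)))
    (sym (ℚₚ.+-assoc (H₁ [] [] *q K (b ∷ v)) _ _))
  go : ∀ (H H₁ H₂ : Fn₂) → (∀ x → H x [] ≡ H₁ x []) → (∀ x y → H x (b ∷ y) ≡ H₁ x (b ∷ y) +q H₂ x y) →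
    ∀ u → conv₂ H G u (b ∷ v) ≡ conv₂ H₁ G u (b ∷ v) +q conv₂ H₂ G u v
  go H H₁ H₂ p q []      = head H H₁ H₂ p q (G [])
  go H H₁ H₂ p q (a ∷ u) = trans (cong+ (head H H₁ H₂ p q (G (a ∷ u))) (go (H ∘ (a ∷_)) (H₁ ∘ (a ∷_)) (H₂ ∘ (a ∷_)) (p ∘ (a ∷_)) (q ∘ (a ∷_)) u))
    (+q-medial (conv (H₁ []) (G (a ∷ u)) (b ∷ v)) (conv (H₂ []) (G (a ∷ u)) v) (conv₂ (H₁ ∘ (a ∷_)) G u (b ∷ v)) (conv₂ (H₂ ∘ (a ∷_)) G u v))

-- Deconcatenation is a morphism for the shuffle product.
sh-conv : ∀ φ ψ u v → sh (conv φ ψ) u v ≡ conv₂ (sh φ) (sh ψ) u v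
sh-conv φ ψ []      v  = refl
sh-conv φ ψ (a ∷ u) [] = sym (trans (conv₂-[] (sh φ) (sh ψ) (a ∷ u)) (conv-cong (sh-[] φ) (sh-[] ψ) (a ∷ u)))
sh-conv φ ψ (a ∷ u) (b ∷ v) = begin
  sh (λ w → φ [] *q ψ (a ∷ w) +q conv (φ ∘ (a ∷_)) ψ w) u (b ∷ v) +q sh (λ w → φ [] *q ψ (b ∷ w) +q conv (φ ∘ (b ∷_)) ψ w) (a ∷ u) v
    ≡⟨ cong+ (step₁ a u (b ∷ v)) (step₁ b (a ∷ u) v) ⟩
  (φ [] *q A +q conv₂ (sh (φ ∘ (a ∷_))) (sh ψ) u (b ∷ v)) +q (φ [] *q B +q (conv (φ ∘ (b ∷_)) (sh ψ (a ∷ u)) v +q conv₂ (λ x → sh (φ ∘ (b ∷_)) (a ∷ x)) (sh ψ) u v))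
    ≡⟨ solve 6 (λ f A B p q r → (f :* A :+ p) :+ (f :* B :+ (q :+ r)) := (f :* (A :+ B) :+ q) :+ (p :+ r)) refl (φ []) A B _ _ _ ⟩
  (φ [] *q (A +q B) +q conv (φ ∘ (b ∷_)) (sh ψ (a ∷ u)) v) +q (conv₂ (sh (φ ∘ (a ∷_))) (sh ψ) u (b ∷ v) +q conv₂ (λ x → sh (φ ∘ (b ∷_)) (a ∷ x)) (sh ψ) u v)
    ≡⟨ cong ((φ [] *q (A +q B) +q conv (φ ∘ (b ∷_)) (sh ψ (a ∷ u)) v) +q_)
         (sym (conv₂-∷ (λ x → sh φ (a ∷ x)) (sh (φ ∘ (a ∷_))) (λ x → sh (φ ∘ (b ∷_)) (a ∷ x)) (sh ψ) b (λ x → sym (sh-[] (φ ∘ (a ∷_)) x)) (λ _ _ → refl) u v)) ⟩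
  (φ [] *q (A +q B) +q conv (φ ∘ (b ∷_)) (sh ψ (a ∷ u)) v) +q conv₂ (λ x → sh φ (a ∷ x)) (sh ψ) u (b ∷ v) ∎
  where
  open QS
  open ≡-Reasoning
  A = sh (ψ ∘ (a ∷_)) u (b ∷ v)
  B = sh (ψ ∘ (b ∷_)) (a ∷ u) v
  step₁ : ∀ c x y → sh (λ w → φ [] *q ψ (c ∷ w) +q conv (φ ∘ (c ∷_)) ψ w) x y ≡ φ [] *q sh (ψ ∘ (c ∷_)) x y +q conv₂ (sh (φ ∘ (c ∷_))) (sh ψ) x y
  step₁ c x y = trans (sh-+ (λ w → φ [] *q ψ (c ∷ w)) (conv (φ ∘ (c ∷_)) ψ) x y) (cong+ (sh-* (φ []) (ψ ∘ (c ∷_)) x y) (sh-conv (φ ∘ (c ∷_)) ψ x y))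

conv-congAll : ∀ {P : ℕ → Set} {f f' g g' : Fn} {w} → All P w → (∀ u → All P u → f u ≡ f' u) → (∀ u → All P u → g u ≡ g' u) → conv f g w ≡ conv f' g' w
conv-congAll []       p q = cong* (p [] []) (q [] [])
conv-congAll (a ∷ as) p q = cong+ (cong* (p [] []) (q _ (a ∷ as))) (conv-congAll as (λ u us → p _ (a ∷ us)) q)

module _ {P Q : ℕ → Set} where

  -- Multiplicativity relative to two classes of letters. That the classes are disjoint enters only
  -- for the single factors `χ s`.
  Factors : Fn₂ → Fn → Fn → Set
  Factors F f g = ∀ x y → All P x → All Q y → F x y ≡ f x *q g y

  conv₂-factors : ∀ {F G f g h k} → Factors F f g → Factors G h k → Factors (conv₂ F G) (conv f h) (conv g k)
  conv₂-factors {F} {G} {f} {g} {h} {k} p q x y ps qs = go F f p x ps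
    where
    inner : ∀ (F : Fn₂) (f : Fn) → Factors F f g → ∀ u → All P u → conv (F []) (G u) y ≡ f [] *q h u *q conv g k y
    inner F f p u us = trans (conv-congAll qs (λ z zs → p [] z [] zs) (λ z zs → q u z us zs))
      (trans (conv-*ˡ (f []) g (λ z → h u *q k z) y) (trans (cong (f [] *q_) (conv-*ʳ (h u) g k y)) (sym (ℚₚ.*-assoc (f []) (h u) (conv g k y)))))
    go : ∀ (F : Fn₂) (f : Fn) → Factors F f g → ∀ u → All P u → conv₂ F G u y ≡ conv f h u *q conv g k y
    go F f p []      []          = inner F f p [] []
    go F f p (a ∷ u) us@(a' ∷ us') = trans (cong+ (inner F f p (a ∷ u) us) (go (F ∘ (a ∷_)) (f ∘ (a ∷_)) (λ x y xs ys → p (a ∷ x) y (a' ∷ xs) ys) u us'))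
      (sym (ℚₚ.*-distribʳ-+ (conv g k y) (f [] *q h (a ∷ u)) (conv (f ∘ (a ∷_)) h u)))

  sh-conv-factors : ∀ {φ ψ} → Factors (sh φ) φ φ → Factors (sh ψ) ψ ψ → Factors (sh (conv φ ψ)) (conv φ ψ) (conv φ ψ)
  sh-conv-factors {φ} {ψ} p q x y xs ys = trans (sh-conv φ ψ x y) (conv₂-factors p q x y xs ys)

  sh-unit : Factors (sh unit) unit unit
  sh-unit []      v       xs ys = sym (ℚₚ.*-identityˡ (unit v))
  sh-unit (a ∷ u) []      xs ys = sym (ℚₚ.*-zeroˡ 1ℚ)
  sh-unit (a ∷ u) (b ∷ v) xs ys = trans (0+0 (zero-sh u (b ∷ v)) (zero-sh (a ∷ u) v)) (sym (ℚₚ.*-zeroˡ 0ℚ))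
    where
    zero-sh : ∀ u v → sh (λ _ → 0ℚ) u v ≡ 0ℚ
    zero-sh []      v       = refl
    zero-sh (a ∷ u) []      = refl
    zero-sh (a ∷ u) (b ∷ v) = 0+0 (zero-sh u (b ∷ v)) (zero-sh (a ∷ u) v)

<ᵇ-true : ∀ {m n} → m < n → (m <ᵇ n) ≡ true
<ᵇ-true {zero}  {suc n} l       = refl
<ᵇ-true {suc m} {suc n} (s≤s l) = <ᵇ-true l

<ᵇ-false : ∀ {m n} → n ≤ m → (m <ᵇ n) ≡ false
<ᵇ-false {m}     {zero}  l       = refl
<ᵇ-false {suc m} {suc n} (s≤s l) = <ᵇ-false l

ind< : ∀ {m n} → m < n → ind (m <ᵇ n) ≡ 1ℚ
ind< l = cong ind (<ᵇ-true l)

ind≥ : ∀ {m n} → n ≤ m → ind (m <ᵇ n) ≡ 0ℚ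
ind≥ l = cong ind (<ᵇ-false l)

ind≮ : ∀ {m n} → n ≤ m → ind (not (m <ᵇ n)) ≡ 1ℚ
ind≮ l = cong (ind ∘ not) (<ᵇ-false l)

ind≯ : ∀ {m n} → m < n → ind (not (m <ᵇ n)) ≡ 0ℚ
ind≯ l = cong (ind ∘ not) (<ᵇ-true l)

-- For distinct letters the step relation is an order. Its transitivity, that c before a implies c
-- before b, is written as an equation so that it combines with ring identities.
StepOrder : Bool → ℕ → ℕ → Set
StepOrder s a b = ind (step s a b) ≡ 1ℚ × ind (step s b a) ≡ 0ℚ × (∀ c → ind (step s c a) ≡ ind (step s c a) *q ind (step s c b))

stepOrder-< : ∀ a b → a < b → StepOrder true a b
stepOrder-< a b l = ind≮ (ℕₚ.<⇒≤ l) , ind≯ l , tr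
  where
  tr : ∀ c → ind (not (a <ᵇ c)) ≡ ind (not (a <ᵇ c)) *q ind (not (b <ᵇ c))
  tr c with ℕₚ.<-≤-connex a c
  ... | inj₁ a<c = trans (ind≯ a<c) (sym (0*x (ind (not (b <ᵇ c))) (ind≯ a<c)))
  ... | inj₂ c≤a = trans (ind≮ c≤a) (sym (cong* (ind≮ c≤a) (ind≮ (ℕₚ.≤-trans c≤a (ℕₚ.<⇒≤ l)))))

stepOrder-> : ∀ a b → b < a → StepOrder false a b
stepOrder-> a b l = trans (not² (b <ᵇ a)) (ind< l) , trans (not² (a <ᵇ b)) (ind≥ (ℕₚ.<⇒≤ l)) , tr
  where
  not² : ∀ x → ind (not (not x)) ≡ ind x
  not² x = cong ind (not-involutive x)
  tr : ∀ c → ind (not (not (a <ᵇ c))) ≡ ind (not (not (a <ᵇ c))) *q ind (not (not (b <ᵇ c)))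
  tr c rewrite not-involutive (a <ᵇ c) | not-involutive (b <ᵇ c) with ℕₚ.<-≤-connex a c
  ... | inj₁ a<c = trans (ind< a<c) (sym (cong* (ind< a<c) (ind< (ℕₚ.<-trans l a<c))))
  ... | inj₂ c≤a = trans (ind≥ c≤a) (sym (0*x (ind (b <ᵇ c)) (ind≥ c≤a)))

stepOrder : ∀ s a b → a ≢ b → StepOrder s a b ⊎ StepOrder s b a
stepOrder s a b ne with ℕₚ.<-cmp a b
stepOrder s     a b ne | tri≈ _ e _ = ⊥-elim (ne e)
stepOrder true  a b ne | tri< l _ _ = inj₁ (stepOrder-< a b l)
stepOrder true  a b ne | tri> _ _ l = inj₂ (stepOrder-< b a l)
stepOrder false a b ne | tri< l _ _ = inj₂ (stepOrder-> b a l)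
stepOrder false a b ne | tri> _ _ l = inj₁ (stepOrder-> a b l)

step-antisym : ∀ s a b → a ≢ b → ind (step s b a) ≡ ind (step (not s) a b)
step-antisym s a b ne with stepOrder s a b ne
... | inj₁ (p , q , _) = trans q (sym (trans (solve 2 (λ x y → y := (x :+ y) :+ :- x) refl (ind (step s a b)) (ind (step (not s) a b)))
        (trans (cong₂ (λ x y → x +q -q y) (ind-step s a b) p) refl)))
  where open QS
... | inj₂ (p , q , _) = trans p (sym (trans (solve 2 (λ x y → y := (x :+ y) :+ :- x) refl (ind (step s a b)) (ind (step (not s) a b)))
        (trans (cong₂ (λ x y → x +q -q y) (ind-step s a b) q) refl)))
  where open QS

step-total : ∀ s a b → a ≢ b → ind (step s a b) +q ind (step s b a) ≡ 1ℚ
step-total s a b ne = trans (cong (ind (step s a b) +q_) (step-antisym s a b ne)) (ind-step s a b)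

-- Whichever of a and b precedes the other, c before that one is by transitivity c before both.
step-merge : ∀ s a b c → a ≢ b → ind (step s c a) *q ind (step s a b) +q ind (step s c b) *q ind (step s b a) ≡ ind (step s c a) *q ind (step s c b)
step-merge s a b c ne with stepOrder s a b ne
... | inj₁ (p , q , t) = trans (cong₂ (λ x y → ind (step s c a) *q x +q ind (step s c b) *q y) p q)
        (trans (solve 2 (λ x y → x :* con 1ℚ :+ y :* con 0ℚ := x) refl (ind (step s c a)) (ind (step s c b))) (t c))
  where open QS
... | inj₂ (p , q , t) = trans (cong₂ (λ x y → ind (step s c a) *q x +q ind (step s c b) *q y) q p)
        (trans (solve 2 (λ x y → x :* con 0ℚ :+ y :* con 1ℚ := y) refl (ind (step s c a)) (ind (step s c b)))
          (trans (t c) (ℚₚ.*-comm (ind (step s c b)) (ind (step s c a)))))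
  where open QS

module _ {P Q : ℕ → Set} (disj : ∀ {a b} → P a → Q b → a ≢ b) where

  sh-χ-after : ∀ s c u v → All P u → All Q v → sh (χ s ∘ (c ∷_)) u v ≡ χ s (c ∷ u) *q χ s (c ∷ v)
  sh-χ-after s c []      v       us ys = sym (ℚₚ.*-identityˡ (χ s (c ∷ v)))
  sh-χ-after s c (a ∷ u) []      us ys = sym (ℚₚ.*-identityʳ (χ s (c ∷ a ∷ u)))
  sh-χ-after s c (a ∷ u) (b ∷ v) (pa ∷ us) (qb ∷ vs) = begin
    sh (λ w → ind (step s c a) *q χ s (a ∷ w)) u (b ∷ v) +q sh (λ w → ind (step s c b) *q χ s (b ∷ w)) (a ∷ u) v
      ≡⟨ cong+ (trans (sh-* ca (χ s ∘ (a ∷_)) u (b ∷ v)) (cong (ca *q_) (sh-χ-after s a u (b ∷ v) us (qb ∷ vs))))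
               (trans (sh-* cb (χ s ∘ (b ∷_)) (a ∷ u) v) (cong (cb *q_) (sh-χ-after s b (a ∷ u) v (pa ∷ us) vs))) ⟩
    ca *q (x *q (ab *q y)) +q cb *q ((ba *q x) *q y)
      ≡⟨ solve 6 (λ ca cb ab ba x y → ca :* (x :* (ab :* y)) :+ cb :* ((ba :* x) :* y) := (ca :* ab :+ cb :* ba) :* (x :* y)) refl ca cb ab ba x y ⟩
    (ca *q ab +q cb *q ba) *q (x *q y)
      ≡⟨ cong (_*q (x *q y)) (step-merge s a b c (disj pa qb)) ⟩
    (ca *q cb) *q (x *q y)
      ≡⟨ *q-medial ca cb x y ⟩
    (ca *q x) *q (cb *q y) ∎
    where
    open QS
    open ≡-Reasoning
    ca = ind (step s c a)
    cb = ind (step s c b)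
    ab = ind (step s a b)
    ba = ind (step s b a)
    x = χ s (a ∷ u)
    y = χ s (b ∷ v)

  -- Two monotone words without common letters have exactly one monotone shuffle.
  sh-χ : ∀ s → Factors {P} {Q} (sh (χ s)) (χ s) (χ s)
  sh-χ s []      v       us ys = sym (ℚₚ.*-identityˡ (χ s v))
  sh-χ s (a ∷ u) []      us ys = sym (ℚₚ.*-identityʳ (χ s (a ∷ u)))
  sh-χ s (a ∷ u) (b ∷ v) (pa ∷ us) (qb ∷ vs) = begin
    sh (χ s ∘ (a ∷_)) u (b ∷ v) +q sh (χ s ∘ (b ∷_)) (a ∷ u) v
      ≡⟨ cong+ (sh-χ-after s a u (b ∷ v) us (qb ∷ vs)) (sh-χ-after s b (a ∷ u) v (pa ∷ us) vs) ⟩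
    x *q (ab *q y) +q (ba *q x) *q y
      ≡⟨ solve 4 (λ ab ba x y → x :* (ab :* y) :+ (ba :* x) :* y := (ab :+ ba) :* (x :* y)) refl ab ba x y ⟩
    (ab +q ba) *q (x *q y)
      ≡⟨ trans (cong (_*q (x *q y)) (step-total s a b (disj pa qb))) (ℚₚ.*-identityˡ (x *q y)) ⟩
    x *q y ∎
    where
    open QS
    open ≡-Reasoning
    ab = ind (step s a b)
    ba = ind (step s b a)
    x = χ s (a ∷ u)
    y = χ s (b ∷ v)

  sh-N : ∀ ε → Factors {P} {Q} (sh (N ε)) (N ε) (N ε)
  sh-N []      = sh-unit
  sh-N (s ∷ ε) = sh-conv-factors (sh-χ s) (sh-N ε)

-- Insertion codes of permutations

ins : ℕ → ℕ → List ℕ → List ℕ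
ins zero    x β       = x ∷ β
ins (suc j) x []      = x ∷ []
ins (suc j) x (b ∷ β) = b ∷ ins j x β

del : ℕ → List ℕ → List ℕ
del j       []      = []
del zero    (a ∷ σ) = σ
del (suc j) (a ∷ σ) = a ∷ del j σ

-- The head of a code is the position of the largest value; the tail encodes the permutation with
-- that value removed.
codes : ℕ → List (List ℕ)
codes zero    = [] ∷ []
codes (suc n) = concatMap (λ j → map (j ∷_) (codes n)) (upTo (suc n))

∑-codes : ∀ n (ψ : Fn) → ∑ (codes (suc n)) ψ ≡ ∑< (suc n) (λ j → ∑ (codes n) (ψ ∘ (j ∷_)))
∑-codes n ψ = trans (∑-concatMap-upTo (λ j → map (j ∷_) (codes n)) (suc n) ψ) (∑<-cong (suc n) (λ j _ → ∑-map (j ∷_) (codes n) ψ))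

data Valid : ℕ → List ℕ → Set where
  []  : Valid 0 []
  _∷_ : ∀ {n j c} → j ≤ n → Valid n c → Valid (suc n) (j ∷ c)

codes-valid : ∀ n → All (Valid n) (codes n)
codes-valid zero    = [] ∷ []
codes-valid (suc n) = All-concatMap (Allₚ.applyUpTo⁺₁ (λ i → i) (suc n) (λ i<n → Allₚ.map⁺ (All.map (ℕₚ.≤-pred i<n ∷_) (codes-valid n))))

Valid-length : ∀ {n c} → Valid n c → length c ≡ n
Valid-length []      = refl
Valid-length (_ ∷ v) = cong suc (Valid-length v)

-- If β is the permutation with insertion code c, then ract σ c is σ ∘ β⁻¹ read backwards: β puts its largest value at
-- position j, so the last letter of σ ∘ β⁻¹ is the j-th letter of σ.
ract : List ℕ → List ℕ → List ℕ
ract σ []      = []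
ract σ (j ∷ c) = nth σ j ∷ ract (del j σ) c

-- The code of a concatenation βγ with |β| = i interleaves the codes of (the standardisations of) β and γ.
tens : Fn → Fn → ℕ → Fn
tens F G i []      = F [] *q G []
tens F G i (j ∷ c) = if j <ᵇ i then tens (F ∘ (j ∷_)) G (pred i) c else tens F (G ∘ ((j ∸ i) ∷_)) i c

nth-++ˡ : ∀ σ τ j → j < length σ → nth (σ ++ τ) j ≡ nth σ j
nth-++ˡ (a ∷ σ) τ zero    l       = refl
nth-++ˡ (a ∷ σ) τ (suc j) (s≤s l) = nth-++ˡ σ τ j l

nth-++ʳ : ∀ σ τ j → nth (σ ++ τ) (length σ + j) ≡ nth τ j
nth-++ʳ []      τ j = refl
nth-++ʳ (a ∷ σ) τ j = nth-++ʳ σ τ j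

del-++ˡ : ∀ σ τ j → j < length σ → del j (σ ++ τ) ≡ del j σ ++ τ
del-++ˡ (a ∷ σ) τ zero    l       = refl
del-++ˡ (a ∷ σ) τ (suc j) (s≤s l) = cong (a ∷_) (del-++ˡ σ τ j l)

del-++ʳ : ∀ σ τ j → del (length σ + j) (σ ++ τ) ≡ σ ++ del j τ
del-++ʳ []      τ j = refl
del-++ʳ (a ∷ σ) τ j = cong (a ∷_) (del-++ʳ σ τ j)

length-del : ∀ σ j → j < length σ → length (del j σ) ≡ pred (length σ)
length-del (a ∷ σ)      zero    l       = refl
length-del (a ∷ b ∷ σ)  (suc j) (s≤s l) = cong suc (length-del (b ∷ σ) j l)

-- Independent codes for the two blocks, followed by a shuffle of the two words they produce.
shSum : ℕ → ℕ → Fn → Fn → Fn → List ℕ → List ℕ → ℚ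
shSum i m F G φ σ τ = ∑ (codes i) (λ c → ∑ (codes m) (λ c' → (F c *q G c') *q sh φ (ract σ c) (ract τ c')))

-- Separates the shuffles by the word that supplies the first letter. Where `pred` truncates, the
-- corresponding sum is empty.
shSum-rec : ∀ i m → suc zero ≤ i + m → ∀ F G φ σ τ → shSum i m F G φ σ τ ≡
  ∑< i (λ j → shSum (pred i) m (F ∘ (j ∷_)) G (φ ∘ (nth σ j ∷_)) (del j σ) τ) +q
  ∑< m (λ j → shSum i (pred m) F (G ∘ (j ∷_)) (φ ∘ (nth τ j ∷_)) σ (del j τ))
shSum-rec zero (suc m) _ F G φ σ τ = trans (ℚₚ.+-identityʳ (∑ (codes (suc m)) ψ))
  (trans (∑-codes m ψ) (sym (trans (ℚₚ.+-identityˡ (∑< (suc m) (λ j → shSum zero m F (G ∘ (j ∷_)) (φ ∘ (nth τ j ∷_)) σ (del j τ))))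
    (∑<-cong (suc m) (λ j _ → ℚₚ.+-identityʳ (∑ (codes m) (ψ ∘ (j ∷_))))))))
  where
  ψ : Fn
  ψ c' = (F [] *q G c') *q φ (ract τ c')
shSum-rec (suc i) zero _ F G φ σ τ = trans (∑-codes i _) (trans
  (∑<-cong (suc i) (λ j _ → ∑-cong (codes i) (λ c → cong (_+q 0ℚ) (cong ((F (j ∷ c) *q G []) *q_) (sym (sh-[] (φ ∘ (nth σ j ∷_)) (ract (del j σ) c)))))))
  (sym (ℚₚ.+-identityʳ (∑< (suc i) (λ j → shSum i zero (F ∘ (j ∷_)) G (φ ∘ (nth σ j ∷_)) (del j σ) τ)))))
shSum-rec (suc i) (suc m) _ F G φ σ τ = begin
  ∑ (codes (suc i)) (λ c → ∑ (codes (suc m)) (λ c' → FG c c' *q sh φ (ract σ c) (ract τ c')))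
    ≡⟨ ∑-codes i _ ⟩
  ∑< (suc i) (λ j → ∑ (codes i) (λ c → ∑ (codes (suc m)) (λ c' → FG (j ∷ c) c' *q sh φ (nth σ j ∷ ract (del j σ) c) (ract τ c'))))
    ≡⟨ ∑<-cong (suc i) (λ j _ → trans (∑-cong (codes i) (inner j)) (∑-+ (codes i) (X j) (λ c → Y (j ∷ c)))) ⟩
  ∑< (suc i) (λ j → ∑ (codes i) (X j) +q ∑ (codes i) (λ c → Y (j ∷ c)))
    ≡⟨ ∑<-+ (suc i) (λ j → ∑ (codes i) (X j)) (λ j → ∑ (codes i) (λ c → Y (j ∷ c))) ⟩
  ∑< (suc i) (λ j → ∑ (codes i) (X j)) +q ∑< (suc i) (λ j → ∑ (codes i) (λ c → Y (j ∷ c)))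
    ≡⟨ cong (∑< (suc i) (λ j → ∑ (codes i) (X j)) +q_) (trans (sym (∑-codes i Y))
         (sym (∑<-∑-swap (suc m) (codes (suc i)) (λ j c → ∑ (codes m) (λ c' → FG c (j ∷ c') *q sh (φ ∘ (nth τ j ∷_)) (ract σ c) (ract (del j τ) c')))))) ⟩
  ∑< (suc i) (λ j → ∑ (codes i) (X j)) +q ∑< (suc m) (λ j → shSum (suc i) m F (G ∘ (j ∷_)) (φ ∘ (nth τ j ∷_)) σ (del j τ)) ∎
  where
  open ≡-Reasoning
  FG : List ℕ → List ℕ → ℚ
  FG c c' = F c *q G c'
  X : ℕ → Fn
  X j c = ∑ (codes (suc m)) (λ c' → FG (j ∷ c) c' *q sh (φ ∘ (nth σ j ∷_)) (ract (del j σ) c) (ract τ c'))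
  Y : Fn
  Y c = ∑< (suc m) (λ j' → ∑ (codes m) (λ c' → FG c (j' ∷ c') *q sh (φ ∘ (nth τ j' ∷_)) (ract σ c) (ract (del j' τ) c')))
  inner : ∀ j c → ∑ (codes (suc m)) (λ c' → FG (j ∷ c) c' *q sh φ (nth σ j ∷ ract (del j σ) c) (ract τ c')) ≡ X j c +q Y (j ∷ c)
  inner j c = trans (∑-codes m _) (trans
    (∑<-cong (suc m) (λ j' _ → trans (∑-cong (codes m) (λ c' → ℚₚ.*-distribˡ-+ (FG (j ∷ c) (j' ∷ c')) _ _))
      (∑-+ (codes m) (x j') (λ c' → FG (j ∷ c) (j' ∷ c') *q sh (φ ∘ (nth τ j' ∷_)) (ract σ (j ∷ c)) (ract (del j' τ) c')))))
    (trans (∑<-+ (suc m) (λ j' → ∑ (codes m) (x j')) (λ j' → ∑ (codes m) (λ c' → FG (j ∷ c) (j' ∷ c') *q sh (φ ∘ (nth τ j' ∷_)) (ract σ (j ∷ c)) (ract (del j' τ) c')))) (cong (_+q Y (j ∷ c)) (sym (∑-codes m _)))))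
    where
    x : ℕ → Fn
    x j' c' = FG (j ∷ c) (j' ∷ c') *q sh (φ ∘ (nth σ j ∷_)) (ract (del j σ) c) (ract τ (j' ∷ c'))

-- The largest value of β lies in the left block exactly when its position is below i, and removing
-- it leaves the same situation with one block shortened. This is the recursion of `shSum`, so
-- prescribing β on its two blocks amounts to shuffling.
tens-sum : ∀ n i m → n ≡ i + m → ∀ F G φ σ τ → length σ ≡ i → length τ ≡ m →
  ∑ (codes n) (λ c → tens F G i c *q φ (ract (σ ++ τ) c)) ≡ shSum i m F G φ σ τ
tens-sum zero zero zero e F G φ [] [] p q = sym (ℚₚ.+-identityʳ _)
tens-sum (suc n) i m e F G φ σ τ p q = begin
  ∑ (codes (suc n)) (λ c → tens F G i c *q φ (ract (σ ++ τ) c))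
    ≡⟨ ∑-codes n _ ⟩
  ∑< (suc n) t
    ≡⟨ trans (cong (λ x → ∑< x t) e) (∑<-split i m t) ⟩
  ∑< i t +q ∑< m (λ j → t (i + j))
    ≡⟨ cong+ (∑<-cong i left) (∑<-cong m right) ⟩
  ∑< i (λ j → shSum (pred i) m (F ∘ (j ∷_)) G (φ ∘ (nth σ j ∷_)) (del j σ) τ) +q ∑< m (λ j → shSum i (pred m) F (G ∘ (j ∷_)) (φ ∘ (nth τ j ∷_)) σ (del j τ))
    ≡⟨ sym (shSum-rec i m (subst (1 ≤_) e (s≤s z≤n)) F G φ σ τ) ⟩
  shSum i m F G φ σ τ ∎
  where
  open ≡-Reasoning
  t : ℕ → ℚ
  t j = ∑ (codes n) (λ c → tens F G i (j ∷ c) *q φ (nth (σ ++ τ) j ∷ ract (del j (σ ++ τ)) c))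
  left : ∀ j → j < i → t j ≡ shSum (pred i) m (F ∘ (j ∷_)) G (φ ∘ (nth σ j ∷_)) (del j σ) τ
  left j l rewrite <ᵇ-true l | nth-++ˡ σ τ j (subst (j <_) (sym p) l) | del-++ˡ σ τ j (subst (j <_) (sym p) l) =
    tens-sum n (pred i) m (n≡ l e) (F ∘ (j ∷_)) G (φ ∘ (nth σ j ∷_)) (del j σ) τ (trans (length-del σ j (subst (j <_) (sym p) l)) (cong pred p)) q
    where
    n≡ : ∀ {i} → j < i → suc n ≡ i + m → n ≡ pred i + m
    n≡ {suc i} _ e = ℕₚ.suc-injective e
  right : ∀ j → j < m → t (i + j) ≡ shSum i (pred m) F (G ∘ (j ∷_)) (φ ∘ (nth τ j ∷_)) σ (del j τ)
  right j l rewrite <ᵇ-false (ℕₚ.m≤m+n i j) | ℕₚ.m+n∸m≡n i j | sym p | nth-++ʳ σ τ j | del-++ʳ σ τ j =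
    tens-sum n (length σ) (pred m) (n≡ l e) F (G ∘ (j ∷_)) (φ ∘ (nth τ j ∷_)) σ (del j τ) refl (trans (length-del τ j (subst (j <_) (sym q) l)) (cong pred q))
    where
    n≡ : ∀ {m} → j < m → suc n ≡ length σ + m → n ≡ length σ + pred m
    n≡ {suc m} _ e = ℕₚ.suc-injective (trans e (ℕₚ.+-suc (length σ) m))

-- The functions N expressed through insertion codes.

Distinct : List ℕ → Set
Distinct = AllPairs _≢_

-- The largest value stands last in an increasing permutation and at position 0 in a decreasing one.
χc : Bool → Fn
χc s     []      = 1ℚ
χc true  (j ∷ c) = ind (j ≡ᵇ length c) *q χc true c
χc false (j ∷ c) = ind (j ≡ᵇ 0) *q χc false c

Nc : List Bool → Fn
Nc []      c = unit c
Nc (s ∷ ε) c = ∑< (suc (length c)) (λ i → tens (χc s) (Nc ε) i c)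

decode : List ℕ → List ℕ → List ℕ
decode (x ∷ vals) (j ∷ c) = ins j x (decode vals c)
decode _          _       = []

-- Strictly decreasing lists starting below X: in `decode` every inserted letter exceeds all letters
-- already present.
data Below : ℕ → List ℕ → Set where
  []  : ∀ {X} → Below X []
  _∷_ : ∀ {X x xs} → x < X → Below x xs → Below X (x ∷ xs)

Below-weaken : ∀ {X Y xs} → X ≤ Y → Below X xs → Below Y xs
Below-weaken l []       = []
Below-weaken l (p ∷ ps) = ℕₚ.<-≤-trans p l ∷ ps

ins-All : ∀ {P : ℕ → Set} j {x β} → P x → All P β → All P (ins j x β)
ins-All zero    p ps       = p ∷ ps
ins-All (suc j) p []       = p ∷ []
ins-All (suc j) p (q ∷ ps) = q ∷ ins-All j p ps

decode-< : ∀ {X} vals c → Below X vals → All (_< X) (decode vals c)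
decode-< []         c       b       = []
decode-< (x ∷ vals) []      b       = []
decode-< (x ∷ vals) (j ∷ c) (l ∷ b) = ins-All j l (All.map (λ q → ℕₚ.<-trans q l) (decode-< vals c b))

length-ins : ∀ j x β → length (ins j x β) ≡ suc (length β)
length-ins zero    x β       = refl
length-ins (suc j) x []      = refl
length-ins (suc j) x (b ∷ β) = cong suc (length-ins j x β)

length-decode : ∀ {n} vals {c} → length vals ≡ n → Valid n c → length (decode vals c) ≡ n
length-decode []         e [] = e
length-decode (x ∷ vals) {j ∷ c} e (l ∷ v) = trans (length-ins j x (decode vals c)) (cong suc (length-decode vals (ℕₚ.suc-injective e) v))

-- Quantifying over all lists of values takes the place of standardisation, since the factors of a
-- decoded word are decoded words over other values.
Represents : ℕ → ℕ → Fn → Fn → Set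
Represents X n F Fc = ∀ vals c → length vals ≡ n → Below X vals → Valid n c → F (decode vals c) ≡ Fc c

take-ins-< : ∀ i j x β → j ≤ i → take (suc i) (ins j x β) ≡ ins j x (take i β)
take-ins-< i       zero    x β       l       = refl
take-ins-< (suc i) (suc j) x []      (s≤s l) = refl
take-ins-< (suc i) (suc j) x (b ∷ β) (s≤s l) = cong (b ∷_) (take-ins-< i j x β l)

drop-ins-< : ∀ i j x β → j ≤ i → drop (suc i) (ins j x β) ≡ drop i β
drop-ins-< i       zero    x β       l       = refl
drop-ins-< (suc i) (suc j) x []      (s≤s l) = refl
drop-ins-< (suc i) (suc j) x (b ∷ β) (s≤s l) = drop-ins-< i j x β l

take-ins-≥ : ∀ i j x β → j ≤ length β → i ≤ j → take i (ins j x β) ≡ take i β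
take-ins-≥ zero    j       x β       k       l       = refl
take-ins-≥ (suc i) (suc j) x (b ∷ β) (s≤s k) (s≤s l) = cong (b ∷_) (take-ins-≥ i j x β k l)

drop-ins-≥ : ∀ i j x β → j ≤ length β → i ≤ j → drop i (ins j x β) ≡ ins (j ∸ i) x (drop i β)
drop-ins-≥ zero    j       x β       k       l       = refl
drop-ins-≥ (suc i) (suc j) x (b ∷ β) (s≤s k) (s≤s l) = drop-ins-≥ i j x β k l

-- The largest letter x is inserted into the left factor when j < i, and otherwise into the right
-- one at position j - i. Accordingly it is absorbed into F or into G.
tens-represents : ∀ X i m {F Fc G Gc} → Represents X i F Fc → Represents X m G Gc →
  ∀ vals c → length vals ≡ i + m → Below X vals → Valid (i + m) c →
  F (take i (decode vals c)) *q G (drop i (decode vals c)) ≡ tens Fc Gc i c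
tens-represents X zero zero r q [] [] e b v = cong* (r [] [] refl [] []) (q [] [] refl [] [])
tens-represents X i m {F} {Fc} {G} {Gc} r q (x ∷ vals) (j ∷ c) e (x<X ∷ b) v = go i m r q e v
  where
  β = decode vals c
  go : ∀ i m → Represents X i F Fc → Represents X m G Gc → suc (length vals) ≡ i + m → Valid (i + m) (j ∷ c) →
    F (take i (ins j x β)) *q G (drop i (ins j x β)) ≡ tens Fc Gc i (j ∷ c)
  go i m r q e v with ℕₚ.<-≤-connex j i
  go (suc i) m r q e (l ∷ v) | inj₁ (s≤s j≤i) rewrite <ᵇ-true (s≤s j≤i) =
    trans (cong₂ (λ y z → F y *q G z) (take-ins-< i j x β j≤i) (drop-ins-< i j x β j≤i))
      (tens-represents x i m {F ∘ ins j x} {Fc ∘ (j ∷_)} {G} {Gc}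
        (λ vals' c' e' b' v' → r (x ∷ vals') (j ∷ c') (cong suc e') (x<X ∷ b') (j≤i ∷ v'))
        (λ vals' c' e' b' v' → q vals' c' e' (Below-weaken (ℕₚ.<⇒≤ x<X) b') v') vals c (ℕₚ.suc-injective e) b v)
  -- With an empty right factor the position j cannot reach i.
  go i zero r q e v | inj₂ i≤j = ⊥-elim (absurd v (trans e (ℕₚ.+-identityʳ i)) (ℕₚ.+-identityʳ i))
    where
    absurd : ∀ {n} → Valid n (j ∷ c) → suc (length vals) ≡ i → n ≡ i → ⊥
    absurd (l ∷ _) e₁ e₂ = ℕₚ.<⇒≱ (subst (j <_) e₂ (s≤s l)) i≤j
  go i (suc m) r q e v | inj₂ i≤j rewrite <ᵇ-false i≤j | ℕₚ.+-suc i m = rest v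
    where
    e' : length vals ≡ i + m
    e' = ℕₚ.suc-injective e
    rest : Valid (suc (i + m)) (j ∷ c) → F (take i (ins j x β)) *q G (drop i (ins j x β)) ≡ tens Fc (Gc ∘ ((j ∸ i) ∷_)) i c
    rest (l ∷ v) = trans (cong₂ (λ y z → F y *q G z) (take-ins-≥ i j x β j≤ i≤j) (drop-ins-≥ i j x β j≤ i≤j))
      (tens-represents x i m {F} {Fc} {G ∘ ins (j ∸ i) x} {Gc ∘ ((j ∸ i) ∷_)}
        (λ vals' c' e' b' v' → r vals' c' e' (Below-weaken (ℕₚ.<⇒≤ x<X) b') v')
        (λ vals' c' e' b' v' → q (x ∷ vals') ((j ∸ i) ∷ c') (cong suc e') (x<X ∷ b')
          (subst (j ∸ i ≤_) (ℕₚ.m+n∸m≡n i m) (ℕₚ.∸-monoˡ-≤ i l) ∷ v')) vals c e' b v)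
      where
      j≤ : j ≤ length β
      j≤ = subst (j ≤_) (sym (length-decode vals e' v)) l

χ-ins-asc : ∀ j x β → All (_< x) β → j ≤ length β → χ true (ins j x β) ≡ ind (j ≡ᵇ length β) *q χ true β
χ-ins-asc zero    x []      ps        l = refl
χ-ins-asc zero    x (b ∷ β) (p ∷ ps)  l = trans (0*x (χ true (b ∷ β)) (ind≯ p)) (sym (ℚₚ.*-zeroˡ (χ true (b ∷ β))))
χ-ins-asc (suc zero) x (b ∷ []) (p ∷ ps) l = trans (cong (_*q 1ℚ) (ind≮ (ℕₚ.<⇒≤ p))) refl
χ-ins-asc (suc zero) x (b ∷ b' ∷ β) (p ∷ ps) l = trans (x*0 (ind (step true b x)) (trans (χ-ins-asc zero x (b' ∷ β) ps z≤n) (ℚₚ.*-zeroˡ (χ true (b' ∷ β)))))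
  (sym (ℚₚ.*-zeroˡ (χ true (b ∷ b' ∷ β))))
χ-ins-asc (suc (suc j)) x (b ∷ b' ∷ β) (p ∷ ps) (s≤s l) = trans (cong (ind (step true b b') *q_) (χ-ins-asc (suc j) x (b' ∷ β) ps l))
  (*q-left-comm (ind (step true b b')) (ind (j ≡ᵇ length β)) (χ true (b' ∷ β)))
χ-ins-asc (suc (suc j)) x (b ∷ []) ps (s≤s ())

χ-ins-desc : ∀ j x β → All (_< x) β → j ≤ length β → χ false (ins j x β) ≡ ind (j ≡ᵇ 0) *q χ false β
χ-ins-desc zero    x []      ps        l = refl
χ-ins-desc zero    x (b ∷ β) (p ∷ ps)  l = cong (_*q χ false (b ∷ β)) (trans (cong ind (not-involutive (b <ᵇ x))) (ind< p))
χ-ins-desc (suc zero) x (b ∷ β) (p ∷ ps) l = trans (0*x (χ false (x ∷ β)) (trans (cong ind (not-involutive (x <ᵇ b))) (ind≥ (ℕₚ.<⇒≤ p)))) (sym (ℚₚ.*-zeroˡ (χ false (b ∷ β))))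
χ-ins-desc (suc (suc j)) x (b ∷ b' ∷ β) (p ∷ ps) (s≤s l) = trans
  (x*0 (ind (step false b b')) (trans (χ-ins-desc (suc j) x (b' ∷ β) ps l) (ℚₚ.*-zeroˡ (χ false (b' ∷ β))))) (sym (ℚₚ.*-zeroˡ (χ false (b ∷ b' ∷ β))))
χ-ins-desc (suc (suc j)) x (b ∷ []) ps (s≤s ())

χ-represents : ∀ s X n → Represents X n (χ s) (χc s)
χ-represents s     X zero    []         []      e b       v       = refl
χ-represents true  X (suc n) (x ∷ vals) (j ∷ c) e (l ∷ b) (k ∷ v) = trans
  (χ-ins-asc j x (decode vals c) (decode-< vals c b) (subst (j ≤_) (sym len) k))
  (cong₂ (λ y z → ind (j ≡ᵇ y) *q z) (trans len (sym (Valid-length v))) (χ-represents true x n vals c (ℕₚ.suc-injective e) b v))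
  where
  len : length (decode vals c) ≡ n
  len = length-decode vals (ℕₚ.suc-injective e) v
χ-represents false X (suc n) (x ∷ vals) (j ∷ c) e (l ∷ b) (k ∷ v) = trans
  (χ-ins-desc j x (decode vals c) (decode-< vals c b) (subst (j ≤_) (sym (length-decode vals (ℕₚ.suc-injective e) v)) k))
  (cong (ind (j ≡ᵇ 0) *q_) (χ-represents false x n vals c (ℕₚ.suc-injective e) b v))

N-represents : ∀ ε X n → Represents X n (N ε) (Nc ε)
N-represents []      X zero    []         []      e b v       = refl
N-represents []      X (suc n) (x ∷ vals) (j ∷ c) e b (l ∷ v) = unit-ins j
  where
  unit-ins : ∀ j {β} → unit (ins j x β) ≡ 0ℚ
  unit-ins zero            = refl
  unit-ins (suc j) {[]}    = refl
  unit-ins (suc j) {_ ∷ _} = refl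
N-represents (s ∷ ε) X n vals c e b v = trans (conv-split (χ s) (N ε) (decode vals c))
  (trans (cong (λ k → ∑< (suc k) (λ i → χ s (take i (decode vals c)) *q N ε (drop i (decode vals c)))) (trans (length-decode vals e v) (sym (Valid-length v))))
    (∑<-cong (suc (length c)) (λ i l → term i (subst (i ≤_) (Valid-length v) (ℕₚ.≤-pred l)))))
  where
  term : ∀ i → i ≤ n → χ s (take i (decode vals c)) *q N ε (drop i (decode vals c)) ≡ tens (χc s) (Nc ε) i c
  term i l = tens-represents X i (n ∸ i) {χ s} {χc s} {N ε} {Nc ε} (χ-represents s X i) (N-represents ε X (n ∸ i)) vals c (trans e (sym n≡)) b (subst (λ k → Valid k c) (sym n≡) v)
    where
    n≡ : i + (n ∸ i) ≡ n
    n≡ = ℕₚ.m+[n∸m]≡n l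

nth∷del : ∀ σ j → j < length σ → nth σ j ∷ del j σ ↭ σ
nth∷del (a ∷ σ) zero    l       = ↭-refl
nth∷del (a ∷ σ) (suc j) (s≤s l) = ↭-trans (swap (nth σ j) a ↭-refl) (prep a (nth∷del σ j l))

ract-↭ : ∀ {n} σ {c} → length σ ≡ n → Valid n c → ract σ c ↭ σ
ract-↭ []      e []      = ↭-refl
ract-↭ (a ∷ σ) {j ∷ c} e (l ∷ v) = ↭-trans (prep _ (ract-↭ (del j (a ∷ σ)) (trans (length-del (a ∷ σ) j l') (ℕₚ.suc-injective e)) v)) (nth∷del (a ∷ σ) j l')
  where
  l' : j < length (a ∷ σ)
  l' = subst (j <_) (sym e) (s≤s l)

Distinct-resp : ∀ {σ τ} → σ ↭ τ → Distinct σ → Distinct τ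
Distinct-resp p = ↭ₛ.AllPairs-resp-↭ (setoid ℕ) (λ ne e → ne (sym e)) ((λ { refl q → q }) , (λ { refl q → q })) (↭⇒↭ₛ p)

-- Sums φ over the words σβ⁻¹ read backwards, with β weighted by F at its code.
Y : Fn → Fn → Fn
Y F φ σ = ∑ (codes (length σ)) (λ c → F c *q φ (ract σ c))

∑<-pick : ∀ n k (g : ℕ → ℚ) → k < n → ∑< n (λ j → ind (j ≡ᵇ k) *q g j) ≡ g k
∑<-pick (suc n) zero    g l = trans (cong+ (ℚₚ.*-identityˡ (g 0)) (∑<-0 n (λ j _ → ℚₚ.*-zeroˡ (g (suc j))))) (ℚₚ.+-identityʳ (g 0))
∑<-pick (suc n) (suc k) g l = trans (cong+ (ℚₚ.*-zeroˡ (g 0)) (∑<-pick n k (g ∘ suc) (ℕₚ.≤-pred l))) (ℚₚ.+-identityˡ (g (suc k)))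

Y-desc : ∀ φ σ → Y (χc false) φ σ ≡ φ σ
Y-desc φ []      = trans (ℚₚ.+-identityʳ (1ℚ *q φ [])) (ℚₚ.*-identityˡ (φ []))
Y-desc φ (a ∷ σ) = trans (∑-codes n _) (trans (∑<-cong (suc n) (λ j _ → trans (∑-cong (codes n) (λ c → ℚₚ.*-assoc (ind (j ≡ᵇ 0)) (χc false c) _))
    (∑-*ˡ (codes n) (ind (j ≡ᵇ 0)) (λ c → χc false c *q φ (nth (a ∷ σ) j ∷ ract (del j (a ∷ σ)) c)))))
  (trans (∑<-pick (suc n) 0 (λ j → ∑ (codes n) (λ c → χc false c *q φ (nth (a ∷ σ) j ∷ ract (del j (a ∷ σ)) c))) z<s) (Y-desc (φ ∘ (a ∷_)) σ)))
  where n = length σ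

nth-snoc : ∀ σ a → nth (σ ++ a ∷ []) (length σ) ≡ a
nth-snoc []      a = refl
nth-snoc (b ∷ σ) a = nth-snoc σ a

del-snoc : ∀ σ a → del (length σ) (σ ++ a ∷ []) ≡ σ
del-snoc []      a = refl
del-snoc (b ∷ σ) a = cong (b ∷_) (del-snoc σ a)

-- The increasing permutation makes `ract` take letters from the end of the word; reversing the
-- argument puts them at the front, where the induction needs them.
Y-asc : ∀ φ τ → ∑ (codes (length τ)) (λ c → χc true c *q φ (ract (reverse τ) c)) ≡ φ τ
Y-asc φ []      = trans (ℚₚ.+-identityʳ (1ℚ *q φ [])) (ℚₚ.*-identityˡ (φ []))
Y-asc φ (a ∷ τ) = begin
  ∑ (codes (suc n)) (λ c → χc true c *q φ (ract (reverse (a ∷ τ)) c))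
    ≡⟨ ∑-codes n _ ⟩
  ∑< (suc n) (λ j → ∑ (codes n) (λ c → ind (j ≡ᵇ length c) *q χc true c *q t j c))
    ≡⟨ ∑<-cong (suc n) (λ j _ → trans (∑-congAll (codes-valid n) (λ c v → trans (cong (λ k → ind (j ≡ᵇ k) *q χc true c *q t j c) (Valid-length v))
         (ℚₚ.*-assoc (ind (j ≡ᵇ n)) (χc true c) (t j c)))) (∑-*ˡ (codes n) (ind (j ≡ᵇ n)) (λ c → χc true c *q t j c))) ⟩
  ∑< (suc n) (λ j → ind (j ≡ᵇ n) *q ∑ (codes n) (λ c → χc true c *q t j c))
    ≡⟨ ∑<-pick (suc n) n (λ j → ∑ (codes n) (λ c → χc true c *q t j c)) ℕₚ.≤-refl ⟩
  ∑ (codes n) (λ c → χc true c *q t n c)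
    ≡⟨ ∑-cong (codes n) (λ c → cong (χc true c *q_) (cong φ (cong₂ (λ x y → x ∷ ract y c) nth-eq del-eq))) ⟩
  ∑ (codes n) (λ c → χc true c *q φ (a ∷ ract (reverse τ) c))
    ≡⟨ Y-asc (φ ∘ (a ∷_)) τ ⟩
  φ (a ∷ τ) ∎
  where
  open ≡-Reasoning
  n = length τ
  t : ℕ → Fn
  t j c = φ (nth (reverse (a ∷ τ)) j ∷ ract (del j (reverse (a ∷ τ))) c)
  nth-eq : nth (reverse (a ∷ τ)) n ≡ a
  nth-eq = trans (cong₂ nth (Lₚ.unfold-reverse a τ) (sym (Lₚ.length-reverse τ))) (nth-snoc (reverse τ) a)
  del-eq : del n (reverse (a ∷ τ)) ≡ reverse τ
  del-eq = trans (cong₂ del (sym (Lₚ.length-reverse τ)) (Lₚ.unfold-reverse a τ)) (del-snoc (reverse τ) a)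

Y-asc' : ∀ φ σ → Y (χc true) φ σ ≡ φ (reverse σ)
Y-asc' φ σ = trans (cong₂ (λ n τ → ∑ (codes n) (λ c → χc true c *q φ (ract τ c))) (sym (Lₚ.length-reverse σ)) (sym (Lₚ.reverse-involutive σ))) (Y-asc φ (reverse σ))

take-drop-distinct : ∀ i σ → Distinct σ → ∀ {a b} → a ∈ take i σ → b ∈ drop i σ → a ≢ b
take-drop-distinct (suc i) (x ∷ σ) (p ∷ ps) (here refl) q = All.lookup (Allₚ.drop⁺ i p) q
take-drop-distinct (suc i) (x ∷ σ) (p ∷ ps) (there m)   q = take-drop-distinct i σ ps m q

-- A + block of σ enters the shuffle as it is, a − block reversed; since ract produces words backwards, it is + that reverses.
block : Fn → Bool → Fn
block φ true  σ = φ (reverse σ)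
block φ false σ = φ σ

blocks : Fn → List Bool → Fn
blocks φ []      = unit
blocks φ (d ∷ δ) = conv (block φ d) (blocks φ δ)

Y-block : ∀ φ d σ → Y (χc d) φ σ ≡ block φ d σ
Y-block φ true  = Y-asc' φ
Y-block φ false = Y-desc φ

conv-cong-Distinct : ∀ {f f' g g' : Fn} {w} → Distinct w → (∀ u → Distinct u → f u ≡ f' u) → (∀ u → Distinct u → g u ≡ g' u) → conv f g w ≡ conv f' g' w
conv-cong-Distinct {f} {f'} {g} {g'} {w} dw p q = trans (conv-split f g w) (trans
  (∑<-cong (suc (length w)) (λ i _ → cong* (p _ (AllPairsₚ.take⁺ i dw)) (q _ (AllPairsₚ.drop⁺ i dw)))) (sym (conv-split f' g' w)))

module _ (ε : List Bool) where

  private φ = N ε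

  -- Cutting off the first block of β, `tens-sum` produces a shuffle of the corresponding blocks of
  -- σ, and the multiplicativity of φ on shuffles separates it into a product.
  Y-blocks : ∀ δ σ → Distinct σ → Y (Nc δ) φ σ ≡ blocks φ δ σ
  Y-blocks []      []      u = trans (ℚₚ.+-identityʳ (1ℚ *q φ [])) (trans (ℚₚ.*-identityˡ (φ [])) (N-[] ε))
    where
    N-[] : ∀ ε → N ε [] ≡ 1ℚ
    N-[] []      = refl
    N-[] (s ∷ ε) = trans (ℚₚ.*-identityˡ (N ε [])) (N-[] ε)
  Y-blocks []      (a ∷ σ) u = trans (∑-codes (length σ) _)
    (∑<-0 (suc (length σ)) (λ j _ → ∑-0 (codes (length σ)) (λ c → ℚₚ.*-zeroˡ (φ (ract (a ∷ σ) (j ∷ c))))))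
  Y-blocks (d ∷ δ) σ u = begin
    ∑ (codes n) (λ c → Nc (d ∷ δ) c *q φ (ract σ c))
      ≡⟨ ∑-congAll (codes-valid n) (λ c v → trans (cong (λ k → ∑< (suc k) (λ i → T i c) *q φ (ract σ c)) (Valid-length v)) (sym (∑<-*ʳ (suc n) (φ (ract σ c)) (λ i → T i c)))) ⟩
    ∑ (codes n) (λ c → ∑< (suc n) (λ i → T i c *q φ (ract σ c)))
      ≡⟨ sym (∑<-∑-swap (suc n) (codes n) (λ i c → T i c *q φ (ract σ c))) ⟩
    ∑< (suc n) (λ i → ∑ (codes n) (λ c → T i c *q φ (ract σ c)))
      ≡⟨ ∑<-cong (suc n) (λ i l → split i (ℕₚ.≤-pred l)) ⟩
    ∑< (suc n) (λ i → block φ d (take i σ) *q blocks φ δ (drop i σ))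
      ≡⟨ sym (conv-split (block φ d) (blocks φ δ) σ) ⟩
    conv (block φ d) (blocks φ δ) σ ∎
    where
    open ≡-Reasoning
    n = length σ
    T : ℕ → Fn
    T i c = tens (χc d) (Nc δ) i c
    split : ∀ i → i ≤ n → ∑ (codes n) (λ c → T i c *q φ (ract σ c)) ≡ block φ d (take i σ) *q blocks φ δ (drop i σ)
    split i l = begin
      ∑ (codes n) (λ c → T i c *q φ (ract σ c))
        ≡⟨ ∑-cong (codes n) (λ c → cong (λ τ → T i c *q φ (ract τ c)) (sym (Lₚ.take++drop≡id i σ))) ⟩
      ∑ (codes n) (λ c → T i c *q φ (ract (x ++ y) c))
        ≡⟨ cong (λ k → ∑ (codes n) (λ c → tens (χc d) (Nc δ) k c *q φ (ract (x ++ y) c))) (sym lx) ⟩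
      ∑ (codes n) (λ c → tens (χc d) (Nc δ) (length x) c *q φ (ract (x ++ y) c))
        ≡⟨ tens-sum n (length x) (length y) (trans (cong length (sym (Lₚ.take++drop≡id i σ))) (Lₚ.length-++ x)) (χc d) (Nc δ) φ x y refl refl ⟩
      shSum (length x) (length y) (χc d) (Nc δ) φ x y
        -- The two classes of letters are those of x and those of y, disjoint because σ has no
        -- repeated letter.
        ≡⟨ ∑-congAll (codes-valid (length x)) (λ c v → ∑-congAll (codes-valid (length y)) (λ c' v' →
             trans (cong ((χc d c *q Nc δ c') *q_) (sh-N {P = _∈ x} {Q = _∈ y} (take-drop-distinct i σ u) ε (ract x c) (ract y c')
               (↭ₚ.All-resp-↭ (↭-sym (ract-↭ x refl v)) (All.tabulate (λ m → m))) (↭ₚ.All-resp-↭ (↭-sym (ract-↭ y refl v')) (All.tabulate (λ m → m)))))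
             (*q-medial (χc d c) (Nc δ c') (φ (ract x c)) (φ (ract y c'))))) ⟩
      ∑ (codes (length x)) (λ c → ∑ (codes (length y)) (λ c' → (χc d c *q φ (ract x c)) *q (Nc δ c' *q φ (ract y c'))))
        ≡⟨ trans (∑-cong (codes (length x)) (λ c → ∑-*ˡ (codes (length y)) (χc d c *q φ (ract x c)) _)) (∑-*ʳ (codes (length x)) (Y (Nc δ) φ y) _) ⟩
      Y (χc d) φ x *q Y (Nc δ) φ y
        ≡⟨ cong* (Y-block φ d x) (Y-blocks δ y (AllPairsₚ.drop⁺ i u)) ⟩
      block φ d x *q blocks φ δ y ∎
      where
      x = take i σ
      y = drop i σ
      lx : length x ≡ i
      lx = trans (Lₚ.length-take i σ) (ℕₚ.m≤n⇒m⊓n≡m l)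

-- Reversal and substitution of sign sequences.

N-++ : ∀ ε ε' w → N (ε ++ ε') w ≡ conv (N ε) (N ε') w
N-++ []      ε' w = sym (conv-unitˡ (N ε') w)
N-++ (s ∷ ε) ε' w = trans (conv-cong {χ s} (λ _ → refl) (N-++ ε ε') w) (sym (conv-assoc (χ s) (N ε) (N ε') w))

conv-snoc : ∀ f g w a → conv f g (w ++ a ∷ []) ≡ conv f (λ u → g (u ++ a ∷ [])) w +q f (w ++ a ∷ []) *q g []
conv-snoc f g []      a = refl
conv-snoc f g (b ∷ w) a = trans (cong (f [] *q g (b ∷ w ++ a ∷ []) +q_) (conv-snoc (f ∘ (b ∷_)) g w a)) (sym (ℚₚ.+-assoc (f [] *q g (b ∷ w ++ a ∷ [])) _ _))

conv-reverse : ∀ f g w → conv f g (reverse w) ≡ conv (g ∘ reverse) (f ∘ reverse) w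
conv-reverse f g []      = ℚₚ.*-comm (f []) (g [])
conv-reverse f g (a ∷ w) = begin
  conv f g (reverse (a ∷ w))
    ≡⟨ trans (cong (conv f g) (Lₚ.unfold-reverse a w)) (conv-snoc f g (reverse w) a) ⟩
  conv f (λ u → g (u ++ a ∷ [])) (reverse w) +q f (reverse w ++ a ∷ []) *q g []
    ≡⟨ cong+ (conv-reverse f (λ u → g (u ++ a ∷ [])) w) (trans (cong (λ u → f u *q g []) (sym (Lₚ.unfold-reverse a w))) (ℚₚ.*-comm (f (reverse (a ∷ w))) (g []))) ⟩
  conv (λ u → g (reverse u ++ a ∷ [])) (f ∘ reverse) w +q g [] *q f (reverse (a ∷ w))
    ≡⟨ ℚₚ.+-comm (conv (λ u → g (reverse u ++ a ∷ [])) (f ∘ reverse) w) (g [] *q f (reverse (a ∷ w))) ⟩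
  g [] *q f (reverse (a ∷ w)) +q conv (λ u → g (reverse u ++ a ∷ [])) (f ∘ reverse) w
    ≡⟨ cong (g [] *q f (reverse (a ∷ w)) +q_) (conv-cong {g = f ∘ reverse} (λ u → cong g (sym (Lₚ.unfold-reverse a u))) (λ _ → refl) w) ⟩
  g [] *q f (reverse (a ∷ w)) +q conv (λ u → g (reverse (a ∷ u))) (f ∘ reverse) w ∎
  where open ≡-Reasoning

χ-snoc : ∀ s u b a → χ s (u ++ b ∷ a ∷ []) ≡ χ s (u ++ b ∷ []) *q ind (step s b a)
χ-snoc s []          b a = ℚₚ.*-comm (ind (step s b a)) 1ℚ
χ-snoc s (x ∷ [])    b a = solve 2 (λ p q → p :* (q :* con 1ℚ) := (p :* con 1ℚ) :* q) refl (ind (step s x b)) (ind (step s b a))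
  where open QS
χ-snoc s (x ∷ y ∷ u) b a = trans (cong (ind (step s x y) *q_) (χ-snoc s (y ∷ u) b a)) (sym (ℚₚ.*-assoc (ind (step s x y)) (χ s (y ∷ u ++ b ∷ [])) (ind (step s b a))))

χ-reverse : ∀ s w → Distinct w → χ s (reverse w) ≡ χ (not s) w
χ-reverse s []          u = refl
χ-reverse s (a ∷ [])    u = refl
χ-reverse s (a ∷ b ∷ w) ((a≢b ∷ _) ∷ u) = begin
  χ s (reverse (a ∷ b ∷ w))
    ≡⟨ cong (χ s) (trans (Lₚ.unfold-reverse a (b ∷ w)) (trans (cong (_++ a ∷ []) (Lₚ.unfold-reverse b w)) (Lₚ.++-assoc (reverse w) (b ∷ []) (a ∷ [])))) ⟩
  χ s (reverse w ++ b ∷ a ∷ [])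
    ≡⟨ χ-snoc s (reverse w) b a ⟩
  χ s (reverse w ++ b ∷ []) *q ind (step s b a)
    ≡⟨ cong* (trans (cong (χ s) (sym (Lₚ.unfold-reverse b w))) (χ-reverse s (b ∷ w) u)) (step-antisym s a b a≢b) ⟩
  χ (not s) (b ∷ w) *q ind (step (not s) a b)
    ≡⟨ ℚₚ.*-comm (χ (not s) (b ∷ w)) (ind (step (not s) a b)) ⟩
  χ (not s) (a ∷ b ∷ w) ∎
  where open ≡-Reasoning

flip : List Bool → List Bool
flip []      = []
flip (s ∷ ε) = flip ε ++ not s ∷ []

N-reverse : ∀ ε w → Distinct w → N ε (reverse w) ≡ N (flip ε) w
N-reverse []      []      u = refl
N-reverse []      (a ∷ w) u = trans (cong unit (Lₚ.unfold-reverse a w)) (unit-snoc (reverse w))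
  where
  unit-snoc : ∀ v → unit (v ++ a ∷ []) ≡ 0ℚ
  unit-snoc []      = refl
  unit-snoc (_ ∷ _) = refl
N-reverse (s ∷ ε) w u = trans (conv-reverse (χ s) (N ε) w)
  (trans (conv-cong-Distinct u (N-reverse ε) (χ-reverse s))
    (sym (trans (N-++ (flip ε) (not s ∷ []) w) (conv-cong {N (flip ε)} (λ _ → refl) (conv-unitʳ (χ (not s))) w))))

flip-involutive : ∀ ε → flip (flip ε) ≡ ε
flip-involutive []      = refl
flip-involutive (s ∷ ε) = trans (flip-snoc (flip ε) (not s)) (cong₂ _∷_ (not-involutive s) (flip-involutive ε))
  where
  flip-snoc : ∀ ε s → flip (ε ++ s ∷ []) ≡ not s ∷ flip ε
  flip-snoc []      s = refl
  flip-snoc (t ∷ ε) s = cong (_++ not t ∷ []) (flip-snoc ε s)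

-- The internal product at the level of signs: a descending block of the right factor makes the left
-- factor read its part of σ backwards.
sub : List Bool → List Bool → List Bool
sub ε []          = []
sub ε (true ∷ δ)  = ε ++ sub ε δ
sub ε (false ∷ δ) = flip ε ++ sub ε δ

blocks-sub : ∀ ε δ w → Distinct w → blocks (N (flip ε)) δ w ≡ N (sub ε δ) w
blocks-sub ε []          w u = refl
blocks-sub ε (true ∷ δ)  w u = trans (conv-cong-Distinct u (λ v dv → trans (N-reverse (flip ε) v dv) (cong (λ x → N x v) (flip-involutive ε))) (blocks-sub ε δ))
  (sym (N-++ ε (sub ε δ) w))
blocks-sub ε (false ∷ δ) w u = trans (conv-cong-Distinct {N (flip ε)} u (λ _ _ → refl) (blocks-sub ε δ)) (sym (N-++ (flip ε) (sub ε δ) w))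

-- The internal product of functions on words of length n

downFrom : ℕ → List ℕ
downFrom zero    = []
downFrom (suc n) = n ∷ downFrom n

-- With β decoded from c and α = `reverse (ract σ c)` one has αβ = σ (`compose-ract`), so on
-- permutations this is the coefficient of σ in the product of the group algebra.
prod : ℕ → Fn → Fn → Fn
prod n f g σ = ∑ (codes n) (λ c → g (decode (downFrom n) c) *q f (reverse (ract σ c)))

downFrom-below : ∀ n → Below n (downFrom n)
downFrom-below zero    = []
downFrom-below (suc n) = ℕₚ.≤-refl ∷ downFrom-below n

length-downFrom : ∀ n → length (downFrom n) ≡ n
length-downFrom zero    = refl
length-downFrom (suc n) = cong suc (length-downFrom n)

-- The reversal in `prod` replaces ε by `flip ε`; `Y-blocks` distributes the result over the blocks
-- given by δ, and `blocks-sub` collects it again.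
prod-N : ∀ n ε δ σ → length σ ≡ n → Distinct σ → prod n (N ε) (N δ) σ ≡ N (sub ε δ) σ
prod-N n ε δ σ refl u = trans
  (∑-congAll (codes-valid n) (λ c v → cong* (N-represents δ n n (downFrom n) c (length-downFrom n) (downFrom-below n) v)
    (N-reverse ε (ract σ c) (Distinct-resp (↭-sym (ract-↭ σ refl v)) u))))
  (trans (Y-blocks (flip ε) δ σ u) (blocks-sub ε δ σ u))

alt-++ : ∀ s a b → alt s a ++ alt (if even a then s else not s) b ≡ alt s (a + b)
alt-++ s zero    b = refl
alt-++ s (suc a) b = cong (s ∷_) (trans (cong (λ t → alt (not s) a ++ alt t b) (lemma (even a))) (alt-++ (not s) a b))
  where
  lemma : ∀ e → (if not e then s else not s) ≡ (if e then not s else not (not s))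
  lemma true  = refl
  lemma false = sym (not-involutive s)

flip-alt : ∀ s k → flip (alt s k) ≡ alt (if even k then s else not s) k
flip-alt s zero    = refl
flip-alt s (suc k) = trans (cong (_++ not s ∷ []) (flip-alt (not s) k)) (trans (cong (alt t k ++_) (lemma (even k)))
    (trans (alt-++ t k 1) (trans (cong (alt t) (ℕₚ.+-comm k 1)) (cong (λ x → alt x (suc k)) (lemma' (even k))))))
  where
  t = if even k then not s else not (not s)
  lemma : ∀ e → not s ∷ [] ≡ alt (if e then (if e then not s else not (not s)) else not (if e then not s else not (not s))) 1
  lemma true  = refl
  lemma false = cong (λ x → not x ∷ []) (sym (not-involutive s))
  lemma' : ∀ e → (if e then not s else not (not s)) ≡ (if not e then s else not s)
  lemma' true  = refl
  lemma' false = not-involutive s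

even-dbl : ∀ j → even (dbl j) ≡ true
even-dbl zero    = refl
even-dbl (suc j) = trans (not-involutive (even (dbl j))) (even-dbl j)

-- `flip` fixes an alternating sequence of even length, so all l inserted copies agree and join into
-- one alternating sequence.
sub-even : ∀ s i t l → sub (alt s (dbl i)) (alt t l) ≡ alt s (l * dbl i)
sub-even s i t     zero    = refl
sub-even s i true  (suc l) = trans (cong (alt s (dbl i) ++_) (sub-even s i false l))
  (trans (cong (λ e → alt s (dbl i) ++ alt (if e then s else not s) (l * dbl i)) (sym (even-dbl i))) (alt-++ s (dbl i) (l * dbl i)))
sub-even s i false (suc l) = trans (cong₂ _++_ (trans (flip-alt s (dbl i)) (cong (λ e → alt (if e then s else not s) (dbl i)) (even-dbl i))) (sub-even s i true l))
  (trans (cong (λ e → alt s (dbl i) ++ alt (if e then s else not s) (l * dbl i)) (sym (even-dbl i))) (alt-++ s (dbl i) (l * dbl i)))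

-- `flip` changes the first sign of an alternating sequence of odd length. The signs of the right
-- factor alternate too, so neighbouring copies still fit together.
sub-odd : ∀ s i t l → sub (alt s (suc (dbl i))) (alt t l) ≡ alt (eqB t s) (l * suc (dbl i))
sub-odd s i t     zero    = refl
sub-odd s i true  (suc l) = trans (cong (alt s k ++_) (sub-odd s i false l))
  (trans (cong (λ e → alt s k ++ alt (if not e then s else not s) (l * k)) (sym (even-dbl i))) (alt-++ s k (l * k)))
  where k = suc (dbl i)
sub-odd s i false (suc l) = trans (cong₂ _++_ (trans (flip-alt s k) (cong (λ e → alt (if not e then s else not s) k) (even-dbl i))) (sub-odd s i true l))
  (trans (cong (alt (not s) k ++_) (cong (λ x → alt x (l * k)) (trans (sym (not-involutive s)) (cong (λ e → if not e then not s else not (not s)) (sym (even-dbl i))))))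
    (alt-++ (not s) k (l * k)))
  where k = suc (dbl i)

-- Restriction to permutations and bilinearity of the internal product.

IsPerm : ℕ → List ℕ → Set
IsPerm n σ = σ ↭ upTo n

IsPerm-length : ∀ {n σ} → IsPerm n σ → length σ ≡ n
IsPerm-length {n} p = trans (↭ₚ.↭-length p) (Lₚ.length-upTo n)

IsPerm-distinct : ∀ {n σ} → IsPerm n σ → Distinct σ
IsPerm-distinct {n} p = Distinct-resp (↭-sym p) (Uniqueₚ.upTo⁺ n)

upTo-snoc : ∀ n → upTo (suc n) ≡ upTo n ++ n ∷ []
upTo-snoc n = sym (Lₚ.upTo-∷ʳ n)

ins-↭ : ∀ j x β → ins j x β ↭ x ∷ β
ins-↭ zero    x β       = ↭-refl
ins-↭ (suc j) x []      = ↭-refl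
ins-↭ (suc j) x (b ∷ β) = ↭-trans (prep b (ins-↭ j x β)) (swap b x ↭-refl)

ins-perm : ∀ j {n β} → IsPerm n β → IsPerm (suc n) (ins j n β)
ins-perm j {n} {β} p = ↭-trans (ins-↭ j n β) (↭-trans (prep n p) (↭-trans (↭ₚ.∷↭∷ʳ n (upTo n)) (subst (upTo n ++ n ∷ [] ↭_) (sym (upTo-snoc n)) ↭-refl)))

decode-perm : ∀ n {c} → Valid n c → IsPerm n (decode (downFrom n) c)
decode-perm zero    []      = ↭-refl
decode-perm (suc n) {j ∷ c} (l ∷ v) = ins-perm j (decode-perm n v)

ract-perm : ∀ {n σ c} → IsPerm n σ → Valid n c → IsPerm n (reverse (ract σ c))
ract-perm {n} {σ} {c} p v = ↭-trans (↭ₚ.↭-reverse (ract σ c)) (↭-trans (ract-↭ σ (IsPerm-length p) v) p)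

prod-cong : ∀ n {f f' g g' : Fn} → (∀ u → IsPerm n u → f u ≡ f' u) → (∀ u → IsPerm n u → g u ≡ g' u) → ∀ σ → IsPerm n σ → prod n f g σ ≡ prod n f' g' σ
prod-cong n p q σ h = ∑-congAll (codes-valid n) (λ c v → cong* (q _ (decode-perm n v)) (p _ (ract-perm h v)))

prod-+ˡ : ∀ n f f' g σ → prod n (λ u → f u +q f' u) g σ ≡ prod n f g σ +q prod n f' g σ
prod-+ˡ n f f' g σ = trans (∑-cong (codes n) (λ c → ℚₚ.*-distribˡ-+ (g (decode (downFrom n) c)) _ _)) (∑-+ (codes n) _ _)

prod-*ˡ : ∀ n k f g σ → prod n (λ u → k *q f u) g σ ≡ k *q prod n f g σ
prod-*ˡ n k f g σ = trans (∑-cong (codes n) (λ c → *q-left-comm (g (decode (downFrom n) c)) k _)) (∑-*ˡ (codes n) k _)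

prod-+ʳ : ∀ n f g g' σ → prod n f (λ u → g u +q g' u) σ ≡ prod n f g σ +q prod n f g' σ
prod-+ʳ n f g g' σ = trans (∑-cong (codes n) (λ c → ℚₚ.*-distribʳ-+ (f (reverse (ract σ c))) (g (decode (downFrom n) c)) (g' (decode (downFrom n) c)))) (∑-+ (codes n) _ _)

prod-*ʳ : ∀ n k f g σ → prod n f (λ u → k *q g u) σ ≡ k *q prod n f g σ
prod-*ʳ n k f g σ = trans (∑-cong (codes n) (λ c → ℚₚ.*-assoc k (g (decode (downFrom n) c)) _)) (∑-*ˡ (codes n) k _)

prod-0ˡ : ∀ n f g σ → (∀ u → f u ≡ 0ℚ) → prod n f g σ ≡ 0ℚ
prod-0ˡ n f g σ h = ∑-0 (codes n) (λ c → x*0 (g (decode (downFrom n) c)) (h (reverse (ract σ c))))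

prod-0ʳ : ∀ n f g σ → (∀ u → g u ≡ 0ℚ) → prod n f g σ ≡ 0ℚ
prod-0ʳ n f g σ h = ∑-0 (codes n) (λ c → 0*x (f (reverse (ract σ c))) (h (decode (downFrom n) c)))

prod-evalPˡ : ∀ n d (P : ℕ → Fn) x g σ → prod n (λ u → evalP d (λ i → P i u) x) g σ ≡ evalP d (λ i → prod n (P i) g σ) x
prod-evalPˡ n zero    P x g σ = prod-0ˡ n (λ _ → 0ℚ) g σ (λ _ → refl)
prod-evalPˡ n (suc d) P x g σ = trans (prod-+ˡ n (P 0) (λ u → x *q evalP d (λ i → P (suc i) u) x) g σ) (cong (prod n (P 0) g σ +q_)
  (trans (prod-*ˡ n x (λ u → evalP d (λ i → P (suc i) u) x) g σ) (cong (x *q_) (prod-evalPˡ n d (P ∘ suc) x g σ))))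

prod-evalPʳ : ∀ n d f (P : ℕ → Fn) x σ → prod n f (λ u → evalP d (λ i → P i u) x) σ ≡ evalP d (λ i → prod n f (P i) σ) x
prod-evalPʳ n zero    f P x σ = prod-0ʳ n f (λ _ → 0ℚ) σ (λ _ → refl)
prod-evalPʳ n (suc d) f P x σ = trans (prod-+ʳ n f (P 0) (λ u → x *q evalP d (λ i → P (suc i) u) x) σ) (cong (prod n f (P 0) σ +q_)
  (trans (prod-*ʳ n x f (λ u → evalP d (λ i → P (suc i) u) x) σ) (cong (x *q_) (prod-evalPʳ n d f (P ∘ suc) x σ))))

-- The two families I (kind true) and J (kind false), read off at even and odd arguments

Kc : Bool → Bool → ℕ → Fn
Kc true  = Ic
Kc false = Jc

point : Bool → ℕ → ℕ
point true  j = dbl j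
point false j = suc (dbl j)

dbl-injective : ∀ i j → dbl i ≡ dbl j → i ≡ j
dbl-injective zero    zero    e = refl
dbl-injective (suc i) (suc j) e = cong suc (dbl-injective i j (ℕₚ.suc-injective (ℕₚ.suc-injective e)))

point-injective : ∀ k {i j} → ι (point k i) ≡ ι (point k j) → i ≡ j
point-injective true  e = dbl-injective _ _ (ι-injective e)
point-injective false e = dbl-injective _ _ (ℕₚ.suc-injective (ι-injective e))

N-eval : ∀ k s j d w → length w < d → N (alt s (point k j)) w ≡ evalP d (λ i → Kc k s i w) (ι (point k j))
N-eval true  = N-even
N-eval false = N-odd

dbl-+ : ∀ a b → dbl (a + b) ≡ dbl a + dbl b
dbl-+ zero    b = refl
dbl-+ (suc a) b = cong (suc ∘ suc) (dbl-+ a b)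

*-dbl : ∀ l i → l * dbl i ≡ dbl (l * i)
*-dbl zero    i = refl
*-dbl (suc l) i = trans (cong (λ x → dbl i + x) (*-dbl l i)) (sym (dbl-+ i (l * i)))

point-* : ∀ k k' i l → Σ ℕ λ m → point k' l * point k i ≡ point (k ∨ k') m
point-* true  k'    i l = point k' l * i , *-dbl (point k' l) i
point-* false true  i l = l * point false i , trans (ℕₚ.*-comm (dbl l) (point false i)) (trans (*-dbl (point false i) l) (cong dbl (ℕₚ.*-comm (point false i) l)))
point-* false false i l = i + l * point false i ,
  cong suc (trans (cong (λ x → dbl i + x) (trans (ℕₚ.*-comm (dbl l) (point false i)) (trans (*-dbl (point false i) l) (cong dbl (ℕₚ.*-comm (point false i) l))))) (sym (dbl-+ i (l * point false i))))

mulSign : Bool → Bool → Bool → Bool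
mulSign k s t = if k then s else eqB t s

sub-alt : ∀ k s i t l → sub (alt s (point k i)) (alt t l) ≡ alt (mulSign k s t) (l * point k i)
sub-alt true  = sub-even
sub-alt false = sub-odd

evalP-monomial : ∀ d i c x → i < d → evalP d (λ j → ind (j ≡ᵇ i) *q c) x ≡ qpow x i *q c
evalP-monomial (suc d) zero    c x l = trans (cong (λ y → 1ℚ *q c +q x *q y) (evalP-0 d x (λ j _ → ℚₚ.*-zeroˡ c)))
  (trans (cong (1ℚ *q c +q_) (ℚₚ.*-zeroʳ x)) (ℚₚ.+-identityʳ (1ℚ *q c)))
evalP-monomial (suc d) (suc i) c x (s≤s l) = trans (cong₂ (λ y z → y +q x *q z) (ℚₚ.*-zeroˡ c) (evalP-monomial d i c x l))
  (trans (ℚₚ.+-identityˡ (x *q (qpow x i *q c))) (sym (ℚₚ.*-assoc x (qpow x i) c)))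

-- The product of V_a and V_l depends on a and l only through al. Hence for fixed l the coefficient
-- of aⁱ is lⁱ times `H i` (`coefs`), and comparing powers of l leaves only j = i.
prod-K : ∀ n k s i k' t j σ → IsPerm n σ → i ≤ n → j ≤ n →
  prod n (Kc k s i) (Kc k' t j) σ ≡ ind (j ≡ᵇ i) *q Kc (k ∨ k') (mulSign k s t) i σ
prod-K n k s i k' t j σ h i≤n j≤n =
  poly-unique d (λ j → prod n (Kc k s i) (Kc k' t j) σ) (λ j → ind (j ≡ᵇ i) *q H i) (ι ∘ point k') (point-injective k')
    (λ l → trans (sym (right l)) (trans (coefs l) (sym (evalP-monomial d i (H i) (ι (point k' l)) (s≤s i≤n))))) j (s≤s j≤n)
  where
  open ≡-Reasoning
  d = suc n
  H : ℕ → ℚ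
  H i = Kc (k ∨ k') (mulSign k s t) i σ
  short : ∀ u → IsPerm n u → length u < d
  short u p = s≤s (ℕₚ.≤-reflexive (IsPerm-length p))
  whole : ∀ a l → prod n (N (alt s (point k a))) (N (alt t (point k' l))) σ ≡ evalP d H (ι (point k' l) *q ι (point k a))
  whole a l with point-* k k' a l
  ... | m , e = begin
    prod n (N (alt s (point k a))) (N (alt t (point k' l))) σ
      ≡⟨ prod-N n (alt s (point k a)) (alt t (point k' l)) σ (IsPerm-length h) (IsPerm-distinct h) ⟩
    N (sub (alt s (point k a)) (alt t (point k' l))) σ
      ≡⟨ cong (λ ε → N ε σ) (trans (sub-alt k s a t (point k' l)) (cong (alt (mulSign k s t)) e)) ⟩
    N (alt (mulSign k s t) (point (k ∨ k') m)) σ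
      ≡⟨ N-eval (k ∨ k') (mulSign k s t) m d σ (short σ h) ⟩
    evalP d H (ι (point (k ∨ k') m))
      ≡⟨ cong (evalP d H) (trans (cong ι (sym e)) (ι-* (point k' l) (point k a))) ⟩
    evalP d H (ι (point k' l) *q ι (point k a)) ∎
  coefs : ∀ l → prod n (Kc k s i) (N (alt t (point k' l))) σ ≡ qpow (ι (point k' l)) i *q H i
  coefs l = poly-unique d (λ i → prod n (Kc k s i) (N (alt t (point k' l))) σ) (λ i → qpow (ι (point k' l)) i *q H i) (ι ∘ point k) (point-injective k)
    (λ a → trans (sym (prod-evalPˡ n d (Kc k s) (ι (point k a)) (N (alt t (point k' l))) σ))
      (trans (prod-cong n {g = N (alt t (point k' l))} (λ u p → sym (N-eval k s a d u (short u p))) (λ _ _ → refl) σ h)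
        (trans (whole a l) (sym (evalP-qpow d (ι (point k' l)) H (ι (point k a))))))) i (s≤s i≤n)
  right : ∀ l → prod n (Kc k s i) (N (alt t (point k' l))) σ ≡ evalP d (λ j → prod n (Kc k s i) (Kc k' t j) σ) (ι (point k' l))
  right l = trans (prod-cong n {f = Kc k s i} (λ _ _ → refl) (λ u p → N-eval k' t l d u (short u p)) σ h)
    (prod-evalPʳ n d (Kc k s i) (Kc k' t) (ι (point k' l)) σ)

-- Coefficients as linear functionals on formal combinations

≡ᵇ-sound : ∀ a b → (a ≡ᵇ b) ≡ true → a ≡ b
≡ᵇ-sound zero    zero    e = refl
≡ᵇ-sound (suc a) (suc b) e = cong suc (≡ᵇ-sound a b e)

eqL-sound : ∀ σ τ → eqL σ τ ≡ true → σ ≡ τ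
eqL-sound []      []      e = refl
eqL-sound (a ∷ σ) (b ∷ τ) e with a ≡ᵇ b in ab
... | true = cong₂ _∷_ (≡ᵇ-sound a b ab) (eqL-sound σ τ e)

eqL-refl : ∀ σ → eqL σ σ ≡ true
eqL-refl []      = refl
eqL-refl (a ∷ σ) rewrite ≡ᵇ-refl a = eqL-refl σ

ind-eqL-subst : ∀ τ σ (f : Fn) → ind (eqL τ σ) *q f τ ≡ ind (eqL τ σ) *q f σ
ind-eqL-subst τ σ f with eqL τ σ in e
... | true  = cong (λ ρ → 1ℚ *q f ρ) (eqL-sound τ σ e)
... | false = trans (ℚₚ.*-zeroˡ (f τ)) (sym (ℚₚ.*-zeroˡ (f σ)))

-- The linear extension of h to formal combinations, in which the same permutation may occur several
-- times.
lin : GA → Fn → ℚ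
lin x h = ∑ x (λ p → proj₁ p *q h (proj₂ p))

coeff-lin : ∀ x σ → coeff x σ ≡ lin x (λ τ → ind (eqL τ σ))
coeff-lin []            σ = refl
coeff-lin ((q , τ) ∷ x) σ with eqL τ σ
... | true  = cong+ (sym (ℚₚ.*-identityʳ q)) (coeff-lin x σ)
... | false = trans (coeff-lin x σ) (sym (trans (cong (_+q lin x (λ τ → ind (eqL τ σ))) (ℚₚ.*-zeroʳ q)) (ℚₚ.+-identityˡ _)))

remove : List ℕ → GA → GA
remove τ = filterB (λ p → not (eqL (proj₂ p) τ))

lin-remove : ∀ τ x h → lin x h ≡ coeff x τ *q h τ +q lin (remove τ x) h
lin-remove τ []            h = sym (trans (cong (_+q 0ℚ) (ℚₚ.*-zeroˡ (h τ))) refl)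
lin-remove τ ((q , ρ) ∷ x) h with eqL ρ τ in e
... | true  = trans (cong₂ (λ y z → q *q h y +q z) (eqL-sound ρ τ e) (lin-remove τ x h))
  (solve 4 (λ q h c l → q :* h :+ (c :* h :+ l) := (q :+ c) :* h :+ l) refl q (h τ) (coeff x τ) (lin (remove τ x) h))
  where open QS
... | false = trans (cong (q *q h ρ +q_) (lin-remove τ x h))
  (solve 3 (λ a b l → a :+ (b :+ l) := b :+ (a :+ l)) refl (q *q h ρ) (coeff x τ *q h τ) (lin (remove τ x) h))
  where open QS

coeff-remove : ∀ τ x σ → coeff x σ ≡ 0ℚ → coeff (remove τ x) σ ≡ 0ℚ
coeff-remove τ x σ z with eqL σ τ in e
... | true rewrite eqL-sound σ τ e = gone x
  where
  gone : ∀ x → coeff (remove τ x) τ ≡ 0ℚ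
  gone []            = refl
  gone ((q , ρ) ∷ x) with eqL ρ τ in e'
  ... | true  = gone x
  ... | false rewrite e' = gone x
... | false = trans (sym (trans (lin-remove τ x (λ ρ → ind (eqL ρ σ))) (trans (cong (λ y → coeff x τ *q ind y +q lin (remove τ x) (λ ρ → ind (eqL ρ σ))) τ≢σ)
    (trans (cong (_+q lin (remove τ x) (λ ρ → ind (eqL ρ σ))) (ℚₚ.*-zeroʳ (coeff x τ))) (trans (ℚₚ.+-identityˡ _) (sym (coeff-lin (remove τ x) σ)))))))
  (trans (sym (coeff-lin x σ)) z)
  where
  τ≢σ : eqL τ σ ≡ false
  τ≢σ with eqL τ σ in e'
  ... | false = refl
  ... | true  = ⊥-elim (contra (trans (sym e) (trans (cong (λ y → eqL y τ) (sym (eqL-sound τ σ e'))) (eqL-refl τ))))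
    where
    contra : false ≢ true
    contra ()

length-remove : ∀ τ x → length (remove τ x) ≤ length x
length-remove τ []            = z≤n
length-remove τ ((q , ρ) ∷ x) with eqL ρ τ
... | true  = ℕₚ.m≤n⇒m≤1+n (length-remove τ x)
... | false = s≤s (length-remove τ x)

-- Collecting all occurrences of the first permutation gives a zero contribution and leaves a
-- shorter combination with zero coefficients. The bound m carries the induction, as `remove` is not
-- structural.
lin-0 : ∀ m x → length x ≤ m → (∀ σ → coeff x σ ≡ 0ℚ) → ∀ h → lin x h ≡ 0ℚ
lin-0 m       []            l z h = refl
lin-0 (suc m) x@((q , τ) ∷ x') (s≤s l) z h = trans (lin-remove τ x h)
  (0+0 (0*x (h τ) (z τ)) (lin-0 m (remove τ x) (ℕₚ.≤-trans shorter l) (λ σ → coeff-remove τ x σ (z σ)) h))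
  where
  shorter : length (remove τ x) ≤ length x'
  shorter rewrite eqL-refl τ = length-remove τ x'

lin-++ : ∀ x y h → lin (x ++ y) h ≡ lin x h +q lin y h
lin-++ x y h = ∑-++ x y _

lin-scale : ∀ c x h → lin (scaleGA c x) h ≡ c *q lin x h
lin-scale c x h = trans (∑-map _ x _) (trans (∑-cong x (λ p → ℚₚ.*-assoc c (proj₁ p) (h (proj₂ p)))) (∑-*ˡ x c _))

coeff-++ : ∀ x y σ → coeff (x ++ y) σ ≡ coeff x σ +q coeff y σ
coeff-++ x y σ = trans (coeff-lin (x ++ y) σ) (trans (lin-++ x y _) (sym (cong+ (coeff-lin x σ) (coeff-lin y σ))))

coeff-scale : ∀ c x σ → coeff (scaleGA c x) σ ≡ c *q coeff x σ
coeff-scale c x σ = trans (coeff-lin (scaleGA c x) σ) (trans (lin-scale c x _) (cong (c *q_) (sym (coeff-lin x σ))))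

lin-cong : ∀ x y → x ≈ y → ∀ h → lin x h ≡ lin y h
lin-cong x y e h = x-y≡0⇒x≡y (lin x h) (lin y h) (trans
  (trans (solve 2 (λ a b → a :+ :- b := a :+ :- con 1ℚ :* b) refl (lin x h) (lin y h))
    (sym (trans (lin-++ x (scaleGA (-q 1ℚ) y) h) (cong (lin x h +q_) (lin-scale (-q 1ℚ) y h)))))
  (lin-0 (length z) z ℕₚ.≤-refl (λ σ → trans (coeff-++ x (scaleGA (-q 1ℚ) y) σ) (trans (cong₂ _+q_ (e σ) (coeff-scale (-q 1ℚ) y σ))
    (solve 1 (λ a → a :+ :- con 1ℚ :* a := con 0ℚ) refl (coeff y σ)))) h))
  where
  open QS
  z = x ++ scaleGA (-q 1ℚ) y

-- Permutations as lists

∑-insertAll : ∀ x β (ψ : Fn) → ∑ (insertAll x β) ψ ≡ ∑< (suc (length β)) (λ j → ψ (ins j x β))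
∑-insertAll x []      ψ = refl
∑-insertAll x (b ∷ β) ψ = cong (ψ (x ∷ b ∷ β) +q_) (trans (∑-map (b ∷_) (insertAll x β) ψ) (∑-insertAll x β (ψ ∘ (b ∷_))))

∑-perms : ∀ n (ψ : Fn) → ∑ (perms n) ψ ≡ ∑ (codes n) (ψ ∘ decode (downFrom n))
∑-perms zero    ψ = refl
∑-perms (suc n) ψ = begin
  ∑ (perms (suc n)) ψ                                      ≡⟨ ∑-concatMap (insertAll n) (perms n) ψ ⟩
  ∑ (perms n) (λ β → ∑ (insertAll n β) ψ)                  ≡⟨ ∑-perms n _ ⟩
  ∑ (codes n) (λ c → ∑ (insertAll n (D c)) ψ)              ≡⟨ ∑-congAll (codes-valid n) (λ c v → trans (∑-insertAll n (D c) ψ)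
                                                               (cong (λ k → ∑< (suc k) (λ j → ψ (ins j n (D c)))) (length-decode (downFrom n) (length-downFrom n) v))) ⟩
  ∑ (codes n) (λ c → ∑< (suc n) (λ j → ψ (ins j n (D c)))) ≡⟨ sym (∑<-∑-swap (suc n) (codes n) (λ j c → ψ (ins j n (D c)))) ⟩
  ∑< (suc n) (λ j → ∑ (codes n) (λ c → ψ (ins j n (D c)))) ≡⟨ sym (∑-codes n (ψ ∘ decode (downFrom (suc n)))) ⟩
  ∑ (codes (suc n)) (ψ ∘ decode (downFrom (suc n)))        ∎
  where
  open ≡-Reasoning
  D = decode (downFrom n)

insertAll-perm : ∀ n β → IsPerm n β → All (IsPerm (suc n)) (insertAll n β)
insertAll-perm n β p = All.map (λ q → ↭-trans q (↭-trans (prep n p) (↭-trans (↭ₚ.∷↭∷ʳ n (upTo n)) (↭-reflexive (Lₚ.upTo-∷ʳ n))))) (go β)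
  where
  go : ∀ β → All (_↭ n ∷ β) (insertAll n β)
  go []      = ↭-refl ∷ []
  go (b ∷ β) = ↭-refl ∷ Allₚ.map⁺ (All.map (λ q → ↭-trans (prep b q) (swap b n ↭-refl)) (go β))

perms-perm : ∀ n → All (IsPerm n) (perms n)
perms-perm zero    = ↭-refl ∷ []
perms-perm (suc n) = All-concatMap (All.map (insertAll-perm n _) (perms-perm n))

∈-ins : ∀ {x σ} → x ∈ σ → Σ ℕ λ j → Σ (List ℕ) λ σ' → σ ≡ ins j x σ' × j ≤ length σ'
∈-ins {x} {_ ∷ σ} (here refl) = 0 , σ , refl , z≤n
∈-ins {x} {b ∷ σ} (there m) with ∈-ins m
... | j , σ' , e , l = suc j , b ∷ σ' , cong (b ∷_) e , s≤s l

perm-ins : ∀ n σ → IsPerm (suc n) σ → Σ ℕ λ j → Σ (List ℕ) λ σ' → σ ≡ ins j n σ' × j ≤ n × IsPerm n σ'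
perm-ins n σ p with ∈-ins (↭ₚ.∈-resp-↭ (↭-sym p) (∈ₚ.∈-upTo⁺ {suc n} {n} ℕₚ.≤-refl))
... | j , σ' , refl , l = j , σ' , refl , subst (j ≤_) (IsPerm-length p') l , p'
  where
  p' : IsPerm n σ'
  p' = ↭ₚ.drop-∷ (↭-trans (↭-sym (ins-↭ j n σ')) (↭-trans p (↭-trans (↭-reflexive (sym (Lₚ.upTo-∷ʳ n))) (↭-sym (↭ₚ.∷↭∷ʳ n (upTo n))))))

perm-< : ∀ {n σ} → IsPerm n σ → All (_< n) σ
perm-< p = ↭ₚ.All-resp-↭ (↭-sym p) (All.tabulate ∈ₚ.∈-upTo⁻)

eqL-ins : ∀ x i j β γ → All (_< x) β → All (_< x) γ → length β ≡ length γ → i ≤ length β → j ≤ length γ →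
  ind (eqL (ins i x β) (ins j x γ)) ≡ ind (i ≡ᵇ j) *q ind (eqL β γ)
eqL-ins x zero    zero    β       γ       p q e k l rewrite ≡ᵇ-refl x = sym (ℚₚ.*-identityˡ (ind (eqL β γ)))
eqL-ins x zero    (suc j) β       (c ∷ γ) p (q ∷ _) e k l rewrite ≡ᵇ-sym x c | ≡ᵇ-< c x q = sym (ℚₚ.*-zeroˡ (ind (eqL β (c ∷ γ))))
eqL-ins x (suc i) zero    (b ∷ β) γ       (p ∷ _) q e k l rewrite ≡ᵇ-< b x p = sym (ℚₚ.*-zeroˡ (ind (eqL (b ∷ β) γ)))
eqL-ins x (suc i) (suc j) (b ∷ β) (c ∷ γ) (_ ∷ p) (_ ∷ q) e (s≤s k) (s≤s l) = trans (ind-∧ (b ≡ᵇ c) (eqL (ins i x β) (ins j x γ)))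
  (trans (cong (ind (b ≡ᵇ c) *q_) (eqL-ins x i j β γ p q (ℕₚ.suc-injective e) k l))
    (trans (*q-left-comm (ind (b ≡ᵇ c)) (ind (i ≡ᵇ j)) (ind (eqL β γ))) (cong (ind (i ≡ᵇ j) *q_) (sym (ind-∧ (b ≡ᵇ c) (eqL β γ))))))

-- The place of the largest value determines the head of the code, and deleting that value leaves
-- the same question for the tail.
perm-once : ∀ n σ → IsPerm n σ → ∑ (codes n) (λ c → ind (eqL (decode (downFrom n) c) σ)) ≡ 1ℚ
perm-once zero σ p with σ | IsPerm-length p
... | [] | _ = refl
perm-once (suc n) σ p with perm-ins n σ p
... | j , σ' , refl , l , p' = begin
  ∑ (codes (suc n)) (λ c → ind (eqL (decode (downFrom (suc n)) c) (ins j n σ')))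
    ≡⟨ ∑-codes n _ ⟩
  ∑< (suc n) (λ i → ∑ (codes n) (λ c → ind (eqL (ins i n (D c)) (ins j n σ'))))
    ≡⟨ ∑<-cong (suc n) (λ i i<n → trans (∑-congAll (codes-valid n) (λ c v → eqL-ins n i j (D c) σ' (perm-< (decode-perm n v)) (perm-< p')
         (trans (len v) (sym (IsPerm-length p'))) (subst (i ≤_) (sym (len v)) (ℕₚ.≤-pred i<n)) (subst (j ≤_) (sym (IsPerm-length p')) l)))
         (∑-*ˡ (codes n) (ind (i ≡ᵇ j)) _)) ⟩
  ∑< (suc n) (λ i → ind (i ≡ᵇ j) *q ∑ (codes n) (λ c → ind (eqL (D c) σ')))
    ≡⟨ ∑<-pick (suc n) j (λ _ → ∑ (codes n) (λ c → ind (eqL (D c) σ'))) (s≤s l) ⟩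
  ∑ (codes n) (λ c → ind (eqL (D c) σ'))
    ≡⟨ perm-once n σ' p' ⟩
  1ℚ ∎
  where
  open ≡-Reasoning
  D = decode (downFrom n)
  len : ∀ {c} → Valid n c → length (D c) ≡ n
  len v = length-decode (downFrom n) (length-downFrom n) v

∑-perms-pick : ∀ n σ → IsPerm n σ → ∀ (f : Fn) → ∑ (perms n) (λ τ → ind (eqL τ σ) *q f τ) ≡ f σ
∑-perms-pick n σ p f = trans (∑-cong (perms n) (λ τ → ind-eqL-subst τ σ f)) (trans (∑-*ʳ (perms n) (f σ) (λ τ → ind (eqL τ σ)))
  (trans (cong (_*q f σ) (trans (∑-perms n _) (perm-once n σ p))) (ℚₚ.*-identityˡ (f σ))))

-- Formulated with the Boolean test on which `coeff` branches, so that it can be used directly in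
-- sums of coefficients.
Off : ℕ → List ℕ → Set
Off n σ = All (λ τ → eqL τ σ ≡ false) (perms n)

∑-perms-off : ∀ n σ → Off n σ → ∀ (f : Fn) → ∑ (perms n) (λ τ → ind (eqL τ σ) *q f τ) ≡ 0ℚ
∑-perms-off n σ o f = trans (∑-congAll {g = λ _ → 0ℚ} o (λ τ e → trans (cong (λ b → ind b *q f τ) e) (ℚₚ.*-zeroˡ (f τ)))) (∑-0 (perms n) (λ _ → refl))

perm⊎off : ∀ n σ → IsPerm n σ ⊎ Off n σ
perm⊎off n σ = go (perms n) (perms-perm n)
  where
  go : ∀ xs → All (IsPerm n) xs → IsPerm n σ ⊎ All (λ τ → eqL τ σ ≡ false) xs
  go []       ps = inj₂ []
  go (τ ∷ xs) (p ∷ ps) with eqL τ σ in e | go xs ps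
  ... | true  | _      = inj₁ (subst (IsPerm n) (eqL-sound τ σ e) p)
  ... | false | inj₁ q = inj₁ q
  ... | false | inj₂ q = inj₂ (e ∷ q)

off-not-perm : ∀ n σ → Off n σ → ¬ IsPerm n σ
off-not-perm n σ o p = 1≢0 (trans (sym (∑-perms-pick n σ p (λ _ → 1ℚ))) (∑-perms-off n σ o (λ _ → 1ℚ)))
  where
  1≢0 : 1ℚ ≢ 0ℚ
  1≢0 ()

-- x is the sum of f(σ) σ over 𝔖ₙ.
record Rep (n : ℕ) (x : GA) (f : Fn) : Set where
  constructor rep
  field
    on  : ∀ σ → IsPerm n σ → coeff x σ ≡ f σ
    off : ∀ σ → Off n σ → coeff x σ ≡ 0ℚ
open Rep public

Rep⇒≈ : ∀ {n x y f} → Rep n x f → Rep n y f → x ≈ y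
Rep⇒≈ {n} r q σ with perm⊎off n σ
... | inj₁ p = trans (on r σ p) (sym (on q σ p))
... | inj₂ o = trans (off r σ o) (sym (off q σ o))

Rep-≈ : ∀ {n x y f} → x ≈ y → Rep n y f → Rep n x f
Rep-≈ e r = rep (λ σ p → trans (e σ) (on r σ p)) (λ σ o → trans (e σ) (off r σ o))

Rep-ext : ∀ {n x f g} → (∀ σ → IsPerm n σ → f σ ≡ g σ) → Rep n x f → Rep n x g
Rep-ext e r = rep (λ σ p → trans (on r σ p) (e σ p)) (off r)

Rep-zero : ∀ {n} → Rep n zeroGA (λ _ → 0ℚ)
Rep-zero = rep (λ _ _ → refl) (λ _ _ → refl)

Rep-add : ∀ {n x y f g} → Rep n x f → Rep n y g → Rep n (addGA x y) (λ σ → f σ +q g σ)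
Rep-add {x = x} {y} r q = rep (λ σ p → trans (coeff-++ x y σ) (cong+ (on r σ p) (on q σ p))) (λ σ o → trans (coeff-++ x y σ) (0+0 (off r σ o) (off q σ o)))

Rep-scale : ∀ {n x f} c → Rep n x f → Rep n (scaleGA c x) (λ σ → c *q f σ)
Rep-scale {x = x} c r = rep (λ σ p → trans (coeff-scale c x σ) (cong (c *q_) (on r σ p))) (λ σ o → trans (coeff-scale c x σ) (x*0 c (off r σ o)))

canon : ℕ → Fn → GA
canon n f = map (λ σ → (f σ , σ)) (perms n)

coeff-canon : ∀ n f σ → coeff (canon n f) σ ≡ ∑ (perms n) (λ τ → ind (eqL τ σ) *q f τ)
coeff-canon n f σ = trans (coeff-lin (canon n f) σ) (trans (∑-map _ (perms n) _) (∑-cong (perms n) (λ τ → ℚₚ.*-comm (f τ) (ind (eqL τ σ)))))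

Rep-canon : ∀ n f → Rep n (canon n f) f
Rep-canon n f = rep (λ σ p → trans (coeff-canon n f σ) (∑-perms-pick n σ p f)) (λ σ o → trans (coeff-canon n f σ) (∑-perms-off n σ o f))

lin-Rep : ∀ {n x f} → Rep n x f → ∀ h → lin x h ≡ ∑ (perms n) (λ σ → f σ *q h σ)
lin-Rep {n} {x} {f} r h = trans (lin-cong x (canon n f) (Rep⇒≈ r (Rep-canon n f)) h) (∑-map _ (perms n) _)

map-ins : ∀ (f : ℕ → ℕ) j x β → map f (ins j x β) ≡ ins j (f x) (map f β)
map-ins f zero    x β       = refl
map-ins f (suc j) x []      = refl
map-ins f (suc j) x (b ∷ β) = cong (f b ∷_) (map-ins f j x β)

ins-del : ∀ j σ → j < length σ → ins j (nth σ j) (del j σ) ≡ σ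
ins-del zero    (a ∷ σ) l       = refl
ins-del (suc j) (a ∷ σ) (s≤s l) = cong (a ∷_) (ins-del j σ l)

-- The largest value of β sits at position j and picks the last letter of α, which is `nth σ j`. The
-- remaining values see only the shorter word with that letter deleted.
compose-ract : ∀ n σ c → length σ ≡ n → Valid n c → compose (reverse (ract σ c)) (decode (downFrom n) c) ≡ σ
compose-ract zero    []      []      e []      = refl
compose-ract (suc n) σ (j ∷ c) e (l ∷ v) = begin
  map (nth (reverse (a ∷ r))) (ins j n β)
    ≡⟨ cong (λ ρ → map (nth ρ) (ins j n β)) (Lₚ.unfold-reverse a r) ⟩
  map (nth (reverse r ++ a ∷ [])) (ins j n β)
    ≡⟨ map-ins (nth (reverse r ++ a ∷ [])) j n β ⟩
  ins j (nth (reverse r ++ a ∷ []) n) (map (nth (reverse r ++ a ∷ [])) β)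
    ≡⟨ cong₂ (ins j) (trans (cong (nth (reverse r ++ a ∷ [])) (sym len)) (nth-snoc (reverse r) a))
         (trans (map-cong-All (All.map (λ {p} p<n → nth-++ˡ (reverse r) (a ∷ []) p (subst (p <_) (sym len) p<n)) (decode-< (downFrom n) c (downFrom-below n)))) (compose-ract n (del j σ) c ld v)) ⟩
  ins j a (del j σ)
    ≡⟨ ins-del j σ l' ⟩
  σ ∎
  where
  open ≡-Reasoning
  a = nth σ j
  r = ract (del j σ) c
  β = decode (downFrom n) c
  l' : j < length σ
  l' = subst (j <_) (sym e) (s≤s l)
  ld : length (del j σ) ≡ n
  ld = trans (length-del σ j l') (cong pred e)
  len : length (reverse r) ≡ n
  len = trans (Lₚ.length-reverse r) (trans (↭ₚ.↭-length (ract-↭ (del j σ) ld v)) ld)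
  map-cong-All : ∀ {f g : ℕ → ℕ} {xs} → All (λ x → f x ≡ g x) xs → map f xs ≡ map g xs
  map-cong-All []       = refl
  map-cong-All (p ∷ ps) = cong₂ _∷_ p (map-cong-All ps)

nth-ext : ∀ α α' → length α ≡ length α' → (∀ p → p < length α → nth α p ≡ nth α' p) → α ≡ α'
nth-ext []      []        e h = refl
nth-ext (a ∷ α) (a' ∷ α') e h = cong₂ _∷_ (h 0 z<s) (nth-ext α α' (ℕₚ.suc-injective e) (λ p l → h (suc p) (s<s l)))

map-∈ : ∀ {f g : ℕ → ℕ} xs → map f xs ≡ map g xs → ∀ {x} → x ∈ xs → f x ≡ g x
map-∈ (x ∷ xs) e (here refl) = Lₚ.∷-injectiveˡ e
map-∈ (x ∷ xs) e (there m)   = map-∈ xs (Lₚ.∷-injectiveʳ e) m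

compose-cancel : ∀ n {α α' β} → IsPerm n α → IsPerm n α' → IsPerm n β → compose α β ≡ compose α' β → α ≡ α'
compose-cancel n {α} {α'} {β} p p' q e = nth-ext α α' (trans (IsPerm-length p) (sym (IsPerm-length p')))
  (λ i l → map-∈ β e (↭ₚ.∈-resp-↭ (↭-sym q) (∈ₚ.∈-upTo⁺ (subst (i <_) (IsPerm-length p) l))))

map-nth-upTo : ∀ α → map (nth α) (upTo (length α)) ≡ α
map-nth-upTo []      = refl
map-nth-upTo (a ∷ α) = cong (a ∷_) (trans (Lₚ.map-applyUpTo suc (nth (a ∷ α)) (length α)) (trans (sym (Lₚ.map-upTo (nth α) (length α))) (map-nth-upTo α)))

compose-perm : ∀ n {α β} → IsPerm n α → IsPerm n β → IsPerm n (compose α β)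
compose-perm n {α} {β} p q = ↭-trans (↭ₚ.map⁺ (nth α) q)
  (↭-trans (↭-reflexive (trans (cong (λ k → map (nth α) (upTo k)) (sym (IsPerm-length p))) (map-nth-upTo α))) p)

coeff-mul : ∀ x y σ → coeff (mulGA x y) σ ≡ lin x (λ α → lin y (λ β → ind (eqL (compose α β) σ)))
coeff-mul x y σ = trans (coeff-lin (mulGA x y) σ) (trans (∑-concatMap _ x _) (∑-cong x (λ p → trans (∑-map _ y _)
  (trans (∑-cong y (λ q → ℚₚ.*-assoc (proj₁ p) (proj₁ q) (ind (eqL (compose (proj₂ p) (proj₂ q)) σ)))) (∑-*ˡ y (proj₁ p) _)))))

-- For each β exactly one α satisfies αβ = σ, by `compose-ract` and `compose-cancel`, so the double
-- sum collapses to `prod`.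
Rep-mul : ∀ {n x y f g} → Rep n x f → Rep n y g → Rep n (mulGA x y) (prod n f g)
Rep-mul {n} {x} {y} {f} {g} r q = rep on' off'
  where
  open ≡-Reasoning
  expand : ∀ σ → coeff (mulGA x y) σ ≡ ∑ (perms n) (λ β → g β *q ∑ (perms n) (λ α → ind (eqL (compose α β) σ) *q f α))
  expand σ = begin
    coeff (mulGA x y) σ
      ≡⟨ coeff-mul x y σ ⟩
    lin x (λ α → lin y (λ β → ind (eqL (compose α β) σ)))
      ≡⟨ lin-Rep r _ ⟩
    ∑ (perms n) (λ α → f α *q lin y (λ β → ind (eqL (compose α β) σ)))
      ≡⟨ ∑-cong (perms n) (λ α → trans (cong (f α *q_) (lin-Rep q _)) (sym (∑-*ˡ (perms n) (f α) _))) ⟩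
    ∑ (perms n) (λ α → ∑ (perms n) (λ β → f α *q (g β *q ind (eqL (compose α β) σ))))
      ≡⟨ ∑-swap (perms n) (perms n) _ ⟩
    ∑ (perms n) (λ β → ∑ (perms n) (λ α → f α *q (g β *q ind (eqL (compose α β) σ))))
      ≡⟨ ∑-cong (perms n) (λ β → trans (∑-cong (perms n) (λ α →
           trans (*q-left-comm (f α) (g β) (ind (eqL (compose α β) σ))) (cong (g β *q_) (ℚₚ.*-comm (f α) (ind (eqL (compose α β) σ)))))) (∑-*ˡ (perms n) (g β) _)) ⟩
    ∑ (perms n) (λ β → g β *q ∑ (perms n) (λ α → ind (eqL (compose α β) σ) *q f α)) ∎
  on' : ∀ σ → IsPerm n σ → coeff (mulGA x y) σ ≡ prod n f g σ
  on' σ p = trans (expand σ) (trans (∑-perms n _) (∑-congAll (codes-valid n) (λ c v → cong (g (decode (downFrom n) c) *q_)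
    (trans (∑-congAll (perms-perm n) (λ α pα → cong (λ b → ind b *q f α) (same c v α pα)))
      (∑-perms-pick n (reverse (ract σ c)) (ract-perm p v) f)))))
    where
    same : ∀ c → Valid n c → ∀ α → IsPerm n α → eqL (compose α (decode (downFrom n) c)) σ ≡ eqL α (reverse (ract σ c))
    same c v α pα with eqL α (reverse (ract σ c)) in e
    ... | true  = trans (cong (λ ρ → eqL ρ σ) (trans (cong (λ ρ → compose ρ (decode (downFrom n) c)) (eqL-sound α (reverse (ract σ c)) e)) (compose-ract n σ c (IsPerm-length p) v))) (eqL-refl σ)
    ... | false with eqL (compose α (decode (downFrom n) c)) σ in e'
    ...   | false = refl
    ...   | true  = trans (sym (eqL-refl α)) (trans (cong (eqL α) (compose-cancel n pα (ract-perm p v) (decode-perm n v)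
              (trans (eqL-sound _ σ e') (sym (compose-ract n σ c (IsPerm-length p) v))))) e)
  off' : ∀ σ → Off n σ → coeff (mulGA x y) σ ≡ 0ℚ
  off' σ o = trans (expand σ) (trans (∑-congAll {g = λ _ → 0ℚ} (perms-perm n) (λ β pβ → x*0 (g β)
    (trans (∑-congAll {g = λ _ → 0ℚ} (perms-perm n) (λ α pα → 0*x (f α) (cong ind (neq α β pα pβ)))) (∑-0 (perms n) (λ _ → refl))))) (∑-0 (perms n) (λ _ → refl)))
    where
    neq : ∀ α β → IsPerm n α → IsPerm n β → eqL (compose α β) σ ≡ false
    neq α β pα pβ with eqL (compose α β) σ in e
    ... | false = refl
    ... | true  = ⊥-elim (off-not-perm n σ o (subst (IsPerm n) (eqL-sound _ σ e) (compose-perm n pα pβ)))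

ite-ind : ∀ b (c : ℚ) → (if b then 1ℚ *q c else 0ℚ) ≡ c *q ind b
ite-ind true  c = ℚₚ.*-comm 1ℚ c
ite-ind false c = sym (ℚₚ.*-zeroʳ c)

filter-Rep : ∀ n (p : List ℕ → Bool) → Rep n (map (λ σ → (1ℚ , σ)) (filterB p (perms n))) (λ σ → ind (p σ))
filter-Rep n p = rep (λ σ q → trans (val σ) (∑-perms-pick n σ q (ind ∘ p))) (λ σ o → trans (val σ) (∑-perms-off n σ o (ind ∘ p)))
  where
  val : ∀ σ → coeff (map (λ σ → (1ℚ , σ)) (filterB p (perms n))) σ ≡ ∑ (perms n) (λ τ → ind (eqL τ σ) *q ind (p τ))
  val σ = trans (coeff-lin (map (λ σ → (1ℚ , σ)) (filterB p (perms n))) σ) (trans (∑-map (λ σ → (1ℚ , σ)) (filterB p (perms n)) (λ q → proj₁ q *q ind (eqL (proj₂ q) σ))) (trans (∑-filterB p (perms n) (λ τ → 1ℚ *q ind (eqL τ σ)))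
    (∑-cong (perms n) (λ τ → ite-ind (p τ) (ind (eqL τ σ))))))

lcGA-Rep : ∀ n lc → Rep n (lcGA n lc) (evLC lc)
lcGA-Rep n []             = Rep-zero
lcGA-Rep n ((q , I) ∷ lc) = Rep-add (Rep-scale q (filter-Rep n (isRib I))) (lcGA-Rep n lc)

comp-Rep : ∀ n F → Rep n (comp n F) (hat F)
comp-Rep n F = Rep-ext (λ σ p → cong (λ k → evLC (F k) σ) (sym (IsPerm-length p))) (lcGA-Rep n (F n))

-- The identity is the only increasing permutation; V_1^+ is therefore the unit in each degree.
χ-asc-perm : ∀ n σ → IsPerm n σ → χ true σ ≡ ind (eqL (upTo n) σ)
χ-asc-perm zero σ p with σ | IsPerm-length p
... | [] | _ = refl
χ-asc-perm (suc n) σ p with perm-ins n σ p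
... | j , σ' , refl , l , p' = begin
  χ true (ins j n σ')
    ≡⟨ χ-ins-asc j n σ' (perm-< p') (subst (j ≤_) (sym ls) l) ⟩
  ind (j ≡ᵇ length σ') *q χ true σ'
    ≡⟨ cong₂ (λ b c → ind b *q c) (trans (cong (j ≡ᵇ_) ls) (≡ᵇ-sym j n)) (χ-asc-perm n σ' p') ⟩
  ind (n ≡ᵇ j) *q ind (eqL (upTo n) σ')
    ≡⟨ sym (eqL-ins n n j (upTo n) σ' (perm-< {n} ↭-refl) (perm-< p') (trans lu (sym ls)) (ℕₚ.≤-reflexive (sym lu)) (subst (j ≤_) (sym ls) l)) ⟩
  ind (eqL (ins n n (upTo n)) (ins j n σ'))
    ≡⟨ cong (λ ρ → ind (eqL ρ (ins j n σ'))) (trans ins-end (Lₚ.upTo-∷ʳ n)) ⟩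
  ind (eqL (upTo (suc n)) (ins j n σ')) ∎
  where
  open ≡-Reasoning
  ls : length σ' ≡ n
  ls = IsPerm-length p'
  lu : length (upTo n) ≡ n
  lu = Lₚ.length-upTo n
  ins-length : ∀ β x → ins (length β) x β ≡ β ++ x ∷ []
  ins-length []      x = refl
  ins-length (b ∷ β) x = cong (b ∷_) (ins-length β x)
  ins-end : ins n n (upTo n) ≡ upTo n ++ n ∷ []
  ins-end = trans (cong (λ k → ins k n (upTo n)) (sym lu)) (ins-length (upTo n) n)

one-Rep : ∀ n → Rep n (oneGA n) (χ true)
one-Rep n = rep
  (λ σ p → trans (coeff-lin (oneGA n) σ) (trans (ℚₚ.+-identityʳ (1ℚ *q ind (eqL (upTo n) σ))) (trans (ℚₚ.*-identityˡ (ind (eqL (upTo n) σ))) (sym (χ-asc-perm n σ p)))))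
  (λ σ o → trans (coeff-lin (oneGA n) σ) (trans (ℚₚ.+-identityʳ (1ℚ *q ind (eqL (upTo n) σ))) (trans (ℚₚ.*-identityˡ (ind (eqL (upTo n) σ))) (cong ind (ne σ o)))))
  where
  ne : ∀ σ → Off n σ → eqL (upTo n) σ ≡ false
  ne σ o with eqL (upTo n) σ in e
  ... | false = refl
  ... | true  = ⊥-elim (off-not-perm n σ o (subst (IsPerm n) (eqL-sound (upTo n) σ e) ↭-refl))

-- Counting block decompositions of a word of directions

bit : Bool → ℕ
bit true  = 1
bit false = 0

-- Nf ε b counts the ways to cut a word with directions b into consecutive, possibly empty, blocks that are monotone in the
-- directions ε; in Kf s ε b the first block has direction s and is not empty.
Kf : Bool → List Bool → List Bool → ℕ
Nf : List Bool → List Bool → ℕ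
Kf s ε []      = 1
Kf s ε (c ∷ b) = bit (eqB s c) * Kf s ε b + Nf ε b
Nf []      b = 0
Nf (s ∷ ε) b = Kf s ε b + Nf ε b

dirs-ind : ∀ s a b → a ≢ b → ind (step s a b) ≡ ι (bit (eqB s (a <ᵇ b)))
dirs-ind s a b ne with ℕₚ.<-cmp a b
dirs-ind true  a b ne | tri< l _ _ rewrite <ᵇ-true l | <ᵇ-false (ℕₚ.<⇒≤ l) = refl
dirs-ind false a b ne | tri< l _ _ rewrite <ᵇ-true l | <ᵇ-false (ℕₚ.<⇒≤ l) = refl
dirs-ind s     a b ne | tri≈ _ e _ = ⊥-elim (ne e)
dirs-ind true  a b ne | tri> _ _ l rewrite <ᵇ-true l | <ᵇ-false (ℕₚ.<⇒≤ l) = refl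
dirs-ind false a b ne | tri> _ _ l rewrite <ᵇ-true l | <ᵇ-false (ℕₚ.<⇒≤ l) = refl

N-empty : ∀ ε → N ε [] ≡ 1ℚ
N-empty []      = refl
N-empty (s ∷ ε) = trans (ℚₚ.*-identityˡ (N ε [])) (N-empty ε)

N-dirs : ∀ ε a w → Distinct (a ∷ w) → N ε (a ∷ w) ≡ ι (Nf ε (dirs (a ∷ w)))
K-dirs : ∀ s ε a w → Distinct (a ∷ w) → conv (χ s ∘ (a ∷_)) (N ε) w ≡ ι (Kf s ε (dirs (a ∷ w)))
N-dirs []      a w u = refl
N-dirs (s ∷ ε) a w u = trans (cong+ (trans (ℚₚ.*-identityˡ (N ε (a ∷ w))) (N-dirs ε a w u)) (K-dirs s ε a w u))
  (trans (ℚₚ.+-comm (ι (Nf ε (dirs (a ∷ w)))) (ι (Kf s ε (dirs (a ∷ w))))) (sym (ι-+ (Kf s ε (dirs (a ∷ w))) (Nf ε (dirs (a ∷ w))))))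
K-dirs s ε a []      u = trans (ℚₚ.*-identityˡ (N ε [])) (N-empty ε)
K-dirs s ε a (b ∷ w) ((a≢b ∷ _) ∷ u) = begin
  1ℚ *q N ε (b ∷ w) +q conv (λ v → ind (step s a b) *q χ s (b ∷ v)) (N ε) w
    ≡⟨ cong+ (trans (ℚₚ.*-identityˡ (N ε (b ∷ w))) (N-dirs ε b w u))
         (trans (conv-*ˡ (ind (step s a b)) (χ s ∘ (b ∷_)) (N ε) w) (cong* (dirs-ind s a b a≢b) (K-dirs s ε b w u))) ⟩
  ι n +q ι e *q ι k
    ≡⟨ trans (ℚₚ.+-comm (ι n) (ι e *q ι k)) (trans (cong (_+q ι n) (sym (ι-* e k))) (sym (ι-+ (e * k) n))) ⟩
  ι (e * k + n) ∎
  where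
  open ≡-Reasoning
  n = Nf ε (dirs (b ∷ w))
  k = Kf s ε (dirs (b ∷ w))
  e = bit (eqB s (a <ᵇ b))

-- Formulated with `Kf` because `Nf` is a sum of such counts, whereas prefixing a direction involves
-- both.
_~_ : List Bool → List Bool → Set
b ~ b' = ∀ s k → Kf s (alt (not s) k) b ≡ Kf s (alt (not s) k) b'

~-N : ∀ {b b'} → b ~ b' → ∀ s k → Nf (alt s k) b ≡ Nf (alt s k) b'
~-N h s zero    = refl
~-N h s (suc k) = cong₂ _+_ (h s k) (~-N h (not s) k)

~-∷ : ∀ c {b b'} → b ~ b' → (c ∷ b) ~ (c ∷ b')
~-∷ c h s k = cong₂ (λ x y → bit (eqB s c) * x + y) (h s k) (~-N h (not s) k)

eqB-refl : ∀ c → eqB c c ≡ true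
eqB-refl true  = refl
eqB-refl false = refl

eqB-not : ∀ c → eqB c (not c) ≡ false
eqB-not true  = refl
eqB-not false = refl

K-same : ∀ c ε b → Kf c ε (c ∷ b) ≡ Kf c ε b + Nf ε b
K-same c ε b rewrite eqB-refl c = cong (_+ Nf ε b) (ℕₚ.+-identityʳ (Kf c ε b))

K-other : ∀ c ε b → Kf c ε (not c ∷ b) ≡ Nf ε b
K-other c ε b rewrite eqB-not c = refl

-- Peeling the first block off `Y-law` changes the starting sign and produces the correction term
-- `Nf (alt (not c) k) v`; peeling once more leads back. The two laws are therefore proved together.
X-law : ∀ c k v → Nf (alt (not c) k) v + Nf (alt (not c) k) (c ∷ not c ∷ v) ≡ Nf (alt (not c) k) (not c ∷ not c ∷ v)
Y-law : ∀ c k v → Nf (alt c k) (c ∷ not c ∷ v) ≡ Nf (alt c k) (not c ∷ not c ∷ v)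
Y-law c zero    v = refl
Y-law c (suc k) v = begin
  Kf c ε (c ∷ not c ∷ v) + Nf ε (c ∷ not c ∷ v)
    ≡⟨ cong (_+ Nf ε (c ∷ not c ∷ v)) (trans (K-same c ε (not c ∷ v)) (cong (_+ Nf ε (not c ∷ v)) (K-other c ε v))) ⟩
  Nf ε v + Nf ε (not c ∷ v) + Nf ε (c ∷ not c ∷ v)
    ≡⟨ solve 3 (λ x y z → x :+ y :+ z := y :+ (x :+ z)) refl (Nf ε v) (Nf ε (not c ∷ v)) (Nf ε (c ∷ not c ∷ v)) ⟩
  Nf ε (not c ∷ v) + (Nf ε v + Nf ε (c ∷ not c ∷ v))
    ≡⟨ cong₂ _+_ (sym (K-other c ε (not c ∷ v))) (X-law c k v) ⟩
  Kf c ε (not c ∷ not c ∷ v) + Nf ε (not c ∷ not c ∷ v) ∎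
  where
  open NS
  open ≡-Reasoning
  ε = alt (not c) k
X-law c zero    v = refl
X-law c (suc k) v = begin
  (Kf d ε v + Nf ε v) + (Kf d ε (c ∷ d ∷ v) + Nf ε (c ∷ d ∷ v))
    ≡⟨ cong (λ x → (Kf d ε v + Nf ε v) + (x + Nf ε (c ∷ d ∷ v))) (subst (λ x → Kf d ε (x ∷ d ∷ v) ≡ Nf ε (d ∷ v)) (not-involutive c) (K-other d ε (d ∷ v))) ⟩
  (Kf d ε v + Nf ε v) + (Nf ε (d ∷ v) + Nf ε (c ∷ d ∷ v))
    ≡⟨ cong (λ x → (Kf d ε v + Nf ε v) + (Nf ε (d ∷ v) + x)) (subst (λ x → Nf (alt x k) (c ∷ d ∷ v) ≡ Nf (alt x k) (d ∷ d ∷ v)) (sym (not-involutive c)) (Y-law c k v)) ⟩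
  (Kf d ε v + Nf ε v) + (Nf ε (d ∷ v) + Nf ε (d ∷ d ∷ v))
    ≡⟨ sym (ℕₚ.+-assoc (Kf d ε v + Nf ε v) (Nf ε (d ∷ v)) (Nf ε (d ∷ d ∷ v))) ⟩
  ((Kf d ε v + Nf ε v) + Nf ε (d ∷ v)) + Nf ε (d ∷ d ∷ v)
    ≡⟨ cong (_+ Nf ε (d ∷ d ∷ v)) (sym (trans (K-same d ε (d ∷ v)) (cong (_+ Nf ε (d ∷ v)) (K-same d ε v)))) ⟩
  Kf d ε (d ∷ d ∷ v) + Nf ε (d ∷ d ∷ v) ∎
  where
  open ≡-Reasoning
  d = not c
  ε = alt (not (not c)) k

-- Hence a direction can be moved across a change of direction, so only their number and the first one matter.
move : ∀ c v → (c ∷ c ∷ not c ∷ v) ~ (c ∷ not c ∷ not c ∷ v)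
move true  v true  k = trans (K-same true (alt false k) (true ∷ false ∷ v)) (trans (Y-law true (suc k) v) (sym (K-same true (alt false k) (false ∷ false ∷ v))))
move true  v false k = trans (K-other false (alt true k) (true ∷ false ∷ v)) (trans (Y-law true k v) (sym (K-other false (alt true k) (false ∷ false ∷ v))))
move false v true  k = trans (K-other true (alt false k) (false ∷ true ∷ v)) (trans (Y-law false k v) (sym (K-other true (alt false k) (true ∷ true ∷ v))))
move false v false k = trans (K-same false (alt true k) (false ∷ true ∷ v)) (trans (Y-law false (suc k) v) (sym (K-same false (alt true k) (true ∷ true ∷ v))))

-- A normal form of length m with all d changes as early as possible and a constant tail.
canonDirs : Bool → ℕ → ℕ → List Bool
canonDirs c d       zero    = []
canonDirs c zero    (suc m) = c ∷ canonDirs c zero m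
canonDirs c (suc d) (suc m) = c ∷ canonDirs (not c) d m

~-refl : ∀ {b} → b ~ b
~-refl s k = refl

~-trans : ∀ {a b c} → a ~ b → b ~ c → a ~ c
~-trans p q s k = trans (p s k) (q s k)

-- The doubled first direction is moved across one change after another until it joins the constant
-- tail.
push : ∀ c d m → d < m → (c ∷ canonDirs c d m) ~ canonDirs c d (suc m)
push c zero    m       l       = ~-refl
push c (suc d) (suc (suc m)) (s≤s l) = ~-trans (head d) (~-∷ c (push (not c) d (suc m) l))
  where
  head : ∀ d → (c ∷ c ∷ canonDirs (not c) d (suc m)) ~ (c ∷ not c ∷ canonDirs (not c) d (suc m))
  head zero    = move c (canonDirs (not c) zero m)
  head (suc d) = move c (canonDirs (not (not c)) d m)

changes-same : ∀ c b → changes (c ∷ c ∷ b) ≡ changes (c ∷ b)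
changes-same true  b = refl
changes-same false b = refl

changes-other : ∀ c b → changes (c ∷ not c ∷ b) ≡ suc (changes (not c ∷ b))
changes-other true  b = refl
changes-other false b = refl

same⊎other : ∀ c c' → c' ≡ c ⊎ c' ≡ not c
same⊎other true  true  = inj₁ refl
same⊎other true  false = inj₂ refl
same⊎other false true  = inj₂ refl
same⊎other false false = inj₁ refl

changes-≤ : ∀ c b → changes (c ∷ b) ≤ length b
changes-≤ c []       = z≤n
changes-≤ c (c' ∷ b) with same⊎other c c'
... | inj₁ refl = subst (_≤ suc (length b)) (sym (changes-same c b)) (ℕₚ.m≤n⇒m≤1+n (changes-≤ c b))
... | inj₂ refl = subst (_≤ suc (length b)) (sym (changes-other c b)) (s≤s (changes-≤ (not c) b))

canonical : ∀ c b → (c ∷ b) ~ canonDirs c (changes (c ∷ b)) (suc (length b))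
canonical c []       = ~-refl
canonical c (c' ∷ b) with same⊎other c c'
... | inj₁ refl rewrite changes-same c b = λ s k → trans (~-∷ c (canonical c b) s k) (push c (changes (c ∷ b)) (suc (length b)) (s≤s (changes-≤ c b)) s k)
... | inj₂ refl rewrite changes-other c b = ~-∷ c (canonical (not c) b)

-- The least number of blocks in alternating directions, the first of them s, into which a word with directions b can be cut.
need : Bool → List Bool → ℕ
need s []      = 1
need s (c ∷ b) = if eqB s c then need s b else suc (need (not s) b)

need-not : ∀ s b → need s b ≤ suc (need (not s) b)
need-not s     []          = s≤s z≤n
need-not true  (true ∷ b)  = ℕₚ.m≤n⇒m≤1+n (ℕₚ.m≤n⇒m≤1+n ℕₚ.≤-refl)
need-not true  (false ∷ b) = ℕₚ.≤-refl
need-not false (true ∷ b)  = ℕₚ.≤-refl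
need-not false (false ∷ b) = ℕₚ.m≤n⇒m≤1+n (ℕₚ.m≤n⇒m≤1+n ℕₚ.≤-refl)

Kf-vanish : ∀ s k b → suc k < need s b → Kf s (alt (not s) k) b ≡ 0
Nf-vanish : ∀ s k b → k < need s b → Nf (alt s k) b ≡ 0
Kf-vanish s k []      (s≤s ())
Kf-vanish true  k (true ∷ b)  l = cong₂ (λ x y → x + 0 + y) (Kf-vanish true k b l) (Nf-vanish false k b (ℕₚ.≤-pred (ℕₚ.≤-trans l (need-not true b))))
Kf-vanish true  k (false ∷ b) l = Nf-vanish false k b (ℕₚ.≤-pred l)
Kf-vanish false k (true ∷ b)  l = Nf-vanish true k b (ℕₚ.≤-pred l)
Kf-vanish false k (false ∷ b) l = cong₂ (λ x y → x + 0 + y) (Kf-vanish false k b l) (Nf-vanish true k b (ℕₚ.≤-pred (ℕₚ.≤-trans l (need-not false b))))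
Nf-vanish s zero    b l = refl
Nf-vanish s (suc k) b l = cong₂ _+_ (Kf-vanish s k b l) (Nf-vanish (not s) k b (ℕₚ.≤-pred (ℕₚ.≤-trans l (need-not s b))))

need-pos : ∀ s b → 1 ≤ need s b
need-pos s     []          = s≤s z≤n
need-pos true  (true ∷ b)  = need-pos true b
need-pos true  (false ∷ b) = s≤s z≤n
need-pos false (true ∷ b)  = s≤s z≤n
need-pos false (false ∷ b) = need-pos false b

Kf-positive : ∀ s k b → need s b ≤ suc k → 1 ≤ Kf s (alt (not s) k) b
Kf-positive s k [] l = s≤s z≤n
Kf-positive true  k (true ∷ b)  l = ℕₚ.≤-trans (Kf-positive true k b l) (ℕₚ.≤-trans (ℕₚ.≤-reflexive (sym (ℕₚ.+-identityʳ _))) (ℕₚ.m≤m+n _ _))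
Kf-positive false k (false ∷ b) l = ℕₚ.≤-trans (Kf-positive false k b l) (ℕₚ.≤-trans (ℕₚ.≤-reflexive (sym (ℕₚ.+-identityʳ _))) (ℕₚ.m≤m+n _ _))
Kf-positive true  zero    (false ∷ b) (s≤s l) = ⊥-elim (ℕₚ.<⇒≱ (need-pos false b) l)
Kf-positive false zero    (true ∷ b)  (s≤s l) = ⊥-elim (ℕₚ.<⇒≱ (need-pos true b) l)
Kf-positive true  (suc k) (false ∷ b) (s≤s l) = ℕₚ.≤-trans (Kf-positive false k b l) (ℕₚ.m≤m+n _ _)
Kf-positive false (suc k) (true ∷ b)  (s≤s l) = ℕₚ.≤-trans (Kf-positive true k b l) (ℕₚ.m≤m+n _ _)

-- Triangularity in the number of runs.

value : ℕ → Bool → ℕ → ℕ → Bool → ℚ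
value n s k r asc = ι (Nf (alt s k) (canonDirs asc (pred r) (pred n)))

length-dirs : ∀ a w → length (dirs (a ∷ w)) ≡ length w
length-dirs a []      = refl
length-dirs a (b ∷ w) = cong suc (length-dirs b w)

length≥2 : ∀ {n σ} → 2 ≤ n → IsPerm n σ → Σ ℕ λ a → Σ ℕ λ b → Σ (List ℕ) λ w → σ ≡ a ∷ b ∷ w
length≥2 {n} {σ} n≥2 p with σ | subst (2 ≤_) (sym (IsPerm-length p)) n≥2
... | a ∷ b ∷ w | _ = a , b , w , refl
... | a ∷ []    | s≤s ()

N-value : ∀ n s k σ → 2 ≤ n → IsPerm n σ → N (alt s k) σ ≡ value n s k (runs σ) (firstAsc σ)
N-value n s k σ n≥2 p with length≥2 n≥2 p
... | a , b , w , refl = trans (N-dirs (alt s k) a (b ∷ w) (IsPerm-distinct p))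
  (cong ι (trans (~-N (canonical (a <ᵇ b) (dirs (b ∷ w))) s k)
    (cong (λ m → Nf (alt s k) (canonDirs (a <ᵇ b) (changes ((a <ᵇ b) ∷ dirs (b ∷ w))) m)) (trans (cong suc (length-dirs b w)) (cong pred (IsPerm-length p))))))

runs-< : ∀ n σ → 2 ≤ n → IsPerm n σ → runs σ < n
runs-< n σ n≥2 p with length≥2 n≥2 p
... | a , b , w , refl = subst (suc (runs (a ∷ b ∷ w)) ≤_) (IsPerm-length p)
  (s≤s (s≤s (ℕₚ.≤-trans (changes-≤ (a <ᵇ b) (dirs (b ∷ w))) (ℕₚ.≤-reflexive (length-dirs b w)))))

-- Starting with the wrong direction costs one additional, empty, first block.
need-canon : ∀ c d m → d < m → need c (canonDirs c d m) ≡ suc d × need (not c) (canonDirs c d m) ≡ suc (suc d)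
need-canon c zero (suc m) l = first c m , second c m
  where
  first : ∀ c m → need c (canonDirs c zero (suc m)) ≡ 1
  first true  zero    = refl
  first false zero    = refl
  first true  (suc m) = first true m
  first false (suc m) = first false m
  second : ∀ c m → need (not c) (canonDirs c zero (suc m)) ≡ 2
  second true  zero    = refl
  second false zero    = refl
  second true  (suc m) = cong suc (first true m)
  second false (suc m) = cong suc (first false m)
need-canon true  (suc d) (suc m) (s≤s l) = proj₂ (need-canon false d m l) , cong suc (proj₂ (need-canon false d m l))
need-canon false (suc d) (suc m) (s≤s l) = proj₂ (need-canon true d m l) , cong suc (proj₂ (need-canon true d m l))

need-canon-≥ : ∀ s c d m → d < m → suc d ≤ need s (canonDirs c d m)
need-canon-≥ s c d m l with same⊎other c s
... | inj₁ refl = ℕₚ.≤-reflexive (sym (proj₁ (need-canon c d m l)))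
... | inj₂ refl = ℕₚ.≤-trans (ℕₚ.n≤1+n _) (ℕₚ.≤-reflexive (sym (proj₂ (need-canon c d m l))))

value-vanish : ∀ n s k r c → k < suc r → suc r < n → value n s k (suc r) c ≡ 0ℚ
value-vanish (suc n) s k r c l (s≤s r<n) = cong ι (Nf-vanish s k (canonDirs c r n) (ℕₚ.≤-trans l (need-canon-≥ s c r n r<n)))

value-other : ∀ n k c → suc k < n → value n (not c) (suc k) (suc k) c ≡ 0ℚ
value-other (suc n) k c (s≤s l) = cong ι (Nf-vanish (not c) (suc k) (canonDirs c k n) (ℕₚ.≤-reflexive (sym (proj₂ (need-canon c k n l)))))

value-diagonal : ∀ n k c → suc k < n → value n c (suc k) (suc k) c ≢ 0ℚ
value-diagonal (suc n) k c (s≤s l) e = ℕₚ.<⇒≱ positive (ℕₚ.≤-reflexive (ι-injective {m} {0} e))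
  where
  m = Nf (alt c (suc k)) (canonDirs c k n)
  positive : 1 ≤ m
  positive = ℕₚ.≤-trans (Kf-positive c k (canonDirs c k n) (ℕₚ.≤-reflexive (proj₁ (need-canon c k n l)))) (ℕₚ.m≤m+n _ _)

-- Triangularity of the matrix (value n s k r c) spans all functions of (runs, first direction) by the N (alt s k).
record Linear (n : ℕ) (Good : Fn → Set) : Set where
  field
    ext     : ∀ {f g} → (∀ σ → IsPerm n σ → f σ ≡ g σ) → Good f → Good g
    zero-ok : Good (λ _ → 0ℚ)
    plus-ok : ∀ {f g} → Good f → Good g → Good (λ σ → f σ +q g σ)
    mult-ok : ∀ c {f} → Good f → Good (λ σ → c *q f σ)

quotient : ∀ p v → v ≢ 0ℚ → Σ ℚ λ c → c *q v ≡ p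
quotient p v v≢0 = p *q (1/ v) , trans (ℚₚ.*-assoc p (1/ v) v) (trans (cong (p *q_) (ℚₚ.*-inverseˡ v)) (ℚₚ.*-identityʳ p))
  where instance _ = ℚ.≢-nonZero v≢0

module _ {n : ℕ} (n≥2 : 2 ≤ n) {Good : Fn → Set} (lin : Linear n Good) (gens : ∀ s k → Good (N (alt s k))) where

  open Linear lin

  -- Back substitution. The two functions with `suc K` blocks vanish on permutations with more runs,
  -- and by `value-other` their values at exactly `suc K` runs form a diagonal 2 × 2 matrix;
  -- subtracting suitable multiples clears that number of runs.
  spanned-up-to : ∀ K → K < n → ∀ (F : ℕ → Bool → ℚ) → (∀ r c → K < r → r < n → F r c ≡ 0ℚ) → Good (λ σ → F (runs σ) (firstAsc σ))
  spanned-up-to zero    K<n F z = ext (λ σ p → sym (z (runs σ) (firstAsc σ) (s≤s z≤n) (runs-< n σ n≥2 p))) zero-ok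
  spanned-up-to (suc K) K<n F z = ext
      (λ σ p → trans (cong₂ (λ x y → G (runs σ) (firstAsc σ) +q (cT *q x +q cF *q y)) (N-value n true (suc K) σ n≥2 p) (N-value n false (suc K) σ n≥2 p))
        (solve 2 (λ f v → (f :+ :- con 1ℚ :* v) :+ v := f) refl (F (runs σ) (firstAsc σ)) (V (runs σ) (firstAsc σ))))
      (plus-ok (spanned-up-to K (ℕₚ.<-trans (ℕₚ.n<1+n K) K<n) G G-vanish) (plus-ok (mult-ok cT (gens true (suc K))) (mult-ok cF (gens false (suc K)))))
    where
    open QS
    qT = quotient (F (suc K) true) (value n true (suc K) (suc K) true) (value-diagonal n K true K<n)
    qF = quotient (F (suc K) false) (value n false (suc K) (suc K) false) (value-diagonal n K false K<n)
    cT = proj₁ qT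
    cF = proj₁ qF
    V : ℕ → Bool → ℚ
    V r c = cT *q value n true (suc K) r c +q cF *q value n false (suc K) r c
    G : ℕ → Bool → ℚ
    G r c = F r c +q -q 1ℚ *q V r c
    V-diagonal : ∀ c → V (suc K) c ≡ F (suc K) c
    V-diagonal true  = trans (cong₂ _+q_ (proj₂ qT) (x*0 cF (value-other n K true K<n))) (ℚₚ.+-identityʳ _)
    V-diagonal false = trans (cong₂ _+q_ (x*0 cT (value-other n K false K<n)) (proj₂ qF)) (ℚₚ.+-identityˡ _)
    G-vanish : ∀ r c → K < r → r < n → G r c ≡ 0ℚ
    G-vanish (suc r) c (s≤s K≤r) r<n with ℕₚ.m≤n⇒m<n∨m≡n K≤r
    ... | inj₁ K<r = trans (cong₂ (λ x y → x +q -q 1ℚ *q y) (z (suc r) c (s≤s K<r) r<n)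
        (0+0 (x*0 cT (value-vanish n true (suc K) r c (s≤s K<r) r<n)) (x*0 cF (value-vanish n false (suc K) r c (s≤s K<r) r<n)))) refl
    ... | inj₂ refl = trans (cong (λ y → F (suc K) c +q -q 1ℚ *q y) (V-diagonal c)) (solve 1 (λ x → x :+ :- con 1ℚ :* x := con 0ℚ) refl (F (suc K) c))

  spanned : ∀ (F : ℕ → Bool → ℚ) → Good (λ σ → F (runs σ) (firstAsc σ))
  spanned F = spanned-up-to (pred n) (pred-< n≥2) F (λ r c l l' → ⊥-elim (ℕₚ.<⇒≱ l (pred-mono l')))
    where
    pred-< : ∀ {n} → 2 ≤ n → pred n < n
    pred-< (s≤s _) = ℕₚ.≤-refl
    pred-mono : ∀ {r n} → r < n → r ≤ pred n
    pred-mono (s≤s l) = l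

-- Membership in 𝒲ₙ^±

Rep-sum : ∀ {A : Set} {n} (g : A → GA) (f : A → Fn) → (∀ k → Rep n (g k) (f k)) → ∀ ks → Rep n (sumGA (map g ks)) (λ σ → ∑ ks (λ k → f k σ))
Rep-sum g f r []       = Rep-zero
Rep-sum g f r (k ∷ ks) = Rep-add (r k) (Rep-sum g f r ks)

combination-Rep : ∀ n → 2 ≤ n → ∀ (F : ℕ → Bool → ℚ) →
  Rep n (sumGA (map (λ k → addGA (scaleGA (F k true) (Wk true k n)) (scaleGA (F k false) (Wk false k n))) (map suc (upTo (n ∸ 1)))))
    (λ σ → F (runs σ) (firstAsc σ))
combination-Rep n n≥2 F = Rep-ext pick
  (Rep-sum _ (λ k σ → F k true *q ind ((runs σ ≡ᵇ k) ∧ eqB (firstAsc σ) true) +q F k false *q ind ((runs σ ≡ᵇ k) ∧ eqB (firstAsc σ) false))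
    (λ k → Rep-add (Rep-scale (F k true) (filter-Rep n _)) (Rep-scale (F k false) (filter-Rep n _))) (map suc (upTo (n ∸ 1))))
  where
  term : ∀ e c k → F k true *q ind (e ∧ eqB c true) +q F k false *q ind (e ∧ eqB c false) ≡ ind e *q F k c
  term true  true  k = solve 2 (λ x y → x :* con 1ℚ :+ y :* con 0ℚ := con 1ℚ :* x) refl (F k true) (F k false)
    where open QS
  term true  false k = solve 2 (λ x y → x :* con 0ℚ :+ y :* con 1ℚ := con 1ℚ :* y) refl (F k true) (F k false)
    where open QS
  term false c     k = solve 3 (λ x y z → x :* con 0ℚ :+ y :* con 0ℚ := con 0ℚ :* z) refl (F k true) (F k false) (F k c)
    where open QS
  pick : ∀ σ → IsPerm n σ →
    ∑ (map suc (upTo (n ∸ 1))) (λ k → F k true *q ind ((runs σ ≡ᵇ k) ∧ eqB (firstAsc σ) true) +q F k false *q ind ((runs σ ≡ᵇ k) ∧ eqB (firstAsc σ) false))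
      ≡ F (runs σ) (firstAsc σ)
  pick σ p = trans (∑-map suc (upTo (n ∸ 1)) _) (trans (∑-upTo (n ∸ 1) _) (trans
    (∑<-cong (n ∸ 1) (λ i _ → trans (term (runs σ ≡ᵇ suc i) (firstAsc σ) (suc i)) (cong (λ b → ind b *q F (suc i) (firstAsc σ)) (≡ᵇ-sym (changes (dirs σ)) i))))
    (∑<-pick (n ∸ 1) (changes (dirs σ)) (λ i → F (suc i) (firstAsc σ)) (pred-mono (runs-< n σ n≥2 p)))))
    where
    pred-mono : ∀ {r n} → suc r < n → r < n ∸ 1
    pred-mono (s≤s l) = l

byRuns : (ℕ → ℚ) → (ℕ → ℚ) → ℕ → Bool → ℚ
byRuns a b k true  = a k
byRuns a b k false = b k

InW⇒Rep : ∀ {n x} → 2 ≤ n → InW n x → Σ (ℕ → Bool → ℚ) λ F → Rep n x (λ σ → F (runs σ) (firstAsc σ))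
InW⇒Rep n≥2 (a , b , e) = byRuns a b , Rep-≈ e (combination-Rep _ n≥2 (byRuns a b))

Rep⇒InW : ∀ {n x} → 2 ≤ n → (F : ℕ → Bool → ℚ) → Rep n x (λ σ → F (runs σ) (firstAsc σ)) → InW n x
Rep⇒InW {n} n≥2 F r = (λ k → F k true) , (λ k → F k false) , Rep⇒≈ r (combination-Rep n n≥2 F)

-- Coefficients at the identity permutation

U : List Bool → ℕ → ℕ
U ε zero    = 1
U ε (suc m) = Nf ε (replicate m true)

-- At identity permutations a factor V_1^+ acts as 1/(1 - t); a factor V_1^- acts as 1 + t
-- (`U-desc`).
U-asc : ∀ ε n → U (true ∷ ε) (suc n) ≡ U ε (suc n) + U (true ∷ ε) n
U-asc ε zero    = ℕₚ.+-comm 1 (U ε 1)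
U-asc ε (suc n) = trans (ℕₚ.+-comm (Kf true ε (replicate (suc n) true)) (U ε (suc (suc n))))
  (cong (λ x → U ε (suc (suc n)) + (x + Nf ε (replicate n true))) (ℕₚ.+-identityʳ (Kf true ε (replicate n true))))

U-desc : ∀ ε n → U (false ∷ ε) (suc n) ≡ U ε (suc n) + U ε n
U-desc ε zero    = ℕₚ.+-comm 1 (U ε 1)
U-desc ε (suc n) = ℕₚ.+-comm (Nf ε (replicate n true)) (U ε (suc (suc n)))

-- Coefficient form of (1 - t²) q′ = (x + shift · t) q with q(0) = 1, arranged so that only natural
-- numbers occur.
record Recurrence (x shift : ℕ) (q : ℕ → ℕ) : Set where
  field
    at-0 : q 0 ≡ 1
    at-1 : q 1 ≡ x
    next : ∀ n → suc (suc n) * q (suc (suc n)) ≡ x * q (suc n) + (shift + n) * q n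
open Recurrence

-- With Q = ((1+t)/(1−t))^(x/2) the three recurrences say (1−t²) Q′ = x Q, and likewise for Q/√(1−t²) and Q√(1−t²).
odd-from-even : ∀ {x q a} → Recurrence x 0 q → a 0 ≡ 1 → (∀ n → a (suc n) ≡ q (suc n) + a n) → Recurrence (suc x) 1 a
odd-from-even {x} {q} {a} R a0 as = record { at-0 = a0 ; at-1 = a1 ; next = st }
  where
  open ≡-Reasoning
  open NS
  a1 : a 1 ≡ suc x
  a1 = trans (as 0) (trans (cong₂ _+_ (at-1 R) a0) (ℕₚ.+-comm x 1))
  st : ∀ n → suc (suc n) * a (suc (suc n)) ≡ suc x * a (suc n) + (1 + n) * a n
  st zero = begin
    2 * a 2                              ≡⟨ cong (2 *_) (as 1) ⟩
    2 * (q 2 + a 1)                      ≡⟨ solve 2 (λ q a → con 2 :* (q :+ a) := con 2 :* q :+ (a :+ a)) refl (q 2) (a 1) ⟩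
    2 * q 2 + (a 1 + a 1)                ≡⟨ cong₂ (λ y z → y + (a 1 + z)) (trans (next R 0) (cong (λ y → x * q 1 + (0 + 0) * y) (at-0 R))) (trans (as 0) (cong (λ z → q 1 + z) a0)) ⟩
    (x * q 1 + 0) + (a 1 + (q 1 + 1))    ≡⟨ cong (λ y → (x * q 1 + 0) + (a 1 + (y + 1))) (at-1 R) ⟩
    (x * q 1 + 0) + (a 1 + (x + 1))      ≡⟨ solve 3 (λ x q a → (x :* q :+ con 0) :+ (a :+ (x :+ con 1)) := a :+ x :* (q :+ con 1) :+ con 1) refl x (q 1) (a 1) ⟩
    a 1 + x * (q 1 + 1) + 1              ≡⟨ cong₂ (λ y z → a 1 + x * y + z) (sym (trans (as 0) (cong (λ z → q 1 + z) a0))) (sym (trans (ℕₚ.+-identityʳ (a 0)) a0)) ⟩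
    suc x * a 1 + 1 * a 0 ∎
  st (suc n) = begin
    m * a m'                                        ≡⟨ cong (m *_) (as (suc (suc n))) ⟩
    m * (q m' + a (suc (suc n)))                    ≡⟨ solve 3 (λ n q a → (con 3 :+ n) :* (q :+ a) := (con 3 :+ n) :* q :+ (a :+ (con 2 :+ n) :* a)) refl n (q m') (a (suc (suc n))) ⟩
    m * q m' + (a₂ + suc (suc n) * a₂)              ≡⟨ cong₂ (λ y z → y + (a₂ + z)) (next R (suc n)) (st n) ⟩
    (x * q (suc (suc n)) + suc n * q (suc n)) + (a₂ + (suc x * a₁ + suc n * a n))
      ≡⟨ solve 7 (λ x n q₂ q₁ a₂ a₁ a₀ → (x :* q₂ :+ (con 1 :+ n) :* q₁) :+ (a₂ :+ ((con 1 :+ x) :* a₁ :+ (con 1 :+ n) :* a₀))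
           := a₂ :+ x :* (q₂ :+ a₁) :+ (a₁ :+ (con 1 :+ n) :* (q₁ :+ a₀))) refl x n (q (suc (suc n))) (q (suc n)) a₂ a₁ (a n) ⟩
    a₂ + x * (q (suc (suc n)) + a₁) + (a₁ + suc n * (q (suc n) + a n))
      ≡⟨ cong₂ (λ y z → a₂ + x * y + (a₁ + suc n * z)) (sym (as (suc n))) (sym (as n)) ⟩
    suc x * a₂ + (1 + suc n) * a₁ ∎
    where
    m = suc (suc (suc n))
    m' = suc (suc (suc n))
    a₂ = a (suc (suc n))
    a₁ = a (suc n)

even-from-odd : ∀ {x a q} → Recurrence x 1 a → q 0 ≡ 1 → (∀ n → q (suc n) ≡ a (suc n) + a n) → Recurrence (suc x) 0 q
even-from-odd {x} {a} {q} R q0 qs = record { at-0 = q0 ; at-1 = trans (qs 0) (trans (cong₂ _+_ (at-1 R) (at-0 R)) (ℕₚ.+-comm x 1)) ; next = st }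
  where
  open ≡-Reasoning
  open NS
  st : ∀ n → suc (suc n) * q (suc (suc n)) ≡ suc x * q (suc n) + (0 + n) * q n
  st zero = begin
    2 * q 2                              ≡⟨ cong (2 *_) (qs 1) ⟩
    2 * (a 2 + a 1)                      ≡⟨ solve 2 (λ p r → con 2 :* (p :+ r) := con 2 :* p :+ (r :+ r)) refl (a 2) (a 1) ⟩
    2 * a 2 + (a 1 + a 1)                ≡⟨ cong₂ (λ y z → y + (a 1 + z)) (next R 0) (at-1 R) ⟩
    (x * a 1 + 1 * a 0) + (a 1 + x)      ≡⟨ cong (λ y → (x * a 1 + 1 * y) + (a 1 + x)) (at-0 R) ⟩
    (x * a 1 + 1) + (a 1 + x)            ≡⟨ solve 2 (λ x a → (x :* a :+ con 1) :+ (a :+ x) := (con 1 :+ x) :* (a :+ con 1) :+ con 0) refl x (a 1) ⟩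
    suc x * (a 1 + 1) + 0                ≡⟨ cong (λ y → suc x * (a 1 + y) + 0) (sym (at-0 R)) ⟩
    suc x * (a 1 + a 0) + 0              ≡⟨ cong (λ y → suc x * y + 0) (sym (qs 0)) ⟩
    suc x * q 1 + 0 ∎
  st (suc n) = begin
    m * q m                                         ≡⟨ cong (m *_) (qs (suc (suc n))) ⟩
    m * (a m + a₂)                                  ≡⟨ solve 3 (λ n q a → (con 3 :+ n) :* (q :+ a) := (con 3 :+ n) :* q :+ (a :+ (con 2 :+ n) :* a)) refl n (a m) a₂ ⟩
    m * a m + (a₂ + suc (suc n) * a₂)               ≡⟨ cong₂ (λ y z → y + (a₂ + z)) (next R (suc n)) (next R n) ⟩
    (x * a₂ + (1 + suc n) * a₁) + (a₂ + (x * a₁ + (1 + n) * a n))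
      ≡⟨ solve 5 (λ x n a₂ a₁ a₀ → (x :* a₂ :+ (con 2 :+ n) :* a₁) :+ (a₂ :+ (x :* a₁ :+ (con 1 :+ n) :* a₀))
           := (con 1 :+ x) :* (a₂ :+ a₁) :+ (con 1 :+ n) :* (a₁ :+ a₀)) refl x n a₂ a₁ (a n) ⟩
    suc x * (a₂ + a₁) + suc n * (a₁ + a n)          ≡⟨ cong₂ (λ y z → suc x * y + suc n * z) (sym (qs (suc n))) (sym (qs n)) ⟩
    suc x * q (suc (suc n)) + (0 + suc n) * q (suc n) ∎
    where
    m = suc (suc (suc n))
    a₂ = a (suc (suc n))
    a₁ = a (suc n)

-- For even x both starting signs give the same number of factors 1/(1 - t) and 1 + t.
record EvenFacts (x : ℕ) : Set where
  field
    symmetric : ∀ n → U (alt true x) n ≡ U (alt false x) n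
    recur     : Recurrence x 0 (U (alt true x))

-- For odd x the additional factor is 1/(1 - t) or 1 + t. The two functions differ by the factor 1 -
-- t², and `shifted` is this relation coefficientwise.
record OddFacts (x : ℕ) : Set where
  field
    shifted : ∀ n → U (alt false x) (suc (suc n)) + U (alt true x) n ≡ U (alt true x) (suc (suc n))
    agree-1 : U (alt false x) 1 ≡ U (alt true x) 1
    recur   : Recurrence x 1 (U (alt true x))

even⇒odd : ∀ {x} → EvenFacts x → OddFacts (suc x)
even⇒odd {x} E = record
  { shifted = λ n → trans (cong₂ _+_ (cs (suc n)) refl) (trans (ℕₚ.+-assoc (q (suc (suc n))) (q (suc n)) (a n))
      (trans (cong (λ y → q (suc (suc n)) + y) (sym (as n))) (sym (as (suc n)))))
  ; agree-1 = trans (cs 0) (sym (as 0))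
  ; recur = odd-from-even (EvenFacts.recur E) refl as }
  where
  q = U (alt true x)
  a = U (alt true (suc x))
  as : ∀ n → a (suc n) ≡ q (suc n) + a n
  as n = trans (U-asc (alt false x) n) (cong (_+ a n) (sym (EvenFacts.symmetric E (suc n))))
  cs : ∀ n → U (alt false (suc x)) (suc n) ≡ q (suc n) + q n
  cs n = U-desc (alt true x) n

odd⇒even : ∀ {x} → OddFacts x → EvenFacts (suc x)
odd⇒even {x} O = record { symmetric = sm ; recur = even-from-odd (OddFacts.recur O) refl (λ n → trans (sm (suc n)) (U-desc (alt true x) n)) }
  where
  sm : ∀ n → U (alt true (suc x)) n ≡ U (alt false (suc x)) n
  sm zero          = refl
  sm (suc zero)    = trans (U-asc (alt false x) 0) (trans (cong (_+ 1) (OddFacts.agree-1 O)) (sym (U-desc (alt true x) 0)))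
  sm (suc (suc n)) = trans (U-asc (alt false x) (suc n)) (trans (cong (λ y → U (alt false x) (suc (suc n)) + y) (trans (sm (suc n)) (U-desc (alt true x) n)))
    (trans (solve 3 (λ c b a → c :+ (b :+ a) := (c :+ a) :+ b) refl (U (alt false x) (suc (suc n))) (U (alt true x) (suc n)) (U (alt true x) n))
      (trans (cong (_+ U (alt true x) (suc n)) (OddFacts.shifted O n)) (sym (U-desc (alt true x) (suc n))))))
    where open NS

even-facts : ∀ j → EvenFacts (dbl j)
even-facts zero    = record { symmetric = λ { zero → refl ; (suc n) → refl } ; recur = record { at-0 = refl ; at-1 = refl ; next = λ { zero → refl ; (suc n) → trans (ℕₚ.*-zeroʳ n) (sym (ℕₚ.*-zeroʳ n)) } } }
even-facts (suc j) = odd⇒even (even⇒odd (even-facts j))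

odd-facts : ∀ j → OddFacts (suc (dbl j))
odd-facts j = even⇒odd (even-facts j)

dirs-applyUpTo : ∀ f m → (∀ i → (f i <ᵇ f (suc i)) ≡ true) → dirs (applyUpTo f (suc m)) ≡ replicate m true
dirs-applyUpTo f zero    h = refl
dirs-applyUpTo f (suc m) h = cong₂ _∷_ (h 0) (dirs-applyUpTo (f ∘ suc) m (h ∘ suc))

N-identity : ∀ ε n → N ε (upTo n) ≡ ι (U ε n)
N-identity ε zero    = N-empty ε
N-identity ε (suc m) = trans (N-dirs ε 0 (applyUpTo suc m) (Uniqueₚ.upTo⁺ (suc m))) (cong (λ b → ι (Nf ε b)) (dirs-applyUpTo (λ i → i) m (λ i → <ᵇ-true (ℕₚ.n<1+n i))))

-- κ k s i n is the coefficient of xⁱ in the polynomial that U (alt s x) n is in x (even x for k true, odd x for k false).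
κ : Bool → Bool → ℕ → ℕ → ℚ
κ k s i n = Kc k s i (upTo n)

κ-eval : ∀ k s j d n → n < d → ι (U (alt s (point k j)) n) ≡ evalP d (λ i → κ k s i n) (ι (point k j))
κ-eval k s j d n l = trans (sym (N-identity (alt s (point k j)) n)) (N-eval k s j d (upTo n) (subst (_< d) (sym (Lₚ.length-upTo n)) l))

Kc-low : ∀ k s i w → length w < i → Kc k s i w ≡ 0ℚ
Kc-low true  = Ic-low
Kc-low false = Jc-low

Kc-top : ∀ k s w → Kc k s (length w) w ≡ invFact (length w)
Kc-top true  = Ic-top
Kc-top false = Jc-top

Kc-parity : ∀ k s i w → sameParity i (length w) ≡ false → Kc k s i w ≡ 0ℚ
Kc-parity true  = Ic-parity
Kc-parity false = Jc-parity

κ-low : ∀ k s i n → n < i → κ k s i n ≡ 0ℚ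
κ-low k s i n l = Kc-low k s i (upTo n) (subst (_< i) (sym (Lₚ.length-upTo n)) l)

-- Turns a recurrence valid at the sample points into one between coefficients. Multiplication by
-- the variable moves the index, so `Q i` faces `P (suc i)`.
κ-extract : ∀ k (P Q R : ℕ → ℚ) A B d → (∀ i → d < i → P i ≡ 0ℚ) → (∀ i → d ≤ i → Q i ≡ 0ℚ) → (∀ i → d < i → R i ≡ 0ℚ) →
  (∀ j → A *q evalP (suc d) P (ι (point k j)) ≡ ι (point k j) *q evalP d Q (ι (point k j)) +q B *q evalP (suc d) R (ι (point k j))) →
  (A *q P 0 ≡ B *q R 0) × (∀ i → A *q P (suc i) ≡ Q i +q B *q R (suc i))
κ-extract k P Q R A B d Pv Qv Rv h = coef 0 (s≤s z≤n) , λ i → high i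
  where
  S : ℕ → ℚ
  S zero    = B *q R 0
  S (suc i) = Q i +q B *q R (suc i)
  S-eval : ∀ x → evalP (suc d) S x ≡ x *q evalP d Q x +q B *q evalP (suc d) R x
  S-eval x = trans (cong (λ y → B *q R 0 +q x *q y) (trans (evalP-+ d Q (λ i → B *q R (suc i)) x) (cong (evalP d Q x +q_) (evalP-* d B (R ∘ suc) x))))
    (solve 5 (λ b r x q e → b :* r :+ x :* (q :+ b :* e) := x :* q :+ b :* (r :+ x :* e)) refl B (R 0) x (evalP d Q x) (evalP d (R ∘ suc) x))
    where open QS
  coef : ∀ i → i < suc d → A *q P i ≡ S i
  coef = poly-unique (suc d) (λ i → A *q P i) S (ι ∘ point k) (point-injective k)
    (λ j → trans (evalP-* (suc d) A P (ι (point k j))) (trans (h j) (sym (S-eval (ι (point k j))))))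
  high : ∀ i → A *q P (suc i) ≡ Q i +q B *q R (suc i)
  high i with ℕₚ.<-≤-connex i d
  ... | inj₁ l = coef (suc i) (s≤s l)
  ... | inj₂ l = trans (x*0 A (Pv (suc i) (s≤s l))) (sym (0+0 (Qv i l) (x*0 B (Rv (suc i) (s≤s l)))))

+-nonNeg : ∀ {p q} → 0ℚ ℚ.≤ p → 0ℚ ℚ.≤ q → 0ℚ ℚ.≤ p +q q
+-nonNeg {p} {q} hp hq = subst (ℚ._≤ p +q q) (ℚₚ.+-identityˡ 0ℚ) (ℚₚ.+-mono-≤ hp hq)

nonNeg+pos : ∀ {p q} → 0ℚ ℚ.≤ p → 0ℚ ℚ.< q → 0ℚ ℚ.< p +q q
nonNeg+pos {p} {q} hp hq = subst (ℚ._< p +q q) (ℚₚ.+-identityˡ 0ℚ) (ℚₚ.+-mono-≤-< hp hq)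

*-nonNeg : ∀ {p q} → 0ℚ ℚ.≤ p → 0ℚ ℚ.≤ q → 0ℚ ℚ.≤ p *q q
*-nonNeg {p} {q} hp hq = ℚₚ.nonNegative⁻¹ (p *q q) {{ℚₚ.nonNeg*nonNeg⇒nonNeg p {{ℚ.nonNegative hp}} q {{ℚ.nonNegative hq}}}}

*-pos : ∀ {p q} → 0ℚ ℚ.< p → 0ℚ ℚ.< q → 0ℚ ℚ.< p *q q
*-pos {p} {q} hp hq = ℚₚ.positive⁻¹ (p *q q) {{ℚₚ.pos*pos⇒pos p {{ℚ.positive hp}} q {{ℚ.positive hq}}}}

ι-positive : ∀ {n} → 1 ≤ n → 0ℚ ℚ.< ι n
ι-positive {suc n} _ = subst (0ℚ ℚ.<_) (ℚₚ.+-comm (ι n) 1ℚ) (nonNeg+pos (ι-nonNeg n) (ℚₚ.positive⁻¹ 1ℚ))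

nonNeg-div : ∀ n {y} → 0ℚ ℚ.≤ ι (suc n) *q y → 0ℚ ℚ.≤ y
nonNeg-div n {y} h = ℚₚ.*-cancelˡ-≤-pos (ι (suc n)) {{ℚ.positive (ι-positive {suc n} (s≤s z≤n))}} (subst (ℚ._≤ ι (suc n) *q y) (sym (ℚₚ.*-zeroʳ (ι (suc n)))) h)

pos-div : ∀ n {y} → 0ℚ ℚ.< ι (suc n) *q y → 0ℚ ℚ.< y
pos-div n {y} h = ℚₚ.*-cancelˡ-<-nonNeg (ι (suc n)) {{ℚ.nonNegative (ι-nonNeg (suc n))}} (subst (ℚ._< ι (suc n) *q y) (sym (ℚₚ.*-zeroʳ (ι (suc n)))) h)

invFact-positive : ∀ n → 0ℚ ℚ.< invFact n
invFact-positive zero    = ℚₚ.positive⁻¹ 1ℚ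
invFact-positive (suc n) = pos-div n (subst (0ℚ ℚ.<_) (sym (trans (solve 3 (λ m f c → m :* (f :* c) := (c :* m) :* f) refl (ι (suc n)) (invFact n) (+ 1 / suc n))
  (trans (cong (_*q invFact n) (recip-ι n)) (ℚₚ.*-identityˡ (invFact n))))) (invFact-positive n))
  where open QS

prev : (ℕ → ℚ) → ℕ → ℚ
prev f zero    = 0ℚ
prev f (suc i) = f i

prev-nonNeg : ∀ {f} i → (∀ i → 0ℚ ℚ.≤ f i) → 0ℚ ℚ.≤ prev f i
prev-nonNeg zero    h = ℚₚ.≤-refl
prev-nonNeg (suc i) h = h i

κ-top : ∀ k s i → κ k s i i ≡ invFact i
κ-top k s i = subst (λ j → Kc k s j (upTo i) ≡ invFact j) (Lₚ.length-upTo i) (Kc-top k s (upTo i))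

κ-nonNeg-0 : ∀ k s i → 0ℚ ℚ.≤ κ k s i 0
κ-nonNeg-0 k s zero    = ℚₚ.<⇒≤ (subst (0ℚ ℚ.<_) (sym (κ-top k s 0)) (invFact-positive 0))
κ-nonNeg-0 k s (suc i) = ℚₚ.≤-reflexive (sym (κ-low k s (suc i) 0 (s≤s z≤n)))

κ-nonNeg-1 : ∀ k s i → 0ℚ ℚ.≤ κ k s i 1
κ-nonNeg-1 k s zero          = ℚₚ.≤-reflexive (sym (Kc-parity k s 0 (upTo 1) refl))
κ-nonNeg-1 k s (suc zero)    = ℚₚ.<⇒≤ (subst (0ℚ ℚ.<_) (sym (κ-top k s 1)) (invFact-positive 1))
κ-nonNeg-1 k s (suc (suc i)) = ℚₚ.≤-reflexive (sym (κ-low k s (suc (suc i)) 1 (s≤s (s≤s z≤n))))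

module _ (k s : Bool) (shift : ℕ) (R : ∀ j → Recurrence (point k j) shift (U (alt s (point k j)))) where

  private
    extracted : ∀ n → (ι (suc (suc n)) *q κ k s 0 (suc (suc n)) ≡ ι (shift + n) *q κ k s 0 n) ×
      (∀ i → ι (suc (suc n)) *q κ k s (suc i) (suc (suc n)) ≡ κ k s i (suc n) +q ι (shift + n) *q κ k s (suc i) n)
    extracted n = κ-extract k (λ i → κ k s i (suc (suc n))) (λ i → κ k s i (suc n)) (λ i → κ k s i n) (ι (suc (suc n))) (ι (shift + n)) (suc (suc n))
      (λ i → κ-low k s i (suc (suc n))) (λ i l → κ-low k s i (suc n) l) (λ i l → κ-low k s i n (ℕₚ.<-trans (ℕₚ.n<1+n n) (ℕₚ.<-trans (ℕₚ.n<1+n (suc n)) l)))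
      (λ j → begin
        ι (suc (suc n)) *q evalP (suc (suc (suc n))) (λ i → κ k s i (suc (suc n))) (ι (point k j))
          ≡⟨ cong (ι (suc (suc n)) *q_) (sym (κ-eval k s j (suc (suc (suc n))) (suc (suc n)) ℕₚ.≤-refl)) ⟩
        ι (suc (suc n)) *q ι (u j (suc (suc n)))
          ≡⟨ trans (sym (ι-* (suc (suc n)) (u j (suc (suc n))))) (cong ι (Recurrence.next (R j) n)) ⟩
        ι (point k j * u j (suc n) + (shift + n) * u j n)
          ≡⟨ trans (ι-+ (point k j * u j (suc n)) ((shift + n) * u j n)) (cong+ (ι-* (point k j) (u j (suc n))) (ι-* (shift + n) (u j n))) ⟩
        ι (point k j) *q ι (u j (suc n)) +q ι (shift + n) *q ι (u j n)
          ≡⟨ cong₂ (λ y z → ι (point k j) *q y +q ι (shift + n) *q z) (κ-eval k s j (suc (suc n)) (suc n) ℕₚ.≤-refl)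
               (κ-eval k s j (suc (suc (suc n))) n (ℕₚ.<-trans (ℕₚ.n<1+n n) (ℕₚ.<-trans (ℕₚ.n<1+n (suc n)) (ℕₚ.n<1+n (suc (suc n)))))) ⟩
        ι (point k j) *q evalP (suc (suc n)) (λ i → κ k s i (suc n)) (ι (point k j)) +q ι (shift + n) *q evalP (suc (suc (suc n))) (λ i → κ k s i n) (ι (point k j)) ∎)
      where
      open ≡-Reasoning
      u : ℕ → ℕ → ℕ
      u j = U (alt s (point k j))

  κ-step : ∀ i n → ι (suc (suc n)) *q κ k s i (suc (suc n)) ≡ prev (λ i → κ k s i (suc n)) i +q ι (shift + n) *q κ k s i n
  κ-step zero    n = trans (proj₁ (extracted n)) (sym (ℚₚ.+-identityˡ (ι (shift + n) *q κ k s 0 n)))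
  κ-step (suc i) n = proj₂ (extracted n) i

  κ-nonNeg : ∀ n i → 0ℚ ℚ.≤ κ k s i n
  κ-nonNeg zero          i = κ-nonNeg-0 k s i
  κ-nonNeg (suc zero)    i = κ-nonNeg-1 k s i
  κ-nonNeg (suc (suc n)) i = nonNeg-div (suc n) (subst (0ℚ ℚ.≤_) (sym (κ-step i n))
    (+-nonNeg (prev-nonNeg i (κ-nonNeg (suc n))) (*-nonNeg (ι-nonNeg (shift + n)) (κ-nonNeg n i))))

  -- Starts from the top coefficient 1/i! and raises the degree by two at a time. The condition
  -- excludes I_0, which vanishes in positive degree and is absent from the first family.
  κ-positive : ∀ t i → 1 ≤ shift + i → 0ℚ ℚ.< κ k s i (dbl t + i)
  κ-positive zero    i l = subst (0ℚ ℚ.<_) (sym (κ-top k s i)) (invFact-positive i)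
  κ-positive (suc t) i l = pos-div (suc (dbl t + i)) (subst (0ℚ ℚ.<_) (sym (κ-step i (dbl t + i)))
    (nonNeg+pos (prev-nonNeg i (κ-nonNeg (suc (dbl t + i)))) (*-pos (ι-positive (ℕₚ.≤-trans l (ℕₚ.+-monoʳ-≤ shift (ℕₚ.m≤n+m i (dbl t))))) (κ-positive t i l))))

Recurrence-ext : ∀ {x shift p q} → (∀ n → p n ≡ q n) → Recurrence x shift p → Recurrence x shift q
Recurrence-ext {x} {shift} e R = record
  { at-0 = trans (sym (e 0)) (at-0 R)
  ; at-1 = trans (sym (e 1)) (at-1 R)
  ; next = λ n → trans (cong (suc (suc n) *_) (sym (e (suc (suc n))))) (trans (next R n) (cong₂ (λ y z → x * y + (shift + n) * z) (e (suc n)) (e n))) }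

I-recurrence : ∀ s j → Recurrence (dbl j) 0 (U (alt s (dbl j)))
I-recurrence true  j = EvenFacts.recur (even-facts j)
I-recurrence false j = Recurrence-ext (EvenFacts.symmetric (even-facts j)) (EvenFacts.recur (even-facts j))

J-recurrence : ∀ j → Recurrence (suc (dbl j)) 1 (U (alt true (suc (dbl j))))
J-recurrence j = OddFacts.recur (odd-facts j)

κ-shift : ∀ k → (∀ j n → U (alt false (point k j)) (suc (suc n)) + U (alt true (point k j)) n ≡ U (alt true (point k j)) (suc (suc n))) →
  ∀ i n → κ k false i (suc (suc n)) +q κ k true i n ≡ κ k true i (suc (suc n))
κ-shift k h i n with ℕₚ.<-≤-connex (suc (suc n)) i
... | inj₁ l = trans (0+0 (κ-low k false i (suc (suc n)) l) (κ-low k true i n (ℕₚ.<-trans (ℕₚ.n<1+n n) (ℕₚ.<-trans (ℕₚ.n<1+n (suc n)) l)))) (sym (κ-low k true i (suc (suc n)) l))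
... | inj₂ l = poly-unique d (λ i → κ k false i (suc (suc n)) +q κ k true i n) (λ i → κ k true i (suc (suc n))) (ι ∘ point k) (point-injective k)
  (λ j → trans (evalP-+ d (λ i → κ k false i (suc (suc n))) (λ i → κ k true i n) (ι (point k j)))
    (trans (sym (cong+ (κ-eval k false j d (suc (suc n)) ℕₚ.≤-refl) (κ-eval k true j d n (ℕₚ.<-trans (ℕₚ.n<1+n n) (ℕₚ.<-trans (ℕₚ.n<1+n (suc n)) ℕₚ.≤-refl)))))
      (trans (sym (ι-+ (U (alt false (point k j)) (suc (suc n))) (U (alt true (point k j)) n)))
        (trans (cong ι (h j n)) (κ-eval k true j d (suc (suc n)) ℕₚ.≤-refl))))) i (s≤s l)
  where d = suc (suc (suc n))

κ-shifted : ∀ i n → κ false false i (suc (suc n)) +q κ false true i n ≡ κ false true i (suc (suc n))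
κ-shifted = κ-shift false (λ j → OddFacts.shifted (odd-facts j))

-- ½ Hc i is the coefficient function of the second family.
Hc : ℕ → Fn
Hc i w = (Jc true i w +q Jc false i w) +q -q 1ℚ *q (Ic true i w +q Ic false i w)

Hc-0 : ∀ i w → Jc true i w +q Jc false i w ≡ Ic true i w +q Ic false i w → Hc i w ≡ 0ℚ
Hc-0 i w e = trans (cong (_+q -q 1ℚ *q x) e) (solve 1 (λ x → x :+ :- con 1ℚ :* x := con 0ℚ) refl x)
  where
  open QS
  x = Ic true i w +q Ic false i w

Hc-parity : ∀ i w → sameParity i (length w) ≡ false → Hc i w ≡ 0ℚ
Hc-parity i w e = Hc-0 i w (trans (cong+ (Jc-parity true i w e) (Jc-parity false i w e)) (sym (cong+ (Ic-parity true i w e) (Ic-parity false i w e))))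

Hc-top : ∀ i w → length w ≡ i → Hc i w ≡ 0ℚ
Hc-top .(length w) w refl = Hc-0 (length w) w (trans (cong+ (Jc-top true w) (Jc-top false w)) (sym (cong+ (Ic-top true w) (Ic-top false w))))

Hc-subtop : ∀ i w → length w ≡ suc (suc i) → Hc i w ≡ 0ℚ
Hc-subtop .(length w) (a ∷ b ∷ w) refl = Hc-0 (length w) (a ∷ b ∷ w) (J+J≡I+I-subtop a b w)

Hc-low : ∀ i w → length w < i → Hc i w ≡ 0ℚ
Hc-low i w l = Hc-0 i w (trans (cong+ (Jc-low true i w l) (Jc-low false i w l)) (sym (cong+ (Ic-low true i w l) (Ic-low false i w l))))

-- A start value for the recurrence of `η`, as is `Hc-3`: every index has the wrong parity, is the
-- length or two less, or exceeds the length.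
Hc-2 : ∀ w → length w ≡ 2 → ∀ i → Hc i w ≡ 0ℚ
Hc-2 w e 0 = Hc-subtop 0 w e
Hc-2 w e 1 = Hc-parity 1 w (cong (sameParity 1) e)
Hc-2 w e 2 = Hc-top 2 w e
Hc-2 w e (suc (suc (suc i))) = Hc-low (suc (suc (suc i))) w (subst (_< suc (suc (suc i))) (sym e) (s≤s (s≤s (s≤s z≤n))))

Hc-3 : ∀ w → length w ≡ 3 → ∀ i → Hc i w ≡ 0ℚ
Hc-3 w e 0 = Hc-parity 0 w (cong (sameParity 0) e)
Hc-3 w e 1 = Hc-subtop 1 w e
Hc-3 w e 2 = Hc-parity 2 w (cong (sameParity 2) e)
Hc-3 w e 3 = Hc-top 3 w e
Hc-3 w e (suc (suc (suc (suc i)))) = Hc-low (suc (suc (suc (suc i)))) w (subst (_< suc (suc (suc (suc i)))) (sym e) (s≤s (s≤s (s≤s (s≤s z≤n)))))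

η : ℕ → ℕ → ℚ
η i n = Hc i (upTo n)

-- Let a and c belong to J⁺ and J⁻ and let H = a + c minus the two I terms. Since c = (1 - t²) a,
-- the differential equations combine to (1 - t²) H′ = xH + t(a - c) = xH + t³a. The last term
-- appears here as `κ false true i n` and forces positivity.
η-step : ∀ i n → ι (suc (suc (suc (suc n)))) *q η i (suc (suc (suc (suc n)))) ≡
  prev (λ i → η i (suc (suc (suc n)))) i +q (ι (suc (suc n)) *q η i (suc (suc n)) +q κ false true i n)
η-step i n = begin
  (1ℚ +q (1ℚ +q M)) *q ((a i n₄ +q c i n₄) +q -q 1ℚ *q (q i n₄ +q q' i n₄))
    ≡⟨ solve 7 (λ m a c q q' a₂ x → (con 1ℚ :+ (con 1ℚ :+ m)) :* ((a :+ c) :+ :- con 1ℚ :* (q :+ q')) :=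
         con 1ℚ :* ((con 1ℚ :+ (con 1ℚ :+ m)) :* a) :+ (con 1ℚ :+ (con 1ℚ :+ m)) :* (c :+ a₂) :+ :- ((con 1ℚ :+ (con 1ℚ :+ m)) :* a₂)
          :+ :- ((con 1ℚ :+ (con 1ℚ :+ m)) :* q :+ (con 1ℚ :+ (con 1ℚ :+ m)) :* q')) refl M (a i n₄) (c i n₄) (q i n₄) (q' i n₄) (a i n₂) (a i n) ⟩
  1ℚ *q ((1ℚ +q (1ℚ +q M)) *q a i n₄) +q (1ℚ +q (1ℚ +q M)) *q (c i n₄ +q a i n₂) +q -q ((1ℚ +q (1ℚ +q M)) *q a i n₂)
    +q -q ((1ℚ +q (1ℚ +q M)) *q q i n₄ +q (1ℚ +q (1ℚ +q M)) *q q' i n₄)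
    ≡⟨ cong₂ (λ y z → 1ℚ *q ((1ℚ +q (1ℚ +q M)) *q a i n₄) +q y +q -q ((1ℚ +q (1ℚ +q M)) *q a i n₂) +q -q z)
         (cong ((1ℚ +q (1ℚ +q M)) *q_) (κ-shifted i n₂)) (cong+ (κ-step true true 0 (I-recurrence true) i n₂) (κ-step true false 0 (I-recurrence false) i n₂)) ⟩
  1ℚ *q ((1ℚ +q (1ℚ +q M)) *q a i n₄) +q (1ℚ +q (1ℚ +q M)) *q a i n₄ +q -q ((1ℚ +q (1ℚ +q M)) *q a i n₂)
    +q -q ((pq +q M *q q i n₂) +q (pq' +q M *q q' i n₂))
    ≡⟨ cong (λ y → 1ℚ *q y +q y +q -q ((1ℚ +q (1ℚ +q M)) *q a i n₂) +q -q ((pq +q M *q q i n₂) +q (pq' +q M *q q' i n₂)))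
         (κ-step false true 1 J-recurrence i n₂) ⟩
  1ℚ *q (pa +q (1ℚ +q M) *q a i n₂) +q (pa +q (1ℚ +q M) *q a i n₂) +q -q ((1ℚ +q (1ℚ +q M)) *q a i n₂)
    +q -q ((pq +q M *q q i n₂) +q (pq' +q M *q q' i n₂))
    ≡⟨ solve 8 (λ m pa a₂ pq pq' q q' p → con 1ℚ :* (pa :+ (con 1ℚ :+ m) :* a₂) :+ (pa :+ (con 1ℚ :+ m) :* a₂) :+ :- ((con 1ℚ :+ (con 1ℚ :+ m)) :* a₂)
          :+ :- ((pq :+ m :* q) :+ (pq' :+ m :* q')) := (pa :+ pa :+ :- con 1ℚ :* (pq :+ pq')) :+ (m :* (a₂ :+ a₂ :+ :- con 1ℚ :* (q :+ q')) :+ :- (m :* a₂)))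
          refl M pa (a i n₂) pq pq' (q i n₂) (q' i n₂) pa ⟩
  (pa +q pa +q -q 1ℚ *q (pq +q pq')) +q (M *q (a i n₂ +q a i n₂ +q -q 1ℚ *q (q i n₂ +q q' i n₂)) +q -q (M *q a i n₂))
    ≡⟨ cong (λ y → (pa +q pa +q -q 1ℚ *q (pq +q pq')) +q (M *q (a i n₂ +q a i n₂ +q -q 1ℚ *q (q i n₂ +q q' i n₂)) +q -q y)) (κ-step false true 1 J-recurrence i n) ⟩
  (pa +q pa +q -q 1ℚ *q (pq +q pq')) +q (M *q (a i n₂ +q a i n₂ +q -q 1ℚ *q (q i n₂ +q q' i n₂)) +q -q (pa₁ +q (1ℚ +q ι n) *q a i n))
    ≡⟨ cong₂ (λ y z → (pa +q y +q -q 1ℚ *q (pq +q pq')) +q (M *q (a i n₂ +q z +q -q 1ℚ *q (q i n₂ +q q' i n₂)) +q -q (pa₁ +q (1ℚ +q ι n) *q a i n)))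
         (sym (prev-shifted i)) (sym (κ-shifted i n)) ⟩
  (pa +q (pc +q pa₁) +q -q 1ℚ *q (pq +q pq')) +q (M *q (a i n₂ +q (c i n₂ +q a i n) +q -q 1ℚ *q (q i n₂ +q q' i n₂)) +q -q (pa₁ +q (1ℚ +q ι n) *q a i n))
    ≡⟨ solve 11 (λ n pa pc pa₁ pq pq' a₂ c q q' a₀ → (pa :+ (pc :+ pa₁) :+ :- con 1ℚ :* (pq :+ pq')) :+ ((con 1ℚ :+ (con 1ℚ :+ n)) :* (a₂ :+ (c :+ a₀) :+ :- con 1ℚ :* (q :+ q')) :+ :- (pa₁ :+ (con 1ℚ :+ n) :* a₀))
          := (pa :+ pc :+ :- con 1ℚ :* (pq :+ pq')) :+ ((con 1ℚ :+ (con 1ℚ :+ n)) :* ((a₂ :+ c) :+ :- con 1ℚ :* (q :+ q')) :+ a₀)) refl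
          (ι n) pa pc pa₁ pq pq' (a i n₂) (c i n₂) (q i n₂) (q' i n₂) (a i n) ⟩
  (pa +q pc +q -q 1ℚ *q (pq +q pq')) +q (M *q η i n₂ +q a i n)
    ≡⟨ cong (_+q (M *q η i n₂ +q a i n)) (prev-η i) ⟩
  prev (λ i → η i n₃) i +q (M *q η i n₂ +q a i n) ∎
  where
  open QS
  open ≡-Reasoning
  n₂ = suc (suc n)
  n₃ = suc n₂
  n₄ = suc n₃
  M = ι n₂
  a = κ false true
  c = κ false false
  q = κ true true
  q' = κ true false
  pa = prev (λ i → a i n₃) i
  pc = prev (λ i → c i n₃) i
  pa₁ = prev (λ i → a i (suc n)) i
  pq = prev (λ i → q i n₃) i
  pq' = prev (λ i → q' i n₃) i
  prev-shifted : ∀ i → prev (λ i → c i n₃) i +q prev (λ i → a i (suc n)) i ≡ prev (λ i → a i n₃) i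
  prev-shifted zero    = refl
  prev-shifted (suc i) = κ-shifted i (suc n)
  prev-η : ∀ i → prev (λ i → a i n₃) i +q prev (λ i → c i n₃) i +q -q 1ℚ *q (prev (λ i → q i n₃) i +q prev (λ i → q' i n₃) i) ≡ prev (λ i → η i n₃) i
  prev-η zero    = refl
  prev-η (suc i) = refl

η-nonNeg : ∀ n i → 0ℚ ℚ.≤ η i (suc (suc n))
η-nonNeg zero          i = ℚₚ.≤-reflexive (sym (Hc-2 (upTo 2) refl i))
η-nonNeg (suc zero)    i = ℚₚ.≤-reflexive (sym (Hc-3 (upTo 3) refl i))
η-nonNeg (suc (suc n)) i = nonNeg-div (suc (suc (suc n))) (subst (0ℚ ℚ.≤_) (sym (η-step i n))
  (+-nonNeg (prev-nonNeg i (η-nonNeg (suc n))) (+-nonNeg (*-nonNeg (ι-nonNeg (suc (suc n))) (η-nonNeg n i)) (κ-nonNeg false true 1 J-recurrence n i))))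

-- From degree i + 4 on, the positive coefficient of J⁺ four degrees lower enters the recurrence.
η-positive : ∀ t i → 0ℚ ℚ.< η i (dbl (suc (suc t)) + i)
η-positive t i = pos-div (suc (suc (suc n))) (subst (0ℚ ℚ.<_) (sym (η-step i n))
  (nonNeg+pos (prev-nonNeg i (η-nonNeg (suc n))) (nonNeg+pos (*-nonNeg (ι-nonNeg (suc (suc n))) (η-nonNeg n i)) (κ-positive false true 1 J-recurrence t i (s≤s z≤n)))))
  where n = dbl t + i

-- The algebra spanned by I⁺, I⁻, J⁺, J⁻ in a fixed degree

record Vec4 : Set where
  constructor vec4
  field
    i⁺ i⁻ j⁺ j⁻ : ℚ

-- Multiplication in the basis I⁺, I⁻, J⁺, J⁻ according to `prod-K`. The sum of all coefficients of
-- the right factor appears because I⁺ and I⁻ on the left absorb it.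
_⊗_ : Vec4 → Vec4 → Vec4
vec4 a b c d ⊗ vec4 a' b' c' d' = vec4
  (a *q ((a' +q b') +q (c' +q d')) +q (c *q a' +q d *q b'))
  (b *q ((a' +q b') +q (c' +q d')) +q (c *q b' +q d *q a'))
  (c *q c' +q d *q d')
  (c *q d' +q d *q c')

scale4 : ℚ → Vec4 → Vec4
scale4 k (vec4 a b c d) = vec4 (k *q a) (k *q b) (k *q c) (k *q d)

comb4 : Vec4 → ℕ → Fn
comb4 (vec4 a b c d) i σ = (a *q Kc true true i σ +q b *q Kc true false i σ) +q (c *q Kc false true i σ +q d *q Kc false false i σ)

comb4-scale : ∀ k v i σ → comb4 (scale4 k v) i σ ≡ k *q comb4 v i σ
comb4-scale k (vec4 a b c d) i σ = solve 9 (λ k a b c d p q r s → (k :* a :* p :+ k :* b :* q) :+ (k :* c :* r :+ k :* d :* s) := k :* ((a :* p :+ b :* q) :+ (c :* r :+ d :* s))) refl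
  k a b c d (Kc true true i σ) (Kc true false i σ) (Kc false true i σ) (Kc false false i σ)
  where open QS

prod-4ˡ : ∀ n a b c d (p q r s g : Fn) σ → prod n (λ u → (a *q p u +q b *q q u) +q (c *q r u +q d *q s u)) g σ ≡
  (a *q prod n p g σ +q b *q prod n q g σ) +q (c *q prod n r g σ +q d *q prod n s g σ)
prod-4ˡ n a b c d p q r s g σ = trans (prod-+ˡ n (λ u → a *q p u +q b *q q u) (λ u → c *q r u +q d *q s u) g σ) (cong+
  (trans (prod-+ˡ n (λ u → a *q p u) (λ u → b *q q u) g σ) (cong+ (prod-*ˡ n a p g σ) (prod-*ˡ n b q g σ)))
  (trans (prod-+ˡ n (λ u → c *q r u) (λ u → d *q s u) g σ) (cong+ (prod-*ˡ n c r g σ) (prod-*ˡ n d s g σ))))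

prod-4ʳ : ∀ n a b c d (f p q r s : Fn) σ → prod n f (λ u → (a *q p u +q b *q q u) +q (c *q r u +q d *q s u)) σ ≡
  (a *q prod n f p σ +q b *q prod n f q σ) +q (c *q prod n f r σ +q d *q prod n f s σ)
prod-4ʳ n a b c d f p q r s σ = trans (prod-+ʳ n f (λ u → a *q p u +q b *q q u) (λ u → c *q r u +q d *q s u) σ) (cong+
  (trans (prod-+ʳ n f (λ u → a *q p u) (λ u → b *q q u) σ) (cong+ (prod-*ʳ n a f p σ) (prod-*ʳ n b f q σ)))
  (trans (prod-+ʳ n f (λ u → c *q r u) (λ u → d *q s u) σ) (cong+ (prod-*ʳ n c f r σ) (prod-*ʳ n d f s σ))))

module _ (n : ℕ) (σ : List ℕ) (h : IsPerm n σ) (i j : ℕ) (i≤n : i ≤ n) (j≤n : j ≤ n) where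

  private
    x = ind (j ≡ᵇ i)
    K : Bool → Bool → ℚ
    K k s = Kc k s i σ

  prod-K-comb4 : ∀ k s v → let open Vec4 v in prod n (Kc k s i) (comb4 v j) σ ≡
    x *q ((i⁺ *q K (k ∨ true) (mulSign k s true) +q i⁻ *q K (k ∨ true) (mulSign k s false)) +q (j⁺ *q K (k ∨ false) (mulSign k s true) +q j⁻ *q K (k ∨ false) (mulSign k s false)))
  prod-K-comb4 k s (vec4 a b c d) = trans (prod-4ʳ n a b c d (Kc k s i) (Kc true true j) (Kc true false j) (Kc false true j) (Kc false false j) σ)
    (trans (cong₂ _+q_ (cong₂ (λ y z → a *q y +q b *q z) (table true true) (table true false)) (cong₂ (λ y z → c *q y +q d *q z) (table false true) (table false false)))
      (solve 9 (λ x a b c d p q r s → (a :* (x :* p) :+ b :* (x :* q)) :+ (c :* (x :* r) :+ d :* (x :* s)) := x :* ((a :* p :+ b :* q) :+ (c :* r :+ d :* s))) refl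
        x a b c d _ _ _ _))
    where
    open QS
    table : ∀ k' t → prod n (Kc k s i) (Kc k' t j) σ ≡ x *q K (k ∨ k') (mulSign k s t)
    table k' t = prod-K n k s i k' t j σ h i≤n j≤n

  prod-comb4 : ∀ v w → prod n (comb4 v i) (comb4 w j) σ ≡ x *q comb4 (v ⊗ w) i σ
  prod-comb4 v@(vec4 a b c d) w@(vec4 a' b' c' d') = trans (prod-4ˡ n a b c d (Kc true true i) (Kc true false i) (Kc false true i) (Kc false false i) (comb4 w j) σ)
    (trans (cong₂ _+q_ (cong₂ (λ y z → a *q y +q b *q z) (prod-K-comb4 true true w) (prod-K-comb4 true false w))
        (cong₂ (λ y z → c *q y +q d *q z) (prod-K-comb4 false true w) (prod-K-comb4 false false w)))
      (lemma a b c d a' b' c' d' x (K true true) (K true false) (K false true) (K false false)))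
    where
    open QS
    lemma : ∀ a b c d a' b' c' d' x p q r s →
      (a *q (x *q ((a' *q p +q b' *q p) +q (c' *q p +q d' *q p))) +q b *q (x *q ((a' *q q +q b' *q q) +q (c' *q q +q d' *q q)))) +q
      (c *q (x *q ((a' *q p +q b' *q q) +q (c' *q r +q d' *q s))) +q d *q (x *q ((a' *q q +q b' *q p) +q (c' *q s +q d' *q r)))) ≡
      x *q (((a *q ((a' +q b') +q (c' +q d')) +q (c *q a' +q d *q b')) *q p +q (b *q ((a' +q b') +q (c' +q d')) +q (c *q b' +q d *q a')) *q q) +q
            ((c *q c' +q d *q d') *q r +q (c *q d' +q d *q c') *q s))
    lemma = solve 13 (λ a b c d a' b' c' d' x p q r s →
      (a :* (x :* ((a' :* p :+ b' :* p) :+ (c' :* p :+ d' :* p))) :+ b :* (x :* ((a' :* q :+ b' :* q) :+ (c' :* q :+ d' :* q)))) :+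
      (c :* (x :* ((a' :* p :+ b' :* q) :+ (c' :* r :+ d' :* s))) :+ d :* (x :* ((a' :* q :+ b' :* p) :+ (c' :* s :+ d' :* r)))) :=
      x :* (((a :* ((a' :+ b') :+ (c' :+ d')) :+ (c :* a' :+ d :* b')) :* p :+ (b :* ((a' :+ b') :+ (c' :+ d')) :+ (c :* b' :+ d :* a')) :* q) :+
            ((c :* c' :+ d :* d') :* r :+ (c :* d' :+ d :* c') :* s))) refl

data Family : Set where
  𝓔 𝓕 𝓖 : Family

-- J⁺ and J⁻ span the group algebra of a group of order two, with the idempotents ½(J⁺ ± J⁻). The
-- one with the plus sign splits further into `𝓔` = ½(I⁺ + I⁻) and the rest `𝓕`; the other is `𝓖`.
vec : Family → Vec4
vec 𝓔 = vec4 ½ ½ 0ℚ 0ℚ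
vec 𝓕 = vec4 -½ -½ ½ ½
vec 𝓖 = vec4 0ℚ 0ℚ ½ -½

sameFamily : Family → Family → Bool
sameFamily 𝓔 𝓔 = true
sameFamily 𝓕 𝓕 = true
sameFamily 𝓖 𝓖 = true
sameFamily _ _ = false

vec-⊗ : ∀ t t' → vec t ⊗ vec t' ≡ scale4 (ind (sameFamily t t')) (vec t)
vec-⊗ 𝓔 𝓔 = refl
vec-⊗ 𝓔 𝓕 = refl
vec-⊗ 𝓔 𝓖 = refl
vec-⊗ 𝓕 𝓔 = refl
vec-⊗ 𝓕 𝓕 = refl
vec-⊗ 𝓕 𝓖 = refl
vec-⊗ 𝓖 𝓔 = refl
vec-⊗ 𝓖 𝓕 = refl
vec-⊗ 𝓖 𝓖 = refl

basis : Bool → Bool → Vec4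
basis true  true  = vec4 1ℚ 0ℚ 0ℚ 0ℚ
basis true  false = vec4 0ℚ 1ℚ 0ℚ 0ℚ
basis false true  = vec4 0ℚ 0ℚ 1ℚ 0ℚ
basis false false = vec4 0ℚ 0ℚ 0ℚ 1ℚ

-- The corner e𝒲e of each idempotent is one-dimensional.
corner : ∀ t k s → Σ ℚ λ c → (vec t ⊗ basis k s) ⊗ vec t ≡ scale4 c (vec t)
corner 𝓔 true  true  = 1ℚ , refl
corner 𝓔 true  false = 1ℚ , refl
corner 𝓔 false true  = 1ℚ , refl
corner 𝓔 false false = 1ℚ , refl
corner 𝓕 true  true  = 0ℚ , refl
corner 𝓕 true  false = 0ℚ , refl
corner 𝓕 false true  = 1ℚ , refl
corner 𝓕 false false = 1ℚ , refl
corner 𝓖 true  true  = 0ℚ , refl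
corner 𝓖 true  false = 0ℚ , refl
corner 𝓖 false true  = 1ℚ , refl
corner 𝓖 false false = -q 1ℚ , refl

basis-comb4 : ∀ k s i σ → comb4 (basis k s) i σ ≡ Kc k s i σ
basis-comb4 k s i σ = go k s
  where
  open QS
  go : ∀ k s → comb4 (basis k s) i σ ≡ Kc k s i σ
  go true  true  = solve 4 (λ p q r u → (con 1ℚ :* p :+ con 0ℚ :* q) :+ (con 0ℚ :* r :+ con 0ℚ :* u) := p) refl (Kc true true i σ) (Kc true false i σ) (Kc false true i σ) (Kc false false i σ)
  go true  false = solve 4 (λ p q r u → (con 0ℚ :* p :+ con 1ℚ :* q) :+ (con 0ℚ :* r :+ con 0ℚ :* u) := q) refl (Kc true true i σ) (Kc true false i σ) (Kc false true i σ) (Kc false false i σ)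
  go false true  = solve 4 (λ p q r u → (con 0ℚ :* p :+ con 0ℚ :* q) :+ (con 1ℚ :* r :+ con 0ℚ :* u) := r) refl (Kc true true i σ) (Kc true false i σ) (Kc false true i σ) (Kc false false i σ)
  go false false = solve 4 (λ p q r u → (con 0ℚ :* p :+ con 0ℚ :* q) :+ (con 0ℚ :* r :+ con 1ℚ :* u) := u) refl (Kc true true i σ) (Kc true false i σ) (Kc false true i σ) (Kc false false i σ)

ef : Family → ℕ → Fn
ef t = comb4 (vec t)

ef-mul : ∀ n t i t' j σ → IsPerm n σ → i ≤ n → j ≤ n → prod n (ef t i) (ef t' j) σ ≡ ind (j ≡ᵇ i) *q (ind (sameFamily t t') *q ef t i σ)
ef-mul n t i t' j σ h i≤n j≤n = trans (prod-comb4 n σ h i j i≤n j≤n (vec t) (vec t'))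
  (cong (ind (j ≡ᵇ i) *q_) (trans (cong (λ v → comb4 v i σ) (vec-⊗ t t')) (comb4-scale (ind (sameFamily t t')) (vec t) i σ)))

sameFamily-refl : ∀ t → sameFamily t t ≡ true
sameFamily-refl 𝓔 = refl
sameFamily-refl 𝓕 = refl
sameFamily-refl 𝓖 = refl

ef-idempotent : ∀ n t i σ → IsPerm n σ → i ≤ n → prod n (ef t i) (ef t i) σ ≡ ef t i σ
ef-idempotent n t i σ h i≤n = trans (ef-mul n t i t i σ h i≤n i≤n)
  (trans (cong₂ (λ x y → ind x *q (ind y *q ef t i σ)) (≡ᵇ-refl i) (sameFamily-refl t)) (trans (ℚₚ.*-identityˡ (1ℚ *q ef t i σ)) (ℚₚ.*-identityˡ (ef t i σ))))

-- The listed elements in the group algebra.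

-- Written exactly like the entries of `family1`, `family2` and `family3`, so that `idempotents n`
-- is the concatenation of the `members` by computation.
elem : ℕ → Family → ℕ → GA
elem n 𝓔 k = scaleGA ½ (addGA (comp n (Ikp k)) (comp n (Ikm k)))
elem n 𝓕 k = scaleGA ½ (addGA (addGA (comp n (Jkp k)) (comp n (Jkm k))) (scaleGA (-q 1ℚ) (addGA (comp n (Ikp k)) (comp n (Ikm k)))))
elem n 𝓖 k = scaleGA ½ (addGA (comp n (Jkp k)) (scaleGA (-q 1ℚ) (comp n (Jkm k))))

I-Rep : ∀ n s k → Rep n (comp n (Iks s k)) (Kc true s k)
I-Rep n s k = Rep-ext (λ σ _ → hat-Ik s k σ) (comp-Rep n (Iks s k))

J-Rep : ∀ n s k → Rep n (comp n (Jks s k)) (Kc false s k)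
J-Rep n s k = Rep-ext (λ σ _ → hat-Jk s k σ) (comp-Rep n (Jks s k))

elem-Rep : ∀ n t k → Rep n (elem n t k) (ef t k)
elem-Rep n 𝓔 k = Rep-ext (λ σ _ → solve 4 (λ p q r u → con ½ :* (p :+ q) := (con ½ :* p :+ con ½ :* q) :+ (con 0ℚ :* r :+ con 0ℚ :* u)) refl
    (Kc true true k σ) (Kc true false k σ) (Kc false true k σ) (Kc false false k σ))
  (Rep-scale ½ (Rep-add (I-Rep n true k) (I-Rep n false k)))
  where open QS
elem-Rep n 𝓕 k = Rep-ext (λ σ _ → solve 4 (λ p q r u → con ½ :* ((r :+ u) :+ :- con 1ℚ :* (p :+ q)) := (con -½ :* p :+ con -½ :* q) :+ (con ½ :* r :+ con ½ :* u)) refl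
    (Kc true true k σ) (Kc true false k σ) (Kc false true k σ) (Kc false false k σ))
  (Rep-scale ½ (Rep-add (Rep-add (J-Rep n true k) (J-Rep n false k)) (Rep-scale (-q 1ℚ) (Rep-add (I-Rep n true k) (I-Rep n false k)))))
  where open QS
elem-Rep n 𝓖 k = Rep-ext (λ σ _ → solve 4 (λ p q r u → con ½ :* (r :+ :- con 1ℚ :* u) := (con 0ℚ :* p :+ con 0ℚ :* q) :+ (con ½ :* r :+ con -½ :* u)) refl
    (Kc true true k σ) (Kc true false k σ) (Kc false true k σ) (Kc false false k σ))
  (Rep-scale ½ (Rep-add (J-Rep n true k) (Rep-scale (-q 1ℚ) (J-Rep n false k))))
  where open QS

-- The functions `N (alt s k)` see only the number of runs and the first direction; interpolation
-- passes this on to their coefficients in k.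
Kc-runs : ∀ n → 2 ≤ n → ∀ k s i σ τ → IsPerm n σ → IsPerm n τ → runs σ ≡ runs τ → firstAsc σ ≡ firstAsc τ → Kc k s i σ ≡ Kc k s i τ
Kc-runs n n≥2 k s i σ τ p q r f with ℕₚ.<-≤-connex n i
... | inj₁ l = trans (Kc-low k s i σ (subst (_< i) (sym (IsPerm-length p)) l)) (sym (Kc-low k s i τ (subst (_< i) (sym (IsPerm-length q)) l)))
... | inj₂ l = poly-unique (suc n) (λ i → Kc k s i σ) (λ i → Kc k s i τ) (ι ∘ point k) (point-injective k)
  (λ j → trans (sym (N-eval k s j (suc n) σ (s≤s (ℕₚ.≤-reflexive (IsPerm-length p)))))
    (trans (trans (N-value n s (point k j) σ n≥2 p) (trans (cong₂ (value n s (point k j)) r f) (sym (N-value n s (point k j) τ n≥2 q))))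
      (N-eval k s j (suc n) τ (s≤s (ℕₚ.≤-reflexive (IsPerm-length q)))))) i (s≤s l)

hasType : ℕ → Bool → List ℕ → Bool
hasType r c τ = (runs τ ≡ᵇ r) ∧ eqB (firstAsc τ) c

-- Choosing one permutation of each type turns a function constant on types into an explicit
-- function of runs and first direction. For a type that occurs, the default `[]` is not reached.
find : (List ℕ → Bool) → List (List ℕ) → List ℕ
find p []       = []
find p (τ ∷ xs) = if p τ then τ else find p xs

find-sound : ∀ n p xs → All (IsPerm n) xs → (IsPerm n (find p xs) × p (find p xs) ≡ true) ⊎ All (λ τ → p τ ≡ false) xs
find-sound n p []       ps = inj₂ []
find-sound n p (τ ∷ xs) (q ∷ ps) with p τ in e | find-sound n p xs ps
... | true  | _      = inj₁ (q , e)
... | false | inj₁ r = inj₁ r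
... | false | inj₂ r = inj₂ (e ∷ r)

∧-true : ∀ {a b} → (a ∧ b) ≡ true → a ≡ true × b ≡ true
∧-true {true} {true} e = refl , refl

eqB-sound : ∀ a b → eqB a b ≡ true → a ≡ b
eqB-sound true  true  e = refl
eqB-sound false false e = refl

representative : ∀ n σ → IsPerm n σ → let τ = find (hasType (runs σ) (firstAsc σ)) (perms n) in IsPerm n τ × runs σ ≡ runs τ × firstAsc σ ≡ firstAsc τ
representative n σ p with find-sound n (hasType (runs σ) (firstAsc σ)) (perms n) (perms-perm n)
... | inj₁ (q , e) = q , sym (≡ᵇ-sound _ _ (proj₁ (∧-true e))) , sym (eqB-sound _ _ (proj₂ (∧-true {runs τ ≡ᵇ runs σ} e)))
  where τ = find (hasType (runs σ) (firstAsc σ)) (perms n)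
... | inj₂ none = ⊥-elim (off-not-perm n σ (All.map (λ {τ} → other {τ}) none) p)
  where
  self : hasType (runs σ) (firstAsc σ) σ ≡ true
  self rewrite ≡ᵇ-refl (runs σ) = eqB-refl (firstAsc σ)
  other : ∀ {τ} → hasType (runs σ) (firstAsc σ) τ ≡ false → eqL τ σ ≡ false
  other {τ} e with eqL τ σ in e'
  ... | false = refl
  ... | true  = trans (sym self) (trans (cong (hasType (runs σ) (firstAsc σ)) (sym (eqL-sound τ σ e'))) e)

elem-InW : ∀ n → 2 ≤ n → ∀ t i → InW n (elem n t i)
elem-InW n n≥2 t i = Rep⇒InW n≥2 (λ r c → ef t i (find (hasType r c) (perms n))) (Rep-ext same (elem-Rep n t i))
  where
  same : ∀ σ → IsPerm n σ → ef t i σ ≡ ef t i (find (hasType (runs σ) (firstAsc σ)) (perms n))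
  same σ p = cong₂ _+q_
    (cong₂ (λ y z → Vec4.i⁺ (vec t) *q y +q Vec4.i⁻ (vec t) *q z) (K true true) (K true false))
    (cong₂ (λ y z → Vec4.j⁺ (vec t) *q y +q Vec4.j⁻ (vec t) *q z) (K false true) (K false false))
    where
    K : ∀ k s → Kc k s i σ ≡ Kc k s i (find (hasType (runs σ) (firstAsc σ)) (perms n))
    K k s = Kc-runs n n≥2 k s i σ (find (hasType (runs σ) (firstAsc σ)) (perms n)) p
      (proj₁ (representative n σ p)) (proj₁ (proj₂ (representative n σ p))) (proj₂ (proj₂ (representative n σ p)))

elem-idempotent : ∀ n t i → i ≤ n → Idempotent (elem n t i)
elem-idempotent n t i i≤n = Rep⇒≈ (Rep-ext (λ σ p → ef-idempotent n t i σ p i≤n) (Rep-mul (elem-Rep n t i) (elem-Rep n t i))) (elem-Rep n t i)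

elem-orthogonal : ∀ n t i t' j → i ≤ n → j ≤ n → ((j ≡ᵇ i) ∧ sameFamily t t') ≡ false → mulGA (elem n t i) (elem n t' j) ≈ zeroGA
elem-orthogonal n t i t' j i≤n j≤n e = Rep⇒≈ (Rep-ext (λ σ p → trans (ef-mul n t i t' j σ p i≤n j≤n)
    (trans (sym (ℚₚ.*-assoc (ind (j ≡ᵇ i)) (ind (sameFamily t t')) (ef t i σ)))
      (0*x (ef t i σ) (trans (sym (ind-∧ (j ≡ᵇ i) (sameFamily t t'))) (cong ind e)))))
  (Rep-mul (elem-Rep n t i) (elem-Rep n t' j))) Rep-zero

-- Primitivity

even⊎odd : ∀ k → Σ Bool λ b → Σ ℕ λ j → k ≡ point b j
even⊎odd zero    = true , 0 , refl
even⊎odd (suc k) with even⊎odd k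
... | true  , j , refl = false , j , refl
... | false , j , refl = true , suc j , refl

module _ {n : ℕ} {Good : Fn → Set} (lin : Linear n Good) where

  open Linear lin

  Good-evalP : ∀ d (P : ℕ → Fn) x → (∀ j → j < d → Good (P j)) → Good (λ σ → evalP d (λ j → P j σ) x)
  Good-evalP zero    P x h = zero-ok
  Good-evalP (suc d) P x h = plus-ok (h 0 z<s) (mult-ok x (Good-evalP d (P ∘ suc) x (λ j l → h (suc j) (s<s l))))

module _ (n : ℕ) (n≥2 : 2 ≤ n) (t : Family) (i : ℕ) (i≤n : i ≤ n) where

  private e = ef t i

  -- exe is a multiple of e. This condition is linear in x, so it propagates from the generators to
  -- everything determined by runs and first direction.
  Scalar : Fn → Set
  Scalar x = Σ ℚ λ c → ∀ σ → IsPerm n σ → prod n (prod n e x) e σ ≡ c *q e σ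

  Scalar-linear : Linear n Scalar
  Scalar-linear = record
    { ext = λ h (c , s) → c , λ σ p → trans (prod-cong n {g = e} (λ u q → prod-cong n {f = e} (λ _ _ → refl) (λ v r → sym (h v r)) u q) (λ _ _ → refl) σ p) (s σ p)
    ; zero-ok = 0ℚ , λ σ p → trans (prod-0ˡ n (prod n e (λ _ → 0ℚ)) e σ (λ u → prod-0ʳ n e (λ _ → 0ℚ) u (λ _ → refl))) (sym (ℚₚ.*-zeroˡ (e σ)))
    ; plus-ok = λ {f} {g} (c , s) (c' , s') → c +q c' , λ σ p →
        trans (prod-cong n {g = e} (λ u q → prod-+ʳ n e f g u) (λ _ _ → refl) σ p)
          (trans (prod-+ˡ n (prod n e f) (prod n e g) e σ) (trans (cong+ (s σ p) (s' σ p)) (sym (ℚₚ.*-distribʳ-+ (e σ) c c'))))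
    ; mult-ok = λ k {f} (c , s) → k *q c , λ σ p →
        trans (prod-cong n {g = e} (λ u q → prod-*ʳ n k e f u) (λ _ _ → refl) σ p)
          (trans (prod-*ˡ n k (prod n e f) e σ) (trans (cong (k *q_) (s σ p)) (sym (ℚₚ.*-assoc k c (e σ)))))
    }

  Scalar-K : ∀ k s j → j ≤ n → Scalar (Kc k s j)
  Scalar-K k s j j≤n = ind (j ≡ᵇ i) *q proj₁ (corner t k s) , λ σ p → begin
    prod n (prod n e (Kc k s j)) e σ
      ≡⟨ prod-cong n {g = e} (λ u q → trans (prod-cong n {f = e} (λ _ _ → refl) (λ v _ → sym (basis-comb4 k s j v)) u q) (prod-comb4 n u q i j i≤n j≤n (vec t) (basis k s))) (λ _ _ → refl) σ p ⟩
    prod n (λ u → x *q comb4 (vec t ⊗ basis k s) i u) e σ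
      ≡⟨ trans (prod-*ˡ n x (comb4 (vec t ⊗ basis k s) i) e σ) (cong (x *q_) (prod-comb4 n σ p i i i≤n i≤n (vec t ⊗ basis k s) (vec t))) ⟩
    x *q (ind (i ≡ᵇ i) *q comb4 ((vec t ⊗ basis k s) ⊗ vec t) i σ)
      ≡⟨ cong (x *q_) (trans (cong₂ (λ b v → ind b *q comb4 v i σ) (≡ᵇ-refl i) (proj₂ (corner t k s)))
           (trans (ℚₚ.*-identityˡ (comb4 (scale4 c (vec t)) i σ)) (comb4-scale c (vec t) i σ))) ⟩
    x *q (c *q e σ)
      ≡⟨ sym (ℚₚ.*-assoc x c (e σ)) ⟩
    x *q c *q e σ ∎
    where
    open ≡-Reasoning
    x = ind (j ≡ᵇ i)
    c = proj₁ (corner t k s)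

  Scalar-N : ∀ s k → Scalar (N (alt s k))
  Scalar-N s k = subst (λ m → Scalar (N (alt s m))) (sym (proj₂ (proj₂ (even⊎odd k)))) (at (proj₁ (even⊎odd k)) (proj₁ (proj₂ (even⊎odd k))))
    where
    at : ∀ b j → Scalar (N (alt s (point b j)))
    at b j = Linear.ext Scalar-linear (λ σ p → sym (N-eval b s j (suc n) σ (s≤s (ℕₚ.≤-reflexive (IsPerm-length p)))))
      (Good-evalP Scalar-linear (suc n) (Kc b s) (ι (point b j)) (λ j' l → Scalar-K b s j' (ℕₚ.≤-pred l)))

  Scalar-runs : ∀ F → Scalar (λ σ → F (runs σ) (firstAsc σ))
  Scalar-runs = spanned n≥2 Scalar-linear Scalar-N

  module _ (nonzero : e (upTo n) ≢ 0ℚ) where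

    elem≉0 : ¬ (elem n t i ≈ zeroGA)
    elem≉0 z = nonzero (trans (sym (on (elem-Rep n t i) (upTo n) ↭-refl)) (z (upTo n)))

    -- From e = x + y with orthogonal idempotents follows ex = x = xe, hence x = exe = ce.
    -- Idempotence of x then gives c(c - 1)e = 0, and as e does not vanish at the identity, c is 0
    -- or 1.
    elem-primitive : Primitive n (elem n t i)
    elem-primitive = elem≉0 , split
      where
      split : ∀ x y → InW n x → InW n y → Idempotent x → Idempotent y → mulGA x y ≈ zeroGA → mulGA y x ≈ zeroGA → addGA x y ≈ elem n t i → x ≈ zeroGA ⊎ y ≈ zeroGA
      split x y xW yW xx yy xy yx sum = finish (c ℚₚ.≟ 0ℚ)
        where
        open ≡-Reasoning
        F = proj₁ (InW⇒Rep {n} {x} n≥2 xW)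
        rx = proj₂ (InW⇒Rep {n} {x} n≥2 xW)
        G = proj₁ (InW⇒Rep {n} {y} n≥2 yW)
        ry = proj₂ (InW⇒Rep {n} {y} n≥2 yW)
        f g : Fn
        f σ = F (runs σ) (firstAsc σ)
        g σ = G (runs σ) (firstAsc σ)
        f+g : ∀ σ → IsPerm n σ → f σ +q g σ ≡ e σ
        f+g σ p = trans (sym (on (Rep-add rx ry) σ p)) (trans (sum σ) (on (elem-Rep n t i) σ p))
        ff : ∀ σ → IsPerm n σ → prod n f f σ ≡ f σ
        ff σ p = trans (sym (on (Rep-mul rx rx) σ p)) (trans (xx σ) (on rx σ p))
        fg : ∀ σ → IsPerm n σ → prod n f g σ ≡ 0ℚ
        fg σ p = trans (sym (on (Rep-mul rx ry) σ p)) (xy σ)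
        gf : ∀ σ → IsPerm n σ → prod n g f σ ≡ 0ℚ
        gf σ p = trans (sym (on (Rep-mul ry rx) σ p)) (yx σ)
        ef≡f : ∀ σ → IsPerm n σ → prod n e f σ ≡ f σ
        ef≡f σ p = trans (prod-cong n {g = f} (λ u q → sym (f+g u q)) (λ _ _ → refl) σ p)
          (trans (prod-+ˡ n f g f σ) (trans (cong+ (ff σ p) (gf σ p)) (ℚₚ.+-identityʳ (f σ))))
        fe≡f : ∀ σ → IsPerm n σ → prod n f e σ ≡ f σ
        fe≡f σ p = trans (prod-cong n {f = f} (λ _ _ → refl) (λ u q → sym (f+g u q)) σ p)
          (trans (prod-+ʳ n f f g σ) (trans (cong+ (ff σ p) (fg σ p)) (ℚₚ.+-identityʳ (f σ))))
        c : ℚ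
        c = proj₁ (Scalar-runs F)
        f≡ce : ∀ σ → IsPerm n σ → f σ ≡ c *q e σ
        f≡ce σ p = trans (sym (trans (prod-cong n {g = e} ef≡f (λ _ _ → refl) σ p) (fe≡f σ p))) (proj₂ (Scalar-runs F) σ p)
        cce≡ce : ∀ σ → IsPerm n σ → c *q (c *q e σ) ≡ c *q e σ
        cce≡ce σ p = begin
          c *q (c *q e σ)                              ≡⟨ cong (λ y → c *q (c *q y)) (sym (ef-idempotent n t i σ p i≤n)) ⟩
          c *q (c *q prod n e e σ)                     ≡⟨ sym (trans (prod-*ˡ n c e (λ u → c *q e u) σ) (cong (c *q_) (prod-*ʳ n c e e σ))) ⟩
          prod n (λ u → c *q e u) (λ u → c *q e u) σ   ≡⟨ prod-cong n (λ u q → sym (f≡ce u q)) (λ u q → sym (f≡ce u q)) σ p ⟩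
          prod n f f σ                                 ≡⟨ ff σ p ⟩
          f σ                                          ≡⟨ f≡ce σ p ⟩
          c *q e σ                                     ∎
        finish : Dec (c ≡ 0ℚ) → x ≈ zeroGA ⊎ y ≈ zeroGA
        finish (yes c≡0) = inj₁ (Rep⇒≈ (Rep-ext (λ σ p → trans (f≡ce σ p) (0*x (e σ) c≡0)) rx) Rep-zero)
        finish (no c≢0)  = inj₂ (Rep⇒≈ (Rep-ext (λ σ p → g≡0 σ p) ry) Rep-zero)
          where
          c≡1 : c ≡ 1ℚ
          c≡1 = x-y≡0⇒x≡y c 1ℚ (p*x≡0⇒x≡0 (c *q e₀) _ (λ z → nonzero (p*x≡0⇒x≡0 c e₀ c≢0 z))
            (trans (solve 2 (λ c e → (c :* e) :* (c :+ :- con 1ℚ) := c :* (c :* e) :+ :- (c :* e)) refl c e₀)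
              (trans (cong (_+q -q (c *q e₀)) (cce≡ce (upTo n) ↭-refl)) (ℚₚ.+-inverseʳ (c *q e₀)))))
            where
            open QS
            e₀ = e (upTo n)
          g≡0 : ∀ σ → IsPerm n σ → g σ ≡ 0ℚ
          g≡0 σ p = trans (solve 2 (λ f g → g := (f :+ g) :+ :- f) refl (f σ) (g σ))
            (trans (cong₂ (λ y z → y +q -q z) (f+g σ p) (trans (f≡ce σ p) (trans (cong (_*q e σ) c≡1) (ℚₚ.*-identityˡ (e σ))))) (ℚₚ.+-inverseʳ (e σ)))
            where open QS

-- Index sets and non-vanishing

bound : Family → ℕ → ℕ
bound 𝓔 n = suc n
bound 𝓕 n = n ∸ 3
bound 𝓖 n = n ∸ 1

start : Family → ℕ
start 𝓔 = 1
start 𝓕 = 0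
start 𝓖 = 0

Index : ℕ → Family → ℕ → Set
Index n t i = (start t ≤ i × i < bound t n) × sameParity i n ≡ true

∸-< : ∀ m {i n} → i < n ∸ m → m + i < n
∸-< zero              l = l
∸-< (suc m) {n = suc n} l = s≤s (∸-< m l)

Index-≤ : ∀ n t {i} → Index n t i → i ≤ n
Index-≤ n 𝓔 ((_ , l) , _) = ℕₚ.≤-pred l
Index-≤ n 𝓕 ((_ , l) , _) = ℕₚ.<⇒≤ (ℕₚ.<-≤-trans l (ℕₚ.m∸n≤m n 3))
Index-≤ n 𝓖 ((_ , l) , _) = ℕₚ.<⇒≤ (ℕₚ.<-≤-trans l (ℕₚ.m∸n≤m n 1))

even-dbl⁻ : ∀ n → even n ≡ true → Σ ℕ λ t → n ≡ dbl t
even-dbl⁻ zero          e = 0 , refl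
even-dbl⁻ (suc (suc n)) e with even-dbl⁻ n (trans (sym (not-involutive (even n))) e)
... | t , refl = suc t , refl

sameParity-suc : ∀ i n → sameParity (suc i) (suc n) ≡ sameParity i n
sameParity-suc i n with even i | even n
... | true  | true  = refl
... | true  | false = refl
... | false | true  = refl
... | false | false = refl

parity-gap : ∀ i n → sameParity i n ≡ true → i ≤ n → Σ ℕ λ t → n ≡ dbl t + i
parity-gap zero    n       e l with even-dbl⁻ n e
... | t , refl = t , sym (ℕₚ.+-identityʳ (dbl t))
parity-gap (suc i) (suc n) e (s≤s l) with parity-gap i n (trans (sym (sameParity-suc i n)) e) l
... | t , refl = t , sym (ℕₚ.+-suc (dbl t) i)

positive⇒≢0 : ∀ {x} → 0ℚ ℚ.< x → x ≢ 0ℚ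
positive⇒≢0 l e = ℚₚ.<⇒≢ l (sym e)

½-positive : ∀ {x} → 0ℚ ℚ.< x → 0ℚ ℚ.< ½ *q x
½-positive l = *-pos (ℚₚ.positive⁻¹ ½) l

ef-𝓔 : ∀ i σ → ef 𝓔 i σ ≡ ½ *q (Kc true true i σ +q Kc true false i σ)
ef-𝓔 i σ = solve 4 (λ p q r u → (con ½ :* p :+ con ½ :* q) :+ (con 0ℚ :* r :+ con 0ℚ :* u) := con ½ :* (p :+ q)) refl
  (Kc true true i σ) (Kc true false i σ) (Kc false true i σ) (Kc false false i σ)
  where open QS

ef-𝓕 : ∀ i σ → ef 𝓕 i σ ≡ ½ *q Hc i σ
ef-𝓕 i σ = solve 4 (λ p q r u → (con -½ :* p :+ con -½ :* q) :+ (con ½ :* r :+ con ½ :* u) := con ½ :* ((r :+ u) :+ :- con 1ℚ :* (p :+ q))) refl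
  (Kc true true i σ) (Kc true false i σ) (Kc false true i σ) (Kc false false i σ)
  where open QS

ef-𝓖 : ∀ i σ → ef 𝓖 i σ ≡ ½ *q (Kc false true i σ +q -q Kc false false i σ)
ef-𝓖 i σ = solve 4 (λ p q r u → (con 0ℚ :* p :+ con 0ℚ :* q) :+ (con ½ :* r :+ con -½ :* u) := con ½ :* (r :+ :- u)) refl
  (Kc true true i σ) (Kc true false i σ) (Kc false true i σ) (Kc false false i σ)
  where open QS

ef-𝓔-positive : ∀ m i → 1 ≤ i → 0ℚ ℚ.< ef 𝓔 i (upTo (dbl m + i))
ef-𝓔-positive m i l = subst (0ℚ ℚ.<_) (sym (ef-𝓔 i (upTo (dbl m + i))))
  (½-positive (nonNeg+pos (ℚₚ.<⇒≤ (κ-positive true true 0 (I-recurrence true) m i l)) (κ-positive true false 0 (I-recurrence false) m i l)))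

ef-𝓕-positive : ∀ m i → 0ℚ ℚ.< ef 𝓕 i (upTo (dbl (suc (suc m)) + i))
ef-𝓕-positive m i = subst (0ℚ ℚ.<_) (sym (ef-𝓕 i (upTo (dbl (suc (suc m)) + i)))) (½-positive (η-positive m i))

difference-positive : ∀ {r u a} → u +q a ≡ r → 0ℚ ℚ.< a → 0ℚ ℚ.< ½ *q (r +q -q u)
difference-positive {r} {u} {a} e l = ½-positive (subst (0ℚ ℚ.<_) (trans (solve 2 (λ u a → a := (u :+ a) :+ :- u) refl u a) (cong (_+q -q u) e)) l)
  where open QS

-- At the identity J⁺ - J⁻ equals the coefficient of J⁺ two degrees lower, by `κ-shifted`.
ef-𝓖-positive : ∀ m i → 0ℚ ℚ.< ef 𝓖 i (upTo (dbl (suc m) + i))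
ef-𝓖-positive m i = subst (0ℚ ℚ.<_) (sym (ef-𝓖 i (upTo (dbl (suc m) + i))))
  (difference-positive {κ false true i (dbl (suc m) + i)} {κ false false i (dbl (suc m) + i)} {κ false true i (dbl m + i)}
    (κ-shifted i (dbl m + i)) (κ-positive false true 1 J-recurrence m i (s≤s z≤n)))

-- The gap n - i is even. The index ranges exclude the gaps 0 and 2 for `𝓕` and the gap 0 for `𝓖`,
-- which are the even gaps where those elements vanish.
ef-positive : ∀ n t i m → n ≡ dbl m + i → Index n t i → 0ℚ ℚ.< ef t i (upTo n)
ef-positive n 𝓔 i m e ((l , _) , _) = subst (λ k → 0ℚ ℚ.< ef 𝓔 i (upTo k)) (sym e) (ef-𝓔-positive m i l)
ef-positive n 𝓕 i zero e ((_ , l) , _) = ⊥-elim (ℕₚ.<⇒≱ (∸-< 3 l) (ℕₚ.≤-trans (ℕₚ.≤-reflexive e) (ℕₚ.m≤n+m i 3)))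
ef-positive n 𝓕 i (suc zero) e ((_ , l) , _) = ⊥-elim (ℕₚ.<⇒≱ (∸-< 3 l) (ℕₚ.≤-trans (ℕₚ.≤-reflexive e) (ℕₚ.n≤1+n (suc (suc i)))))
ef-positive n 𝓕 i (suc (suc m)) e _ = subst (λ k → 0ℚ ℚ.< ef 𝓕 i (upTo k)) (sym e) (ef-𝓕-positive m i)
ef-positive n 𝓖 i zero e ((_ , l) , _) = ⊥-elim (ℕₚ.<⇒≱ (∸-< 1 l) (ℕₚ.≤-trans (ℕₚ.≤-reflexive e) (ℕₚ.n≤1+n i)))
ef-positive n 𝓖 i (suc m) e _ = subst (λ k → 0ℚ ℚ.< ef 𝓖 i (upTo k)) (sym e) (ef-𝓖-positive m i)

ef-nonzero : ∀ n t i → Index n t i → ef t i (upTo n) ≢ 0ℚ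
ef-nonzero n t i x = positive⇒≢0 (ef-positive n t i (proj₁ gap) (proj₂ gap) x)
  where gap = parity-gap i n (proj₂ x) (Index-≤ n t x)

candidates : Family → ℕ → List ℕ
candidates 𝓔 n = map suc (upTo n)
candidates 𝓕 n = upTo (n ∸ 3)
candidates 𝓖 n = upTo (n ∸ 1)

indices : Family → ℕ → List ℕ
indices t n = filterB (λ i → sameParity i n) (candidates t n)

All-filterB : ∀ {A : Set} {P : A → Set} (p : A → Bool) {xs} → All P xs → All (λ x → P x × p x ≡ true) (filterB p xs)
All-filterB p []       = []
All-filterB p {x ∷ xs} (q ∷ qs) with p x in e
... | true  = (q , e) ∷ All-filterB p qs
... | false = All-filterB p qs

AllPairs-filterB : ∀ {A : Set} {R : A → A → Set} (p : A → Bool) {xs} → AllPairs R xs → AllPairs R (filterB p xs)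
AllPairs-filterB p []       = []
AllPairs-filterB p {x ∷ xs} (q ∷ qs) with p x
... | true  = All.map proj₁ (All-filterB p q) ∷ AllPairs-filterB p qs
... | false = AllPairs-filterB p qs

candidates-range : ∀ t n → All (λ i → start t ≤ i × i < bound t n) (candidates t n)
candidates-range 𝓔 n = Allₚ.map⁺ (Allₚ.applyUpTo⁺₁ (λ i → i) n (λ l → s≤s z≤n , s≤s l))
candidates-range 𝓕 n = Allₚ.applyUpTo⁺₁ (λ i → i) (n ∸ 3) (λ l → z≤n , l)
candidates-range 𝓖 n = Allₚ.applyUpTo⁺₁ (λ i → i) (n ∸ 1) (λ l → z≤n , l)

candidates-distinct : ∀ t n → Distinct (candidates t n)
candidates-distinct 𝓔 n = Uniqueₚ.map⁺ ℕₚ.suc-injective (Uniqueₚ.upTo⁺ n)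
candidates-distinct 𝓕 n = Uniqueₚ.upTo⁺ (n ∸ 3)
candidates-distinct 𝓖 n = Uniqueₚ.upTo⁺ (n ∸ 1)

indices-ok : ∀ t n → All (Index n t) (indices t n)
indices-ok t n = All-filterB (λ i → sameParity i n) (candidates-range t n)

members : ℕ → Family → List GA
members n t = map (elem n t) (indices t n)

All-members : ∀ {P : GA → Set} n → (∀ t i → Index n t i → P (elem n t i)) → All P (members n 𝓔 ++ members n 𝓕 ++ members n 𝓖)
All-members {P} n h = Allₚ.++⁺ (one 𝓔) (Allₚ.++⁺ (one 𝓕) (one 𝓖))
  where
  one : ∀ t → All P (members n t)
  one t = Allₚ.map⁺ (All.map (λ {i} → h t i) (indices-ok t n))

-- Orthogonality of the listed elements.

-- Both orders are recorded because `AllPairs` visits each pair of positions only once.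
Orthogonal : GA → GA → Set
Orthogonal x y = mulGA x y ≈ zeroGA × mulGA y x ≈ zeroGA

≡ᵇ-≢ : ∀ i j → i ≢ j → (j ≡ᵇ i) ≡ false
≡ᵇ-≢ i j ne with j ≡ᵇ i in e
... | false = refl
... | true  = ⊥-elim (ne (sym (≡ᵇ-sound j i e)))

∧-falseʳ : ∀ a {b} → b ≡ false → (a ∧ b) ≡ false
∧-falseʳ true  e = e
∧-falseʳ false e = refl

∧-falseˡ : ∀ {a} b → a ≡ false → (a ∧ b) ≡ false
∧-falseˡ b refl = refl

members-orthogonal : ∀ n t → AllPairs Orthogonal (members n t)
members-orthogonal n t = go (indices t n) (indices-ok t n) (AllPairs-filterB (λ i → sameParity i n) (candidates-distinct t n))
  where
  go : ∀ xs → All (Index n t) xs → Distinct xs → AllPairs Orthogonal (map (elem n t) xs)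
  go []       []       []       = []
  go (i ∷ xs) (p ∷ ps) (d ∷ ds) = Allₚ.map⁺ (All.zipWith (λ {j} (q , i≢j) →
      elem-orthogonal n t i t j (Index-≤ n t p) (Index-≤ n t q) (∧-falseˡ (sameFamily t t) (≡ᵇ-≢ i j i≢j)) ,
      elem-orthogonal n t j t i (Index-≤ n t q) (Index-≤ n t p) (∧-falseˡ (sameFamily t t) (≡ᵇ-≢ j i (λ e → i≢j (sym e))))) (ps , d)) ∷ go xs ps ds

cross-orthogonal : ∀ n t t' → sameFamily t t' ≡ false → sameFamily t' t ≡ false → All (λ x → All (Orthogonal x) (members n t')) (members n t)
cross-orthogonal n t t' e e' = Allₚ.map⁺ (All.map (λ {i} p → Allₚ.map⁺ (All.map (λ {j} q →
  elem-orthogonal n t i t' j (Index-≤ n t p) (Index-≤ n t' q) (∧-falseʳ (j ≡ᵇ i) e) ,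
  elem-orthogonal n t' j t i (Index-≤ n t' q) (Index-≤ n t p) (∧-falseʳ (i ≡ᵇ j) e')) (indices-ok t' n))) (indices-ok t n))

all-orthogonal : ∀ n → AllPairs Orthogonal (members n 𝓔 ++ members n 𝓕 ++ members n 𝓖)
all-orthogonal n = AllPairsₚ.++⁺ (members-orthogonal n 𝓔) (AllPairsₚ.++⁺ (members-orthogonal n 𝓕) (members-orthogonal n 𝓖) (cross-orthogonal n 𝓕 𝓖 refl refl))
  (All.zipWith (λ (p , q) → Allₚ.++⁺ p q) (cross-orthogonal n 𝓔 𝓕 refl refl , cross-orthogonal n 𝓔 𝓖 refl refl))

AllPairs-lookup : ∀ {xs} → AllPairs Orthogonal xs → ∀ (i j : Fin.Fin (length xs)) → i ≢ j → mulGA (lookup xs i) (lookup xs j) ≈ zeroGA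
AllPairs-lookup (p ∷ ps) Fin.zero    Fin.zero    ne = ⊥-elim (ne refl)
AllPairs-lookup (p ∷ ps) Fin.zero    (Fin.suc j) ne = proj₁ (All.lookup p (∈ₚ.∈-lookup j))
AllPairs-lookup (p ∷ ps) (Fin.suc i) Fin.zero    ne = proj₂ (All.lookup p (∈ₚ.∈-lookup i))
AllPairs-lookup (p ∷ ps) (Fin.suc i) (Fin.suc j) ne = AllPairs-lookup ps i j (λ e → ne (cong Fin.suc e))

-- Completeness

ef-parity : ∀ t i σ → sameParity i (length σ) ≡ false → ef t i σ ≡ 0ℚ
ef-parity t i σ e = trans (cong₂ _+q_ (cong₂ (λ y z → i⁺ *q y +q i⁻ *q z) (Kc-parity true true i σ e) (Kc-parity true false i σ e))
    (cong₂ (λ y z → j⁺ *q y +q j⁻ *q z) (Kc-parity false true i σ e) (Kc-parity false false i σ e)))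
  (solve 4 (λ a b c d → (a :* con 0ℚ :+ b :* con 0ℚ) :+ (c :* con 0ℚ :+ d :* con 0ℚ) := con 0ℚ) refl i⁺ i⁻ j⁺ j⁻)
  where
  open QS
  open Vec4 (vec t)

∑<-truncate : ∀ {m M} f → m ≤ M → (∀ i → m ≤ i → i < M → f i ≡ 0ℚ) → ∑< M f ≡ ∑< m f
∑<-truncate {zero}  {M}     f l       z = ∑<-0 M (λ i l → z i z≤n l)
∑<-truncate {suc m} {suc M} f (s≤s l) z = cong (f 0 +q_) (∑<-truncate (f ∘ suc) l (λ i p q → z (suc i) (s≤s p) (s≤s q)))

∑-parity : ∀ t σ n → length σ ≡ n → ∀ xs → ∑ (filterB (λ i → sameParity i n) xs) (λ i → ef t i σ) ≡ ∑ xs (λ i → ef t i σ)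
∑-parity t σ n refl xs = trans (∑-filterB (λ i → sameParity i n) xs (λ i → ef t i σ)) (∑-cong xs (λ i → guard (sameParity i n) (ef-parity t i σ)))
  where
  guard : ∀ b {x} → (b ≡ false → x ≡ 0ℚ) → (if b then x else 0ℚ) ≡ x
  guard true  h = refl
  guard false h = sym (h refl)

sameParity-+1 : ∀ i → sameParity i (suc i) ≡ false
sameParity-+1 i with even i
... | true  = refl
... | false = refl

ef-𝓔-0 : ∀ σ → 1 ≤ length σ → ef 𝓔 0 σ ≡ 0ℚ
-- I_0 is the unit, so on a nonempty word the right-hand side of `ef-𝓔` computes to `0ℚ`.
ef-𝓔-0 (a ∷ σ) l = ef-𝓔 0 (a ∷ σ)

ef-𝓖-top : ∀ σ → ef 𝓖 (length σ) σ ≡ 0ℚ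
ef-𝓖-top σ = trans (ef-𝓖 (length σ) σ) (x*0 ½ (trans (cong₂ (λ y z → y +q -q z) (Jc-top true σ) (Jc-top false σ)) (ℚₚ.+-inverseʳ (invFact (length σ)))))

gap : ∀ {i n} d → i ≤ n → n ≤ d + i → Σ ℕ λ m → m ≤ d × n ≡ m + i
gap {i} {n} d l u = n ∸ i , ℕₚ.≤-trans (ℕₚ.∸-monoˡ-≤ i u) (ℕₚ.≤-reflexive (ℕₚ.m+n∸n≡m d i)) , sym (ℕₚ.m∸n+n≡m l)

-- Omitted indices of the wrong parity contribute zero. The others are 0 for `𝓔`, n and n - 2 for
-- `𝓕`, and n for `𝓖`, where the top-degree formulas or the unit I_0 give zero.
∑-indices : ∀ t n σ → length σ ≡ n → 2 ≤ n → ∑ (indices t n) (λ i → ef t i σ) ≡ ∑< (suc n) (λ i → ef t i σ)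
∑-indices t n σ e n≥2 = trans (∑-parity t σ n e (candidates t n)) (range t)
  where
  outside-𝓕 : ∀ i m → m ≤ 3 → n ≡ m + i → ef 𝓕 i σ ≡ 0ℚ
  outside-𝓕 i 0 _ q = trans (ef-𝓕 i σ) (x*0 ½ (Hc-top i σ (trans e q)))
  outside-𝓕 i 1 _ q = ef-parity 𝓕 i σ (trans (cong (sameParity i) (trans e q)) (sameParity-+1 i))
  outside-𝓕 i 2 _ q = trans (ef-𝓕 i σ) (x*0 ½ (Hc-subtop i σ (trans e q)))
  outside-𝓕 i 3 _ q = ef-parity 𝓕 i σ (trans (cong (sameParity i) (trans e q)) (trans (cong (λ b → eqB (even i) (not b)) (not-involutive (even i))) (sameParity-+1 i)))
  outside-𝓕 i (suc (suc (suc (suc m)))) (s≤s (s≤s (s≤s ()))) q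
  outside-𝓖 : ∀ i m → m ≤ 1 → n ≡ m + i → ef 𝓖 i σ ≡ 0ℚ
  outside-𝓖 i 0 _ q = subst (λ k → ef 𝓖 k σ ≡ 0ℚ) (trans e q) (ef-𝓖-top σ)
  outside-𝓖 i 1 _ q = ef-parity 𝓖 i σ (trans (cong (sameParity i) (trans e q)) (sameParity-+1 i))
  outside-𝓖 i (suc (suc m)) (s≤s ()) q
  outside : ∀ t i → i ≤ n → bound t n ≤ i → ef t i σ ≡ 0ℚ
  outside 𝓔 i l u = ⊥-elim (ℕₚ.<⇒≱ u l)
  outside 𝓕 i l u = outside-𝓕 i (proj₁ g) (proj₁ (proj₂ g)) (proj₂ (proj₂ g))
    where g = gap 3 l (ℕₚ.≤-trans (ℕₚ.m≤n+m∸n n 3) (ℕₚ.+-monoʳ-≤ 3 u))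
  outside 𝓖 i l u = outside-𝓖 i (proj₁ g) (proj₁ (proj₂ g)) (proj₂ (proj₂ g))
    where g = gap 1 l (ℕₚ.≤-trans (ℕₚ.m≤n+m∸n n 1) (ℕₚ.+-monoʳ-≤ 1 u))
  range : ∀ t → ∑ (candidates t n) (λ i → ef t i σ) ≡ ∑< (suc n) (λ i → ef t i σ)
  range 𝓔 = trans (∑-map suc (upTo n) (λ i → ef 𝓔 i σ)) (trans (∑-upTo n (λ i → ef 𝓔 (suc i) σ))
    (sym (trans (cong (_+q ∑< n (λ i → ef 𝓔 (suc i) σ)) (ef-𝓔-0 σ (subst (1 ≤_) (sym e) (ℕₚ.<⇒≤ n≥2)))) (ℚₚ.+-identityˡ (∑< n (λ i → ef 𝓔 (suc i) σ))))))
  range 𝓕 = trans (∑-upTo (n ∸ 3) (λ i → ef 𝓕 i σ)) (sym (∑<-truncate (λ i → ef 𝓕 i σ) (ℕₚ.m≤n⇒m≤1+n (ℕₚ.m∸n≤m n 3)) (λ i u l → outside 𝓕 i (ℕₚ.≤-pred l) u)))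
  range 𝓖 = trans (∑-upTo (n ∸ 1) (λ i → ef 𝓖 i σ)) (sym (∑<-truncate (λ i → ef 𝓖 i σ) (ℕₚ.m≤n⇒m≤1+n (ℕₚ.m∸n≤m n 1)) (λ i u l → outside 𝓖 i (ℕₚ.≤-pred l) u)))

ef-total : ∀ i σ → ef 𝓔 i σ +q (ef 𝓕 i σ +q ef 𝓖 i σ) ≡ Jc true i σ
ef-total i σ = solve 4 (λ p q r u → ((con ½ :* p :+ con ½ :* q) :+ (con 0ℚ :* r :+ con 0ℚ :* u)) :+
    (((con -½ :* p :+ con -½ :* q) :+ (con ½ :* r :+ con ½ :* u)) :+ ((con 0ℚ :* p :+ con 0ℚ :* q) :+ (con ½ :* r :+ con -½ :* u))) := r) refl
  (Kc true true i σ) (Kc true false i σ) (Kc false true i σ) (Kc false false i σ)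
  where open QS

sumGA-++ : ∀ xs ys → sumGA (xs ++ ys) ≡ sumGA xs ++ sumGA ys
sumGA-++ []       ys = refl
sumGA-++ (x ∷ xs) ys = trans (cong (x ++_) (sumGA-++ xs ys)) (sym (Lₚ.++-assoc x (sumGA xs) (sumGA ys)))

complete : ∀ n → 2 ≤ n → sumGA (members n 𝓔 ++ members n 𝓕 ++ members n 𝓖) ≈ oneGA n
complete n n≥2 = Rep⇒≈ (Rep-ext total (subst (λ x → Rep n x S) (sym sums) (Rep-add (family 𝓔) (Rep-add (family 𝓕) (family 𝓖))))) (one-Rep n)
  where
  S : Fn
  S σ = ∑ (indices 𝓔 n) (λ i → ef 𝓔 i σ) +q (∑ (indices 𝓕 n) (λ i → ef 𝓕 i σ) +q ∑ (indices 𝓖 n) (λ i → ef 𝓖 i σ))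
  sums : sumGA (members n 𝓔 ++ members n 𝓕 ++ members n 𝓖) ≡ sumGA (members n 𝓔) ++ (sumGA (members n 𝓕) ++ sumGA (members n 𝓖))
  sums = trans (sumGA-++ (members n 𝓔) (members n 𝓕 ++ members n 𝓖)) (cong (sumGA (members n 𝓔) ++_) (sumGA-++ (members n 𝓕) (members n 𝓖)))
  family : ∀ t → Rep n (sumGA (members n t)) (λ σ → ∑ (indices t n) (λ i → ef t i σ))
  family t = Rep-sum (elem n t) (ef t) (elem-Rep n t) (indices t n)
  total : ∀ σ → IsPerm n σ → S σ ≡ χ true σ
  total σ p = begin
    S σ
      ≡⟨ cong₂ _+q_ (all 𝓔) (cong₂ _+q_ (all 𝓕) (all 𝓖)) ⟩
    ∑< (suc n) (λ i → ef 𝓔 i σ) +q (∑< (suc n) (λ i → ef 𝓕 i σ) +q ∑< (suc n) (λ i → ef 𝓖 i σ))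
      ≡⟨ sym (trans (∑<-+ (suc n) (λ i → ef 𝓔 i σ) (λ i → ef 𝓕 i σ +q ef 𝓖 i σ)) (cong (∑< (suc n) (λ i → ef 𝓔 i σ) +q_) (∑<-+ (suc n) (λ i → ef 𝓕 i σ) (λ i → ef 𝓖 i σ)))) ⟩
    ∑< (suc n) (λ i → ef 𝓔 i σ +q (ef 𝓕 i σ +q ef 𝓖 i σ))
      ≡⟨ ∑<-cong (suc n) (λ i _ → ef-total i σ) ⟩
    ∑< (suc n) (λ i → Jc true i σ)
      ≡⟨ sym (evalP-at-1 (suc n) (λ i → Jc true i σ)) ⟩
    evalP (suc n) (λ i → Jc true i σ) (ι 1)
      -- V_1^+ is the odd family at the argument 1, where a polynomial equals the sum of its
      -- coefficients.
      ≡⟨ sym (N-odd true 0 (suc n) σ (s≤s (ℕₚ.≤-reflexive (IsPerm-length p)))) ⟩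
    conv (χ true) unit σ
      ≡⟨ conv-unitʳ (χ true) σ ⟩
    χ true σ ∎
    where
    open ≡-Reasoning
    all : ∀ t → ∑ (indices t n) (λ i → ef t i σ) ≡ ∑< (suc n) (λ i → ef t i σ)
    all t = ∑-indices t n σ (IsPerm-length p) n≥2

theorem5p5 : (n : ℕ) → 2 ≤ n → CompletePOI n (idempotents n)
theorem5p5 n n≥2 =
  All-members n (λ t i _ → elem-InW n n≥2 t i) ,
  All-members n (λ t i x → elem-idempotent n t i (Index-≤ n t x)) ,
  AllPairs-lookup (all-orthogonal n) ,
  complete n n≥2 ,
  All-members n (λ t i x → elem-primitive n n≥2 t i (Index-≤ n t x) (ef-nonzero n t i x))
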